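{- Let $n\ge 7$ be odd with $5\mid n$. Then $\mathcal K_n=\{3,4,\dots,n-3\}$.
   Context: The multiplicative inverse function $f_{\mathrm{inv}}$ of $\mathbb F_{2^n}$ is defined by $f_{\mathrm{inv}}(x)=x^{ -1}$ for $x\ne 0$ and $f_{\mathrm{inv}}(0)=0$. A function $f:\mathbb F_{2^n}\to\mathbb F_{2^n}$ is $k$th order sum-free if $\sum_{x\in A}f(x)\ne 0$ for every $k$-dimensional $\mathbb F_2$-affine subspace $A$ of $\mathbb F_{2^n}$. For $n\ge 2$, $\mathcal K_n=\{1\le k\le n-1: f_{\mathrm{inv}}\text{ is not $k$th order sum-free on }\mathbb F_{2^n}\}$. (The paper states this as "if $5\mid n$ then the conjecture $\mathcal K_n=\{3,\dots,n-3\}$ for odd $n\ge 7$ holds for $n$".) -}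

module Defs where

-- Model of F_{2^n}: F_2[x]/(P) where P = x^n + p_{n-1}x^{n-1} + ... + p_0
-- is a monic polynomial of degree n, and the quotient is required to be a field.
-- An element is a Vec Bool n: index i holds the coefficient of x^i.

open import Data.Bool using (Bool; true; false; _xor_; if_then_else_)
open import Data.Bool.Properties renaming (_≟_ to _≟B_)
open import Data.Nat using (ℕ; zero; suc; _≤_; _∸_)
open import Data.Vec using (Vec; []; _∷_; replicate; zipWith; map)
open import Data.Vec.Properties using (≡-dec)
open import Data.List using (List; []; _∷_; _++_; foldr)
import Data.List as L
open import Data.Product using (_×_; _,_; ∃)
open import Relation.Nullary using (¬_; does)
open import Relation.Binary.PropositionalEquality using (_≡_; _≢_)

F : ℕ → Set
F n = Vec Bool n

0F : ∀ {n} → F n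
0F = replicate _ false

1F : ∀ {n} → F n
1F {zero}  = []
1F {suc n} = true ∷ replicate n false

_⊕_ : ∀ {n} → F n → F n → F n
_⊕_ = zipWith _xor_
infixl 6 _⊕_

_≟F_ : ∀ {n} (x y : F n) → Relation.Nullary.Dec (x ≡ y)
_≟F_ = ≡-dec _≟B_

push : ∀ {n} → Bool → Vec Bool n → Vec Bool n × Bool
push b []       = [] , b
push b (x ∷ xs) with push x xs
... | ys , o = b ∷ ys , o

-- multiplication by x modulo P (p = lower coefficients of P)
mulX : ∀ {n} → F n → F n → F n
mulX p a with push false a
... | s , o = if o then s ⊕ p else s

mulAux : ∀ {m n} → F n → Vec Bool m → F n → F n
mulAux p []       cur = 0F
mulAux p (a ∷ as) cur = (if a then cur else 0F) ⊕ mulAux p as (mulX p cur)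

mul : ∀ {n} → F n → F n → F n → F n
mul p a b = mulAux p a b

IsFieldModulus : ∀ {n} → F n → Set
IsFieldModulus p = ∀ x → x ≢ 0F → ∃ λ y → mul p x y ≡ 1F

allVecs : ∀ k → List (Vec Bool k)
allVecs zero    = [] ∷ []
allVecs (suc k) = L.map (false ∷_) (allVecs k) ++ L.map (true ∷_) (allVecs k)

searchInv : ∀ {n} → F n → F n → List (F n) → F n
searchInv p x []       = 0F
searchInv p x (y ∷ ys) = if does (mul p x y ≟F 1F) then y else searchInv p x ys

finv : ∀ {n} → F n → F n → F n
finv {n} p x = if does (x ≟F 0F) then 0F else searchInv p x (allVecs n)

combo : ∀ {n k} → Vec Bool k → Vec (F n) k → F n
combo []       []       = 0F
combo (c ∷ cs) (v ∷ vs) = (if c then v else 0F) ⊕ combo cs vs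

LinIndep : ∀ {n k} → Vec (F n) k → Set
LinIndep {k = k} vs = ∀ c → combo c vs ≡ 0F → c ≡ replicate k false

-- sum of f over the affine subspace a + span(v_1..v_k)
-- (with v_i independent, c ↦ a + Σ c_i v_i enumerates the subspace bijectively)
sumAffine : ∀ {n k} → (F n → F n) → F n → Vec (F n) k → F n
sumAffine {k = k} f a vs = foldr _⊕_ 0F (L.map (λ c → f (a ⊕ combo c vs)) (allVecs k))

SumFree : ∀ {n} → ℕ → (F n → F n) → Set
SumFree {n} k f = ∀ (a : F n) (vs : Vec (F n) k) → LinIndep vs → sumAffine f a vs ≢ 0F

InK : ∀ {n} → F n → ℕ → Set
InK {n} p k = 1 ≤ k × k ≤ n ∸ 1 × ¬ SumFree k (finv p)

{-# OPTIONS --safe #-}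
module Submission where

-- For independent vectors spanning a subspace E, let L_E(x) = ∏ (x + u) over u ∈ E and let c be the product of the
-- nonzero elements of E.  The inverses over a coset a + E ≠ E sum to c / L_E(a) ≠ 0, so only linear subspaces matter;
-- call E zero-sum if its inverses sum to 0.  Grouping cosets, s(H) = s(E) + c · s(L_E(H)) for E ⊆ H.  Hence:
--   * if E ⊆ H are zero-sum, then so is L_E(H); as 𝔽 itself is zero-sum, the dimensions are symmetric under k ↦ n − k;
--   * if k l < n, zero-sum spaces of dimensions k and l give one of dimension k + l, since some multiple of
--     the second lies in the image of L_E for E the first.
-- Every subspace over the subfield 𝔽₃₂ is zero-sum, so zero-sum dimensions l yield 5h − l for l ≤ h ≤ n/5.
-- The residues modulo 5 thus reduce everything to k = 3 and k = 4.  These are obtained by counting solutions of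
-- trace conditions; the character sums that occur are bounded through the fourth moment of Kloosterman sums.
-- Dimensions 1 and 2 (hence n − 1 and n − 2) are impossible because x² + x + 1 has no root for odd n.

open import Defs
open import Data.Nat using (ℕ; _≤_; _∸_; _%_)
open import Data.Nat.Divisibility using (_∣_)
open import Data.Product using (_×_)
open import Function.Bundles using (_⇔_)
open import Relation.Binary.PropositionalEquality using (_≡_)

open import Algebra.Bundles using (CommutativeRing; RawRing)
open import Algebra.Structures using (IsCommutativeMonoid; IsCommutativeRing)
import Algebra.Properties.CommutativeSemiring.Exp as Exp
import Algebra.Solver.Ring as RingSolver
open import Algebra.Solver.Ring.AlmostCommutativeRing using (fromCommutativeRing; _-Raw-AlmostCommutative⟶_)
open import Data.Bool using (Bool; true; false; _xor_; _∧_; not; if_then_else_)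
import Data.Bool.Properties as Bool
open import Data.Empty using (⊥; ⊥-elim)
open import Data.List as List using (List; []; _∷_; length)
import Data.List.Properties as List
open import Data.List.Membership.Propositional using (_∈_)
open import Data.List.Membership.Propositional.Properties
  using (∈-map⁺; ∈-map⁻; ∈-++⁺ˡ; ∈-++⁺ʳ; ∈-++⁻; ∈-∃++)
open import Data.List.Relation.Binary.Permutation.Propositional using (_↭_; ↭-refl; ↭-trans; prep; ↭⇒↭ₛ)
open import Data.List.Relation.Binary.Permutation.Propositional.Properties using (shift; ↭-length; ∈-resp-↭; map⁺)
import Data.List.Relation.Binary.Permutation.Setoid.Properties as Permutation
open import Data.List.Relation.Binary.Subset.Propositional using (_⊆_)
open import Data.List.Relation.Unary.All as All using (All; []; _∷_)
open import Data.List.Relation.Unary.AllPairs using ([]; _∷_)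
open import Data.List.Relation.Unary.Any as Any using (here; there)
open import Data.List.Relation.Unary.Unique.Propositional using (Unique)
import Data.List.Relation.Unary.Unique.Propositional.Properties as Unique
open import Data.Maybe using (Maybe; nothing; just)
open import Data.Nat as ℕ using (zero; suc; _<_; z≤n; s≤s; s<s)
open import Data.Nat.DivMod using (m≡m%n+[m/n]*n; _divMod_; result)
open import Data.Nat.Divisibility using (divides)
import Data.Nat.Properties as ℕ
import Data.Nat.Tactic.RingSolver as ℕSolver
open import Data.Product using (_,_; proj₁; proj₂; ∃; ∃-syntax)
open import Data.Sum using (_⊎_; inj₁; inj₂)
open import Data.Unit using (tt)
open import Data.Vec as Vec using (Vec; []; _∷_; _∷ʳ_; replicate; toList)
import Data.Vec.Properties as Vec
open import Function using (_∘_; id)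
open import Function.Bundles using (mk⇔)
open import Function.Definitions using (Injective)
open import Level using (0ℓ)
open import Relation.Binary.PropositionalEquality
  using (_≢_; refl; sym; trans; cong; cong₂; subst; subst₂; setoid; isEquivalence; module ≡-Reasoning)
open import Relation.Nullary using (Dec; yes; no; ¬_; ¬?; does)
import Relation.Nullary.Decidable as Dec
open import Relation.Nullary.Decidable using (toWitness; _×-dec_; _→-dec_)
open import Relation.Unary using (Decidable)

-- Vectors over 𝔽₂ and multiplication modulo p

-- The bound l ≤ h arises because l vectors span at most l dimensions over 𝔽₃₂. With l = 3 and l = 4
-- the formula 5h - l reaches the residues 2 and 1 modulo 5 except for k = 7, 6 and 11; these come
-- from adding smaller dimensions or, for k = 11 and n = 15, from duality. Residues 3 and 4 are dual
-- to 2 and 1 because 5 divides n. An odd multiple of 5 that is at least 7 is at least 15, so q = 2ⁿ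
-- ≥ 32768. With this margin an elementary moment bound can stand in for Weil's: for a Kloosterman
-- sum it gives order q^(3/4) instead of 2√q, while the competing main term is q/3. Dimensions 3 and
-- 4 share one construction. A space containing 1 is zero-sum exactly when its image under x ↦ x² +
-- x has inverse sum 1. A space with inverse sum σ ≠ 0 acquires inverse sum 1 when scaled by σ, and
-- the scaled space lies in that image once its basis has trace 0. A subspace is a list of vectors
-- whose length is the dimension, and independence is the nonvanishing of one field element; this
-- turns linear algebra into identities.

⊕-assoc : ∀ {n} (x y z : F n) → (x ⊕ y) ⊕ z ≡ x ⊕ (y ⊕ z)
⊕-assoc = Vec.zipWith-assoc Bool.xor-assoc

⊕-comm : ∀ {n} (x y : F n) → x ⊕ y ≡ y ⊕ x
⊕-comm = Vec.zipWith-comm Bool.xor-comm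

⊕-identityˡ : ∀ {n} (x : F n) → 0F ⊕ x ≡ x
⊕-identityˡ = Vec.zipWith-identityˡ Bool.xor-identityˡ

⊕-identityʳ : ∀ {n} (x : F n) → x ⊕ 0F ≡ x
⊕-identityʳ = Vec.zipWith-identityʳ Bool.xor-identityʳ

⊕-self : ∀ {n} (x : F n) → x ⊕ x ≡ 0F
⊕-self []       = refl
⊕-self (b ∷ x) = cong₂ _∷_ (Bool.xor-same b) (⊕-self x)

⊕-isCommutativeMonoid : ∀ {n} → IsCommutativeMonoid _≡_ (_⊕_ {n}) 0F
⊕-isCommutativeMonoid = record
  { isMonoid = record
    { isSemigroup = record
      { isMagma = record { isEquivalence = isEquivalence ; ∙-cong = cong₂ _⊕_ }
      ; assoc = ⊕-assoc }
    ; identity = ⊕-identityˡ , ⊕-identityʳ }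
  ; comm = ⊕-comm }

⊕-interchange : ∀ {n} (a b c d : F n) → (a ⊕ b) ⊕ (c ⊕ d) ≡ (a ⊕ c) ⊕ (b ⊕ d)
⊕-interchange a b c d = begin
  (a ⊕ b) ⊕ (c ⊕ d) ≡⟨ ⊕-assoc a b _ ⟩
  a ⊕ (b ⊕ (c ⊕ d)) ≡⟨ cong (a ⊕_) (⊕-assoc b c d) ⟨
  a ⊕ ((b ⊕ c) ⊕ d) ≡⟨ cong (λ t → a ⊕ (t ⊕ d)) (⊕-comm b c) ⟩
  a ⊕ ((c ⊕ b) ⊕ d) ≡⟨ cong (a ⊕_) (⊕-assoc c b d) ⟩
  a ⊕ (c ⊕ (b ⊕ d)) ≡⟨ ⊕-assoc a c _ ⟨
  (a ⊕ c) ⊕ (b ⊕ d) ∎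
  where open ≡-Reasoning

⊕-cancel : ∀ {n} (x y : F n) → x ⊕ (x ⊕ y) ≡ y
⊕-cancel x y = trans (sym (⊕-assoc x x y)) (trans (cong (_⊕ y) (⊕-self x)) (⊕-identityˡ y))

⊕≡0⇒≡ : ∀ {n} (x y : F n) → x ⊕ y ≡ 0F → x ≡ y
⊕≡0⇒≡ x y e = sym (trans (sym (⊕-cancel x y)) (trans (cong (x ⊕_) e) (⊕-identityʳ x)))

infixr 8 _⊙_
_⊙_ : ∀ {n} → Bool → F n → F n
c ⊙ v = if c then v else 0F

⊙-distribˡ : ∀ {n} c (u v : F n) → c ⊙ (u ⊕ v) ≡ c ⊙ u ⊕ c ⊙ v
⊙-distribˡ false u v = sym (⊕-identityˡ 0F)
⊙-distribˡ true  u v = refl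

⊙-distribʳ : ∀ {n} c d (v : F n) → (c xor d) ⊙ v ≡ c ⊙ v ⊕ d ⊙ v
⊙-distribʳ false d     v = sym (⊕-identityˡ _)
⊙-distribʳ true  false v = sym (⊕-identityʳ v)
⊙-distribʳ true  true  v = sym (⊕-self v)

⊙-homo : ∀ {m n} (h : F m → F n) → h 0F ≡ 0F → ∀ c v → h (c ⊙ v) ≡ c ⊙ h v
⊙-homo h h0 false v = h0
⊙-homo h h0 true  v = refl

∈-allVecs : ∀ {k} (v : Vec Bool k) → v ∈ allVecs k
∈-allVecs []          = here refl
∈-allVecs (false ∷ v) = ∈-++⁺ˡ (∈-map⁺ (false ∷_) (∈-allVecs v))
∈-allVecs {suc k} (true ∷ v) =
  ∈-++⁺ʳ (List.map (false ∷_) (allVecs k)) (∈-map⁺ (true ∷_) (∈-allVecs v))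

push-⊕ : ∀ {n} b c (x y : Vec Bool n) →
         push (b xor c) (x ⊕ y) ≡
         (proj₁ (push b x) ⊕ proj₁ (push c y) , proj₂ (push b x) xor proj₂ (push c y))
push-⊕ b c []      []      = refl
push-⊕ b c (u ∷ x) (v ∷ y) rewrite push-⊕ u v x y = refl

push-∷ʳ : ∀ {n} b (x : Vec Bool n) c → push b (x ∷ʳ c) ≡ (b ∷ x , c)
push-∷ʳ b []      c = refl
push-∷ʳ b (u ∷ x) c rewrite push-∷ʳ u x c = refl

replicate-∷ʳ : ∀ n (b : Bool) → replicate n b ∷ʳ b ≡ replicate (suc n) b
replicate-∷ʳ zero    b = refl
replicate-∷ʳ (suc n) b = cong (b ∷_) (replicate-∷ʳ n b)

module Multiplication {n : ℕ} (p : F n) where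

  X : F n → F n
  X = mulX p

  X-push : ∀ a → X a ≡ proj₁ (push false a) ⊕ proj₂ (push false a) ⊙ p
  X-push a with push false a
  ... | s , false = sym (⊕-identityʳ s)
  ... | s , true  = refl

  X-⊕ : ∀ a b → X (a ⊕ b) ≡ X a ⊕ X b
  X-⊕ a b = begin
    X (a ⊕ b)                                    ≡⟨ X-push (a ⊕ b) ⟩
    proj₁ (push false (a ⊕ b)) ⊕ proj₂ (push false (a ⊕ b)) ⊙ p
      ≡⟨ cong (λ t → proj₁ t ⊕ proj₂ t ⊙ p) (push-⊕ false false a b) ⟩
    (s ⊕ t) ⊕ (o xor o′) ⊙ p                     ≡⟨ cong ((s ⊕ t) ⊕_) (⊙-distribʳ o o′ p) ⟩
    (s ⊕ t) ⊕ (o ⊙ p ⊕ o′ ⊙ p)                   ≡⟨ ⊕-interchange s t _ _ ⟩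
    (s ⊕ o ⊙ p) ⊕ (t ⊕ o′ ⊙ p)                   ≡⟨ cong₂ _⊕_ (X-push a) (X-push b) ⟨
    X a ⊕ X b                                    ∎
    where
    open ≡-Reasoning
    s  = proj₁ (push false a)
    t  = proj₁ (push false b)
    o  = proj₂ (push false a)
    o′ = proj₂ (push false b)

  X-0 : X 0F ≡ 0F
  X-0 = begin
    X 0F                ≡⟨ cong X (⊕-self 0F) ⟨
    X (0F ⊕ 0F)         ≡⟨ X-⊕ 0F 0F ⟩
    X 0F ⊕ X 0F         ≡⟨ ⊕-self (X 0F) ⟩
    0F                  ∎
    where open ≡-Reasoning

  mulAux-⊕ʳ : ∀ {m} (as : Vec Bool m) u v → mulAux p as (u ⊕ v) ≡ mulAux p as u ⊕ mulAux p as v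
  mulAux-⊕ʳ []       u v = sym (⊕-identityˡ 0F)
  mulAux-⊕ʳ (a ∷ as) u v = begin
    a ⊙ (u ⊕ v) ⊕ mulAux p as (X (u ⊕ v))
      ≡⟨ cong₂ _⊕_ (⊙-distribˡ a u v) (trans (cong (mulAux p as) (X-⊕ u v)) (mulAux-⊕ʳ as (X u) (X v))) ⟩
    (a ⊙ u ⊕ a ⊙ v) ⊕ (mulAux p as (X u) ⊕ mulAux p as (X v))
      ≡⟨ ⊕-interchange (a ⊙ u) (a ⊙ v) _ _ ⟩
    (a ⊙ u ⊕ mulAux p as (X u)) ⊕ (a ⊙ v ⊕ mulAux p as (X v)) ∎
    where open ≡-Reasoning

  mulAux-zeroʳ : ∀ {m} (as : Vec Bool m) → mulAux p as 0F ≡ 0F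
  mulAux-zeroʳ as = begin
    mulAux p as 0F                      ≡⟨ cong (mulAux p as) (⊕-self 0F) ⟨
    mulAux p as (0F ⊕ 0F)               ≡⟨ mulAux-⊕ʳ as 0F 0F ⟩
    mulAux p as 0F ⊕ mulAux p as 0F     ≡⟨ ⊕-self (mulAux p as 0F) ⟩
    0F                                  ∎
    where open ≡-Reasoning

  mulAux-X : ∀ {m} (as : Vec Bool m) v → mulAux p as (X v) ≡ X (mulAux p as v)
  mulAux-X []       v = sym X-0
  mulAux-X (a ∷ as) v = begin
    a ⊙ X v ⊕ mulAux p as (X (X v))     ≡⟨ cong₂ _⊕_ (sym (⊙-homo X X-0 a v)) (mulAux-X as (X v)) ⟩
    X (a ⊙ v) ⊕ X (mulAux p as (X v))   ≡⟨ X-⊕ (a ⊙ v) _ ⟨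
    X (a ⊙ v ⊕ mulAux p as (X v))       ∎
    where open ≡-Reasoning

  -- Both factors act as polynomials in the one operator `X`, hence commute. Together with
  -- `·-identityʳ` this gives commutativity and then associativity of the product.
  mulAux-commute : ∀ {m m′} (as : Vec Bool m) (bs : Vec Bool m′) v →
                   mulAux p as (mulAux p bs v) ≡ mulAux p bs (mulAux p as v)
  mulAux-commute []       bs v = sym (mulAux-zeroʳ bs)
  mulAux-commute (a ∷ as) bs v = begin
    a ⊙ mulAux p bs v ⊕ mulAux p as (X (mulAux p bs v))
      ≡⟨ cong₂ _⊕_ (sym (⊙-homo (mulAux p bs) (mulAux-zeroʳ bs) a v)) (cong (mulAux p as) (sym (mulAux-X bs v))) ⟩
    mulAux p bs (a ⊙ v) ⊕ mulAux p as (mulAux p bs (X v))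
      ≡⟨ cong (mulAux p bs (a ⊙ v) ⊕_) (mulAux-commute as bs (X v)) ⟩
    mulAux p bs (a ⊙ v) ⊕ mulAux p bs (mulAux p as (X v))
      ≡⟨ mulAux-⊕ʳ bs (a ⊙ v) _ ⟨
    mulAux p bs (a ⊙ v ⊕ mulAux p as (X v)) ∎
    where open ≡-Reasoning

  -- ι is a ↦ a·x^(n−m), on which X acts by shifting as long as nothing overflows.
  mulAux-shifted-1 : ∀ {m} (ι : Vec Bool m → F n) → (∀ u v → ι (u ⊕ v) ≡ ι u ⊕ ι v) →
                     (∀ {l} (e : suc l ≡ m) (v : Vec Bool l) →
                        X (ι (subst (Vec Bool) e (v ∷ʳ false))) ≡ ι (subst (Vec Bool) e (false ∷ v))) →
                     ∀ as → mulAux p as (ι 1F) ≡ ι as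
  mulAux-shifted-1 ι ι-⊕ shiftX [] = begin
    0F              ≡⟨ ⊕-self (ι []) ⟨
    ι [] ⊕ ι []     ≡⟨ ι-⊕ [] [] ⟨
    ι []            ∎
    where open ≡-Reasoning
  mulAux-shifted-1 {suc m} ι ι-⊕ shiftX (a ∷ as) = begin
    a ⊙ ι 1F ⊕ mulAux p as (X (ι 1F))  ≡⟨ cong₂ _⊕_ (sym (⊙-homo ι ι0 a 1F)) (rest as) ⟩
    ι (a ⊙ 1F) ⊕ ι (false ∷ as)        ≡⟨ ι-⊕ _ _ ⟨
    ι (a ⊙ 1F ⊕ (false ∷ as))          ≡⟨ cong ι (lead a) ⟩
    ι (a ∷ as)                         ∎
    where
    open ≡-Reasoning
    ι0 : ι 0F ≡ 0F
    ι0 = begin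
      ι 0F          ≡⟨ cong ι (⊕-self 0F) ⟨
      ι (0F ⊕ 0F)   ≡⟨ ι-⊕ 0F 0F ⟩
      ι 0F ⊕ ι 0F   ≡⟨ ⊕-self (ι 0F) ⟩
      0F            ∎
    lead : ∀ a → a ⊙ 1F ⊕ (false ∷ as) ≡ a ∷ as
    lead false = ⊕-identityˡ (false ∷ as)
    lead true  = cong (true ∷_) (⊕-identityˡ as)
    rest : ∀ {l} {e : l ≡ m} (bs : Vec Bool l) → mulAux p bs (X (ι 1F)) ≡ ι (false ∷ subst (Vec Bool) e bs)
    rest {e = refl} []          = sym ι0
    rest {suc l} {refl} (b ∷ bs) = begin
      mulAux p (b ∷ bs) (X (ι 1F))
        -- A nonempty tail means that the top coefficient of 1 is zero, so multiplication by x is a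
        -- plain shift.
        ≡⟨ cong (λ t → mulAux p (b ∷ bs) (X (ι (true ∷ t)))) (replicate-∷ʳ l false) ⟨
      mulAux p (b ∷ bs) (X (ι ((true ∷ replicate l false) ∷ʳ false)))
        ≡⟨ cong (mulAux p (b ∷ bs)) (shiftX refl (true ∷ replicate l false)) ⟩
      mulAux p (b ∷ bs) (ι (false ∷ 1F))
        ≡⟨ mulAux-shifted-1 (ι ∘ (false ∷_)) (λ u v → ι-⊕ (false ∷ u) (false ∷ v))
             (λ { refl v → shiftX refl (false ∷ v) }) (b ∷ bs) ⟩
      ι (false ∷ b ∷ bs) ∎

  infixl 7 _·_
  _·_ : F n → F n → F n
  a · b = mul p a b

  ·-identityʳ : ∀ a → a · 1F ≡ a
  ·-identityʳ = mulAux-shifted-1 id (λ _ _ → refl) shiftX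
    where
    shiftX : ∀ {l} (e : suc l ≡ n) (v : Vec Bool l) →
            X (subst (Vec Bool) e (v ∷ʳ false)) ≡ subst (Vec Bool) e (false ∷ v)
    shiftX refl v = begin
      X (v ∷ʳ false)   ≡⟨ X-push (v ∷ʳ false) ⟩
      proj₁ (push false (v ∷ʳ false)) ⊕ proj₂ (push false (v ∷ʳ false)) ⊙ p
        ≡⟨ cong (λ t → proj₁ t ⊕ proj₂ t ⊙ p) (push-∷ʳ false v false) ⟩
      (false ∷ v) ⊕ 0F ≡⟨ ⊕-identityʳ (false ∷ v) ⟩
      false ∷ v        ∎
      where open ≡-Reasoning

  ·-comm : ∀ a b → a · b ≡ b · a
  ·-comm a b = begin
    a · b         ≡⟨ cong (a ·_) (·-identityʳ b) ⟨
    a · (b · 1F)  ≡⟨ mulAux-commute a b 1F ⟩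
    b · (a · 1F)  ≡⟨ cong (b ·_) (·-identityʳ a) ⟩
    b · a         ∎
    where open ≡-Reasoning

  ·-identityˡ : ∀ a → 1F · a ≡ a
  ·-identityˡ a = trans (·-comm 1F a) (·-identityʳ a)

  ·-assoc : ∀ a b c → (a · b) · c ≡ a · (b · c)
  ·-assoc a b c = begin
    (a · b) · c  ≡⟨ ·-comm (a · b) c ⟩
    c · (a · b)  ≡⟨ mulAux-commute c a b ⟩
    a · (c · b)  ≡⟨ cong (a ·_) (·-comm c b) ⟩
    a · (b · c)  ∎
    where open ≡-Reasoning

  ·-distribˡ : ∀ a b c → a · (b ⊕ c) ≡ a · b ⊕ a · c
  ·-distribˡ = mulAux-⊕ʳ

  ·-distribʳ : ∀ a b c → (b ⊕ c) · a ≡ b · a ⊕ c · a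
  ·-distribʳ a b c = trans (·-comm (b ⊕ c) a) (trans (·-distribˡ a b c) (cong₂ _⊕_ (·-comm a b) (·-comm a c)))

  ⊕-·-isCommutativeRing : IsCommutativeRing _≡_ _⊕_ _·_ id 0F 1F
  ⊕-·-isCommutativeRing = record
    { isRing = record
      { +-isAbelianGroup = record
        { isGroup = record
          { isMonoid = IsCommutativeMonoid.isMonoid ⊕-isCommutativeMonoid
          ; inverse = ⊕-self , ⊕-self
          ; ⁻¹-cong = id }
        ; comm = ⊕-comm }
      ; *-cong = cong₂ _·_
      ; *-assoc = ·-assoc
      ; *-identity = ·-identityˡ , ·-identityʳ
      ; distrib = ·-distribˡ , ·-distribʳ }
    ; *-comm = ·-comm }

  searchInv-∈ : ∀ x ys {y} → x · y ≡ 1F → y ∈ ys → x · searchInv p x ys ≡ 1F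
  searchInv-∈ x (z ∷ ys) e m with (x · z) ≟F 1F
  ... | yes e′ = e′
  searchInv-∈ x (z ∷ ys) e (here refl) | no ne = ⊥-elim (ne e)
  searchInv-∈ x (z ∷ ys) e (there m)   | no _  = searchInv-∈ x ys e m

  finv-0 : finv p 0F ≡ 0F
  finv-0 with 0F {n} ≟F 0F
  ... | yes _ = refl
  ... | no ne = ⊥-elim (ne refl)

  finv-inverseʳ : IsFieldModulus p → ∀ x → x ≢ 0F → x · finv p x ≡ 1F
  finv-inverseʳ field-p x x≢0 with x ≟F 0F
  ... | yes e = ⊥-elim (x≢0 e)
  ... | no _  = searchInv-∈ x (allVecs n) (proj₂ (field-p x x≢0)) (∈-allVecs _)

-- Sums over all vectors

module FiniteSums where

  open import Data.List using (_++_; foldr)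
  open import Data.Nat using (_+_; _^_)

  unique-⊆⇒↭ : ∀ {A : Set} {xs ys : List A} → Unique xs → xs ⊆ ys → ∃[ zs ] ys ↭ xs ++ zs
  unique-⊆⇒↭ {xs = []} {ys} _ _ = ys , ↭-refl
  unique-⊆⇒↭ {xs = x ∷ xs} (x∉ ∷ u) sub with ∈-∃++ (sub (here refl))
  ... | as , bs , refl with unique-⊆⇒↭ u sub′
    where
    sub′ : xs ⊆ as ++ bs
    sub′ {y} y∈ with ∈-++⁻ as (sub (there y∈))
    ... | inj₁ y∈as         = ∈-++⁺ˡ y∈as
    ... | inj₂ (here refl)  = ⊥-elim (All.lookup x∉ y∈ refl)
    ... | inj₂ (there y∈bs) = ∈-++⁺ʳ as y∈bs
  ... | zs , π = zs , ↭-trans (shift x as bs) (prep x π)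

  allVecs-length : ∀ k → length (allVecs k) ≡ 2 ^ k
  allVecs-length zero    = refl
  allVecs-length (suc k) = begin
    length (List.map (false ∷_) (allVecs k) ++ List.map (true ∷_) (allVecs k))
      ≡⟨ List.length-++ (List.map (false ∷_) (allVecs k)) ⟩
    length (List.map (false ∷_) (allVecs k)) + length (List.map (true ∷_) (allVecs k))
      ≡⟨ cong₂ _+_ (List.length-map (false ∷_) (allVecs k)) (List.length-map (true ∷_) (allVecs k)) ⟩
    length (allVecs k) + length (allVecs k) ≡⟨ cong₂ _+_ (allVecs-length k) (allVecs-length k) ⟩
    2 ^ k + 2 ^ k                           ≡⟨ cong (2 ^ k +_) (ℕ.+-identityʳ (2 ^ k)) ⟨
    2 ^ suc k                               ∎
    where open ≡-Reasoning

  allVecs-unique : ∀ k → Unique (allVecs k)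
  allVecs-unique zero    = [] ∷ []
  allVecs-unique (suc k) =
    Unique.++⁺ (Unique.map⁺ Vec.∷-injectiveʳ (allVecs-unique k)) (Unique.map⁺ Vec.∷-injectiveʳ (allVecs-unique k)) disjoint
    where
    disjoint : ∀ {v} → ¬ (v ∈ List.map (false ∷_) (allVecs k) × v ∈ List.map (true ∷_) (allVecs k))
    disjoint (m₁ , m₂) with ∈-map⁻ (false ∷_) m₁ | ∈-map⁻ (true ∷_) m₂
    ... | _ , _ , refl | _ , _ , ()

  ∃? : ∀ {k} {P : Vec Bool k → Set} → Decidable P → Dec (∃ P)
  ∃? {k} P? = Dec.map′ Any.satisfied (λ (v , pv) → Any.map (λ { refl → pv }) (∈-allVecs v)) (Any.any? P? (allVecs k))

  module _ {k l : ℕ} {σ : Vec Bool k → Vec Bool l} (σ-injective : Injective _≡_ _≡_ σ) where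

    -- The pigeonhole principle as a permutation: comparing lengths gives k ≤ l, and for k = l the
    -- remainder is empty, so that sums are invariant under every injection.
    allVecs-embed : ∃[ zs ] allVecs l ↭ List.map σ (allVecs k) ++ zs
    allVecs-embed = unique-⊆⇒↭ (Unique.map⁺ σ-injective (allVecs-unique k)) (λ _ → ∈-allVecs _)

    2^k+rest : 2 ^ l ≡ 2 ^ k + length (proj₁ allVecs-embed)
    2^k+rest = begin
      2 ^ l                                       ≡⟨ allVecs-length l ⟨
      length (allVecs l)                          ≡⟨ ↭-length (proj₂ allVecs-embed) ⟩
      length (List.map σ (allVecs k) ++ zs)       ≡⟨ List.length-++ (List.map σ (allVecs k)) ⟩
      length (List.map σ (allVecs k)) + length zs ≡⟨ cong (_+ length zs) (trans (List.length-map σ (allVecs k)) (allVecs-length k)) ⟩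
      2 ^ k + length zs                           ∎
      where
      open ≡-Reasoning
      zs = proj₁ allVecs-embed

    injective⇒≤ : k ≤ l
    injective⇒≤ = ℕ.≮⇒≥ λ l<k → ℕ.<⇒≱ (ℕ.^-monoʳ-< 2 (s<s (s≤s z≤n)) l<k)
                    (ℕ.≤-trans (ℕ.m≤m+n (2 ^ k) _) (ℕ.≤-reflexive (sym 2^k+rest)))

  injective⇒↭ : ∀ {k} {σ : Vec Bool k → Vec Bool k} → Injective _≡_ _≡_ σ → allVecs k ↭ List.map σ (allVecs k)
  injective⇒↭ {k} {σ} inj with allVecs-embed inj | 2^k+rest inj
  ... | [] , π    | _ = subst (allVecs k ↭_) (List.++-identityʳ (List.map σ (allVecs k))) π
  ... | z ∷ zs , _ | e = ⊥-elim (ℕ.m≢1+m+n (2 ^ k) (trans e (ℕ.+-suc (2 ^ k) _)))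

  injective⇒surjective : ∀ {k} {σ : Vec Bool k → Vec Bool k} → Injective _≡_ _≡_ σ → ∀ y → ∃[ x ] y ≡ σ x
  injective⇒surjective {σ = σ} inj y with ∈-map⁻ σ (∈-resp-↭ (injective⇒↭ inj) (∈-allVecs y))
  ... | x , _ , e = x , e

  module Sum {A : Set} {_∙_ : A → A → A} {ε : A} (isCM : IsCommutativeMonoid _≡_ _∙_ ε) where

    open IsCommutativeMonoid isCM using (assoc; comm; identityˡ; identityʳ; isMonoid)

    opaque
      -- Kept opaque so that a sum remains an atom instead of unfolding into its 2ᵏ terms.
      ∑ : ∀ {k} → (Vec Bool k → A) → A
      ∑ {k} f = foldr _∙_ ε (List.map f (allVecs k))

    private
      foldr-++ : ∀ xs ys → foldr _∙_ ε (xs ++ ys) ≡ foldr _∙_ ε xs ∙ foldr _∙_ ε ys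
      foldr-++ []       ys = sym (identityˡ _)
      foldr-++ (x ∷ xs) ys = trans (cong (x ∙_) (foldr-++ xs ys)) (sym (assoc x _ _))

    opaque
      unfolding ∑

      ∑-foldr : ∀ {k} (f : Vec Bool k → A) → ∑ f ≡ foldr _∙_ ε (List.map f (allVecs k))
      ∑-foldr f = refl

      ∑-zero : ∀ f → ∑ {0} f ≡ f []
      ∑-zero f = identityʳ (f [])

      ∑-suc : ∀ {k} (f : Vec Bool (suc k) → A) → ∑ f ≡ ∑ (f ∘ (false ∷_)) ∙ ∑ (f ∘ (true ∷_))
      ∑-suc {k} f = begin
        foldr _∙_ ε (List.map f (List.map (false ∷_) vs ++ List.map (true ∷_) vs))
          ≡⟨ cong (foldr _∙_ ε) (List.map-++ f (List.map (false ∷_) vs) (List.map (true ∷_) vs)) ⟩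
        foldr _∙_ ε (List.map f (List.map (false ∷_) vs) ++ List.map f (List.map (true ∷_) vs))
          ≡⟨ foldr-++ (List.map f (List.map (false ∷_) vs)) _ ⟩
        foldr _∙_ ε (List.map f (List.map (false ∷_) vs)) ∙ foldr _∙_ ε (List.map f (List.map (true ∷_) vs))
          ≡⟨ cong₂ (λ s t → foldr _∙_ ε s ∙ foldr _∙_ ε t) (List.map-∘ vs) (List.map-∘ vs) ⟨
        ∑ (f ∘ (false ∷_)) ∙ ∑ (f ∘ (true ∷_)) ∎
        where
        open ≡-Reasoning
        vs : List (Vec Bool k)
        vs = allVecs k

      ∑-cong : ∀ {k} {f g : Vec Bool k → A} → (∀ x → f x ≡ g x) → ∑ f ≡ ∑ g
      ∑-cong {k} e = cong (foldr _∙_ ε) (List.map-cong e (allVecs k))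

    private
      interchange : ∀ a b c d → (a ∙ b) ∙ (c ∙ d) ≡ (a ∙ c) ∙ (b ∙ d)
      interchange a b c d = begin
        (a ∙ b) ∙ (c ∙ d) ≡⟨ assoc a b _ ⟩
        a ∙ (b ∙ (c ∙ d)) ≡⟨ cong (a ∙_) (assoc b c d) ⟨
        a ∙ ((b ∙ c) ∙ d) ≡⟨ cong (λ t → a ∙ (t ∙ d)) (comm b c) ⟩
        a ∙ ((c ∙ b) ∙ d) ≡⟨ cong (a ∙_) (assoc c b d) ⟩
        a ∙ (c ∙ (b ∙ d)) ≡⟨ assoc a c _ ⟨
        (a ∙ c) ∙ (b ∙ d) ∎
        where open ≡-Reasoning

    ∑-∙ : ∀ {k} (f g : Vec Bool k → A) → ∑ (λ x → f x ∙ g x) ≡ ∑ f ∙ ∑ g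
    ∑-∙ {zero}  f g = trans (∑-zero _) (sym (cong₂ _∙_ (∑-zero f) (∑-zero g)))
    ∑-∙ {suc k} f g = begin
      ∑ (λ x → f x ∙ g x) ≡⟨ ∑-suc _ ⟩
      ∑ (λ x → f (false ∷ x) ∙ g (false ∷ x)) ∙ ∑ (λ x → f (true ∷ x) ∙ g (true ∷ x))
        ≡⟨ cong₂ _∙_ (∑-∙ (f ∘ (false ∷_)) (g ∘ (false ∷_))) (∑-∙ (f ∘ (true ∷_)) (g ∘ (true ∷_))) ⟩
      (∑ (f ∘ (false ∷_)) ∙ ∑ (g ∘ (false ∷_))) ∙ (∑ (f ∘ (true ∷_)) ∙ ∑ (g ∘ (true ∷_)))
        ≡⟨ interchange (∑ (f ∘ (false ∷_))) _ _ _ ⟩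
      (∑ (f ∘ (false ∷_)) ∙ ∑ (f ∘ (true ∷_))) ∙ (∑ (g ∘ (false ∷_)) ∙ ∑ (g ∘ (true ∷_)))
        ≡⟨ cong₂ _∙_ (∑-suc f) (∑-suc g) ⟨
      ∑ f ∙ ∑ g ∎
      where open ≡-Reasoning

    ∑-homo : ∀ (h : A → A) → (∀ x y → h (x ∙ y) ≡ h x ∙ h y) → ∀ {k} (f : Vec Bool k → A) → ∑ (h ∘ f) ≡ h (∑ f)
    ∑-homo h h-∙ {zero}  f = trans (∑-zero _) (cong h (sym (∑-zero f)))
    ∑-homo h h-∙ {suc k} f = begin
      ∑ (h ∘ f)                                            ≡⟨ ∑-suc _ ⟩
      ∑ (λ x → h (f (false ∷ x))) ∙ ∑ (λ x → h (f (true ∷ x)))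
        ≡⟨ cong₂ _∙_ (∑-homo h h-∙ (f ∘ (false ∷_))) (∑-homo h h-∙ (f ∘ (true ∷_))) ⟩
      h (∑ (f ∘ (false ∷_))) ∙ h (∑ (f ∘ (true ∷_)))       ≡⟨ h-∙ _ _ ⟨
      h (∑ (f ∘ (false ∷_)) ∙ ∑ (f ∘ (true ∷_)))           ≡⟨ cong h (∑-suc f) ⟨
      h (∑ f)                                              ∎
      where open ≡-Reasoning

    ∑-swap : ∀ {k l} (f : Vec Bool k → Vec Bool l → A) → ∑ (λ x → ∑ (λ y → f x y)) ≡ ∑ (λ y → ∑ (λ x → f x y))
    ∑-swap {zero}  f = trans (∑-zero _) (∑-cong (λ y → sym (∑-zero (λ x → f x y))))
    ∑-swap {suc k} f = begin
      ∑ (λ x → ∑ (f x))                                                      ≡⟨ ∑-suc _ ⟩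
      ∑ (λ x → ∑ (f (false ∷ x))) ∙ ∑ (λ x → ∑ (f (true ∷ x)))               ≡⟨ cong₂ _∙_ (∑-swap (f ∘ (false ∷_))) (∑-swap (f ∘ (true ∷_))) ⟩
      ∑ (λ y → ∑ (λ x → f (false ∷ x) y)) ∙ ∑ (λ y → ∑ (λ x → f (true ∷ x) y)) ≡⟨ ∑-∙ _ _ ⟨
      ∑ (λ y → ∑ (λ x → f (false ∷ x) y) ∙ ∑ (λ x → f (true ∷ x) y))         ≡⟨ ∑-cong (λ y → ∑-suc (λ x → f x y)) ⟨
      ∑ (λ y → ∑ (λ x → f x y))                                              ∎
      where open ≡-Reasoning

    opaque
      unfolding ∑

      ∑-reindex : ∀ {k} {σ : Vec Bool k → Vec Bool k} → Injective _≡_ _≡_ σ → ∀ f → ∑ (f ∘ σ) ≡ ∑ f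
      ∑-reindex {k} {σ} inj f = begin
        foldr _∙_ ε (List.map (f ∘ σ) (allVecs k))          ≡⟨ cong (foldr _∙_ ε) (List.map-∘ (allVecs k)) ⟩
        foldr _∙_ ε (List.map f (List.map σ (allVecs k)))
          ≡⟨ Permutation.foldr-commMonoid (setoid A) isCM (↭⇒↭ₛ (map⁺ f (injective⇒↭ inj))) ⟨
        foldr _∙_ ε (List.map f (allVecs k))                ∎
        where open ≡-Reasoning

    ∑-ε : ∀ {k} → ∑ {k} (λ _ → ε) ≡ ε
    ∑-ε {zero}  = ∑-zero (λ _ → ε)
    ∑-ε {suc k} = trans (∑-suc {k} (λ _ → ε)) (trans (cong₂ _∙_ (∑-ε {k}) (∑-ε {k})) (identityˡ ε))

    ∑-only-0 : ∀ {k} (f : Vec Bool k → A) → (∀ x → x ≢ 0F → f x ≡ ε) → ∑ f ≡ f 0F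
    ∑-only-0 {zero}  f e = ∑-zero f
    ∑-only-0 {suc k} f e = begin
      ∑ f                                       ≡⟨ ∑-suc f ⟩
      ∑ (f ∘ (false ∷_)) ∙ ∑ (f ∘ (true ∷_))    ≡⟨ cong₂ _∙_ (∑-only-0 (f ∘ (false ∷_)) (λ x ne → e _ (ne ∘ Vec.∷-injectiveʳ)))
                                                              (trans (∑-cong (λ x → e (true ∷ x) (λ ()))) ∑-ε) ⟩
      f 0F ∙ ε                                  ≡⟨ identityʳ _ ⟩
      f 0F                                      ∎
      where open ≡-Reasoning

open FiniteSums

-- Fields with 2ⁿ elements

-- The arguments below start from these laws rather than from the polynomial model. Carrier and
-- addition stay concrete because sums run over bit vectors.
record BinaryField (n : ℕ) : Set where
  infixl 7 _·_
  field
    _·_               : F n → F n → F n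
    inv               : F n → F n
    isCommutativeRing : IsCommutativeRing _≡_ _⊕_ _·_ id 0F 1F
    inv-0             : inv 0F ≡ 0F
    ·-inverseʳ        : ∀ x → x ≢ 0F → x · inv x ≡ 1F
    1≢0               : 1F {n} ≢ 0F

module FieldProperties {n : ℕ} (𝔽 : BinaryField n) where

  open BinaryField 𝔽 public

  commutativeRing : CommutativeRing 0ℓ 0ℓ
  commutativeRing = record { isCommutativeRing = isCommutativeRing }

  open CommutativeRing commutativeRing public
    using (commutativeSemiring; *-isCommutativeMonoid)
    renaming ( *-assoc to ·-assoc; *-comm to ·-comm; *-identityˡ to ·-identityˡ; *-identityʳ to ·-identityʳ
             ; distribˡ to ·-distribˡ; distribʳ to ·-distribʳ; zeroˡ to ·-zeroˡ; zeroʳ to ·-zeroʳ )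
  open Exp commutativeSemiring public using (_^_; ^-homo-*; ^-assocʳ)

  private
    𝔽₂ : RawRing 0ℓ 0ℓ
    𝔽₂ = record { Carrier = Bool ; _≈_ = _≡_ ; _+_ = _xor_ ; _*_ = _∧_ ; -_ = id ; 0# = false ; 1# = true }

    𝔽₂⟶𝔽 : 𝔽₂ -Raw-AlmostCommutative⟶ fromCommutativeRing commutativeRing
    𝔽₂⟶𝔽 = record
      { ⟦_⟧    = _⊙ 1F
      ; +-homo = λ c d → ⊙-distribʳ c d 1F
      ; *-homo = λ { false d → sym (·-zeroˡ _) ; true d → sym (·-identityˡ _) }
      ; -‿homo = λ _ → refl
      ; 0-homo = refl
      ; 1-homo = refl }

    coefficient≟ : ∀ c d → Maybe (c ⊙ 1F {n} ≡ d ⊙ 1F)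
    coefficient≟ false false = just refl
    coefficient≟ true  true  = just refl
    coefficient≟ _     _     = nothing

  -- Coefficients in 𝔽₂ let the solver use that 2 = 0.
  module Solver = RingSolver 𝔽₂ (fromCommutativeRing commutativeRing) 𝔽₂⟶𝔽 coefficient≟

  ·-cancelˡ : ∀ {a x y} → a ≢ 0F → a · x ≡ a · y → x ≡ y
  ·-cancelˡ {a} {x} {y} a≢0 e = begin
    x                ≡⟨ lemma x ⟨
    inv a · (a · x)  ≡⟨ cong (inv a ·_) e ⟩
    inv a · (a · y)  ≡⟨ lemma y ⟩
    y                ∎
    where
    open ≡-Reasoning
    lemma : ∀ z → inv a · (a · z) ≡ z
    lemma z = begin
      inv a · (a · z)  ≡⟨ ·-assoc (inv a) a z ⟨
      (inv a · a) · z  ≡⟨ cong (_· z) (trans (·-comm (inv a) a) (·-inverseʳ a a≢0)) ⟩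
      1F · z           ≡⟨ ·-identityˡ z ⟩
      z                ∎

  ·≡0 : ∀ x y → x · y ≡ 0F → x ≡ 0F ⊎ y ≡ 0F
  ·≡0 x y e with x ≟F 0F
  ... | yes x≡0 = inj₁ x≡0
  ... | no x≢0  = inj₂ (·-cancelˡ x≢0 (trans e (sym (·-zeroʳ x))))

  ·≢0 : ∀ {x y} → x ≢ 0F → y ≢ 0F → x · y ≢ 0F
  ·≢0 x≢0 y≢0 e with ·≡0 _ _ e
  ... | inj₁ e′ = x≢0 e′
  ... | inj₂ e′ = y≢0 e′

  ·≡1⇒≢0ˡ : ∀ {x y} → x · y ≡ 1F → x ≢ 0F
  ·≡1⇒≢0ˡ e refl = 1≢0 (trans (sym e) (·-zeroˡ _))

  inv-unique : ∀ {x y} → x · y ≡ 1F → y ≡ inv x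
  inv-unique {x} e = ·-cancelˡ (·≡1⇒≢0ˡ e) (trans e (sym (·-inverseʳ x (·≡1⇒≢0ˡ e))))

  inv-≢0 : ∀ {x} → x ≢ 0F → inv x ≢ 0F
  inv-≢0 {x} x≢0 e = 1≢0 (trans (sym (·-inverseʳ x x≢0)) (trans (cong (x ·_) e) (·-zeroʳ x)))

  ·-inverseˡ : ∀ x → x ≢ 0F → inv x · x ≡ 1F
  ·-inverseˡ x x≢0 = trans (·-comm (inv x) x) (·-inverseʳ x x≢0)

  inv-involutive : ∀ x → inv (inv x) ≡ x
  inv-involutive x with x ≟F 0F
  ... | yes refl = trans (cong inv inv-0) inv-0
  ... | no x≢0   = sym (inv-unique (·-inverseˡ x x≢0))

  inv-injective : Injective _≡_ _≡_ inv
  inv-injective {x} {y} e = trans (sym (inv-involutive x)) (trans (cong inv e) (inv-involutive y))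

  inv-1 : inv 1F ≡ 1F
  inv-1 = sym (inv-unique (·-identityˡ 1F))

  inv-· : ∀ x y → inv (x · y) ≡ inv x · inv y
  inv-· x y with x ≟F 0F | y ≟F 0F
  ... | yes refl | _        = trans (cong inv (·-zeroˡ y)) (trans inv-0 (sym (trans (cong (_· inv y) inv-0) (·-zeroˡ _))))
  ... | no _     | yes refl = trans (cong inv (·-zeroʳ x)) (trans inv-0 (sym (trans (cong (inv x ·_) inv-0) (·-zeroʳ _))))
  ... | no x≢0   | no y≢0   = sym (inv-unique (begin
    (x · y) · (inv x · inv y)  ≡⟨ solve 4 (λ x y u v → (x :* y) :* (u :* v) := (x :* u) :* (y :* v)) refl x y (inv x) (inv y) ⟩
    (x · inv x) · (y · inv y)  ≡⟨ cong₂ _·_ (·-inverseʳ x x≢0) (·-inverseʳ y y≢0) ⟩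
    1F · 1F                    ≡⟨ ·-identityˡ 1F ⟩
    1F                         ∎))
    where
    open ≡-Reasoning
    open Solver

  ⊕-injective : ∀ (a : F n) → Injective _≡_ _≡_ (_⊕ a)
  ⊕-injective a {x} {y} e = begin
    x            ≡⟨ ⊕-cancel a x ⟨
    a ⊕ (a ⊕ x)  ≡⟨ cong (a ⊕_) (trans (⊕-comm a x) (trans e (⊕-comm y a))) ⟩
    a ⊕ (a ⊕ y)  ≡⟨ ⊕-cancel a y ⟩
    y            ∎
    where open ≡-Reasoning

  idempotent⇒0∨1 : ∀ x → x · x ⊕ x ≡ 0F → x ≡ 0F ⊎ x ≡ 1F
  idempotent⇒0∨1 x e with ·≡0 x (x ⊕ 1F) (trans (solve 1 (λ x → x :* (x :+ con true) := x :* x :+ x) refl x) e)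
    where open Solver
  ... | inj₁ e′ = inj₁ e′
  ... | inj₂ e′ = inj₂ (⊕≡0⇒≡ x 1F e′)

  private module ∏ = Sum *-isCommutativeMonoid
  open ∏ using () renaming (∑ to ∏)

  ∏-const : ∀ k a → ∏ {k} (λ _ → a) ≡ a ^ (2 ℕ.^ k)
  ∏-const zero    a = trans (∏.∑-zero (λ _ → a)) (sym (·-identityʳ a))
  ∏-const (suc k) a = begin
    ∏ {suc k} (λ _ → a)                   ≡⟨ ∏.∑-suc {k} (λ _ → a) ⟩
    ∏ {k} (λ _ → a) · ∏ {k} (λ _ → a)     ≡⟨ cong₂ _·_ (∏-const k a) (∏-const k a) ⟩
    a ^ (2 ℕ.^ k) · a ^ (2 ℕ.^ k)         ≡⟨ ^-homo-* a (2 ℕ.^ k) (2 ℕ.^ k) ⟨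
    a ^ (2 ℕ.^ k ℕ.+ 2 ℕ.^ k)             ≡⟨ cong (λ t → a ^ (2 ℕ.^ k ℕ.+ t)) (ℕ.+-identityʳ (2 ℕ.^ k)) ⟨
    a ^ (2 ℕ.^ suc k)                     ∎
    where open ≡-Reasoning

  -- Multiplication by a ≠ 0 permutes the nonzero elements, so a^(q−1) fixes their product.
  fermat : ∀ a → a ^ (2 ℕ.^ n) ≡ a
  fermat a with a ≟F 0F
  ... | yes refl = trans (cong (0F ^_) (proj₂ (2^-suc n))) (·-zeroˡ _)
    where
    2^-suc : ∀ n → ∃[ m ] 2 ℕ.^ n ≡ suc m
    2^-suc n with 2 ℕ.^ n | ℕ.m^n>0 2 n
    ... | suc m | _ = m , refl
  ... | no a≢0 = begin
    a ^ (2 ℕ.^ n)             ≡⟨ ∏-const n a ⟨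
    ∏ {n} (λ _ → a)           ≡⟨ ∏.∑-cong split ⟩
    ∏ (λ x → ψ x · δ x)       ≡⟨ ∏.∑-∙ ψ δ ⟩
    ∏ ψ · ∏ δ                 ≡⟨ cong₂ _·_ ∏ψ≡1 ∏δ≡a ⟩
    1F · a                    ≡⟨ ·-identityˡ a ⟩
    a                         ∎
    where
    open ≡-Reasoning
    -- `nz` replaces 0 by 1 so that the product over all vectors is nonzero. `ψ` carries the factors
    -- a at nonzero vectors and `δ` the one extra factor at 0, which turns a^(q-1) = 1 into a^q = a.
    nz ψ δ : F n → F n
    nz x = if does (x ≟F 0F) then 1F else x
    ψ  x = if does (x ≟F 0F) then 1F else a
    δ  x = if does (x ≟F 0F) then a else 1F
    split : ∀ x → a ≡ ψ x · δ x
    split x with x ≟F 0F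
    ... | yes _ = sym (·-identityˡ a)
    ... | no _  = sym (·-identityʳ a)
    nz-≢0 : ∀ x → nz x ≢ 0F
    nz-≢0 x with x ≟F 0F
    ... | yes _ = 1≢0
    ... | no x≢0 = x≢0
    nz-· : ∀ x → nz (a · x) ≡ nz x · ψ x
    nz-· x with x ≟F 0F | (a · x) ≟F 0F
    ... | yes _    | yes _ = sym (·-identityˡ 1F)
    ... | yes refl | no ne = ⊥-elim (ne (·-zeroʳ a))
    ... | no x≢0   | yes e = ⊥-elim (·≢0 a≢0 x≢0 e)
    ... | no _     | no _  = ·-comm a x
    ∏nz≢0 : ∏ nz ≢ 0F
    ∏nz≢0 = ·≡1⇒≢0ˡ (begin
      ∏ nz · ∏ (inv ∘ nz)          ≡⟨ ∏.∑-∙ nz (inv ∘ nz) ⟨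
      ∏ (λ x → nz x · inv (nz x))  ≡⟨ ∏.∑-cong (λ x → ·-inverseʳ (nz x) (nz-≢0 x)) ⟩
      ∏ {n} (λ _ → 1F)             ≡⟨ ∏.∑-ε {n} ⟩
      1F                           ∎)
    ∏ψ≡1 : ∏ ψ ≡ 1F
    ∏ψ≡1 = ·-cancelˡ ∏nz≢0 (begin
      ∏ nz · ∏ ψ             ≡⟨ ∏.∑-∙ nz ψ ⟨
      ∏ (λ x → nz x · ψ x)   ≡⟨ ∏.∑-cong nz-· ⟨
      ∏ (λ x → nz (a · x))   ≡⟨ ∏.∑-reindex (·-cancelˡ a≢0) nz ⟩
      ∏ nz                   ≡⟨ ·-identityʳ (∏ nz) ⟨
      ∏ nz · 1F              ∎)
    ∏δ≡a : ∏ δ ≡ a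
    ∏δ≡a = trans (∏.∑-only-0 δ δ≢0) δ0
      where
      δ≢0 : ∀ x → x ≢ 0F → δ x ≡ 1F
      δ≢0 x x≢0 with x ≟F 0F
      ... | yes e = ⊥-elim (x≢0 e)
      ... | no _  = refl
      δ0 : δ 0F ≡ a
      δ0 with 0F {n} ≟F 0F
      ... | yes _ = refl
      ... | no ne = ⊥-elim (ne refl)

  -- Frobenius, trace and Artin-Schreier equations

  frob : ℕ → F n → F n
  frob zero    x = x
  frob (suc i) x = frob i (x · x)

  frob-^ : ∀ i x → frob i x ≡ x ^ (2 ℕ.^ i)
  frob-^ zero    x = sym (·-identityʳ x)
  frob-^ (suc i) x = begin
    frob i (x · x)              ≡⟨ frob-^ i (x · x) ⟩
    (x · x) ^ (2 ℕ.^ i)         ≡⟨ cong (λ t → (x · t) ^ (2 ℕ.^ i)) (·-identityʳ x) ⟨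
    (x ^ 2) ^ (2 ℕ.^ i)         ≡⟨ ^-assocʳ x 2 (2 ℕ.^ i) ⟩
    x ^ (2 ℕ.^ suc i)           ∎
    where open ≡-Reasoning

  sq-⊕ : ∀ x y → (x ⊕ y) · (x ⊕ y) ≡ x · x ⊕ y · y
  sq-⊕ = solve 2 (λ x y → (x :+ y) :* (x :+ y) := x :* x :+ y :* y) refl
    where open Solver

  -- The truncated trace x + x² + ⋯ with i terms, each the square of the preceding one; n terms give
  -- the absolute trace.
  frobSum : ℕ → F n → F n
  frobSum zero    x = 0F
  frobSum (suc i) x = x ⊕ frobSum i (x · x)

  frobSum-⊕ : ∀ i x y → frobSum i (x ⊕ y) ≡ frobSum i x ⊕ frobSum i y
  frobSum-⊕ zero    x y = sym (⊕-identityˡ 0F)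
  frobSum-⊕ (suc i) x y = begin
    (x ⊕ y) ⊕ frobSum i ((x ⊕ y) · (x ⊕ y))                 ≡⟨ cong (λ t → (x ⊕ y) ⊕ frobSum i t) (sq-⊕ x y) ⟩
    (x ⊕ y) ⊕ frobSum i (x · x ⊕ y · y)                     ≡⟨ cong ((x ⊕ y) ⊕_) (frobSum-⊕ i (x · x) (y · y)) ⟩
    (x ⊕ y) ⊕ (frobSum i (x · x) ⊕ frobSum i (y · y))       ≡⟨ ⊕-interchange x y _ _ ⟩
    (x ⊕ frobSum i (x · x)) ⊕ (y ⊕ frobSum i (y · y))       ∎
    where open ≡-Reasoning

  frobSum-sq : ∀ i x → frobSum i x · frobSum i x ≡ frobSum i (x · x)
  frobSum-sq zero    x = ·-zeroˡ 0F
  frobSum-sq (suc i) x = trans (sq-⊕ x _) (cong (x · x ⊕_) (frobSum-sq i (x · x)))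

  frobSum-last : ∀ i x → frobSum (suc i) x ≡ frobSum i x ⊕ frob i x
  frobSum-last zero    x = ⊕-comm x 0F
  frobSum-last (suc i) x = trans (cong (x ⊕_) (frobSum-last i (x · x))) (sym (⊕-assoc x _ _))

  Tr : F n → F n
  Tr = frobSum n

  frobSum-suc-n : ∀ x → frobSum (suc n) x ≡ Tr x ⊕ x
  frobSum-suc-n x = trans (frobSum-last n x) (cong (Tr x ⊕_) (trans (frob-^ n x) (fermat x)))

  Tr-sq : ∀ x → Tr (x · x) ≡ Tr x
  Tr-sq x = begin
    Tr (x · x)             ≡⟨ ⊕-cancel x _ ⟨
    x ⊕ (x ⊕ Tr (x · x))   ≡⟨ cong (x ⊕_) (trans (frobSum-suc-n x) (⊕-comm (Tr x) x)) ⟩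
    x ⊕ (x ⊕ Tr x)         ≡⟨ ⊕-cancel x _ ⟩
    Tr x                   ∎
    where open ≡-Reasoning

  Tr≡0∨1 : ∀ x → Tr x ≡ 0F ⊎ Tr x ≡ 1F
  Tr≡0∨1 x = idempotent⇒0∨1 (Tr x) (trans (cong (_⊕ Tr x) (trans (frobSum-sq n x) (Tr-sq x))) (⊕-self (Tr x)))

  opaque
    tr : F n → Bool
    tr x = not (does (Tr x ≟F 0F))

    tr≡false⇒Tr≡0 : ∀ {x} → tr x ≡ false → Tr x ≡ 0F
    tr≡false⇒Tr≡0 {x} e with Tr x ≟F 0F
    ... | yes Tr≡0 = Tr≡0
    tr≡false⇒Tr≡0 {x} () | no _

    Tr≡0⇒tr≡false : ∀ {x} → Tr x ≡ 0F → tr x ≡ false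
    Tr≡0⇒tr≡false {x} e with Tr x ≟F 0F
    ... | yes _ = refl
    ... | no ne = ⊥-elim (ne e)

    Tr≡1⇒tr≡true : ∀ {x} → Tr x ≡ 1F → tr x ≡ true
    Tr≡1⇒tr≡true {x} e with Tr x ≟F 0F
    ... | yes e′ = ⊥-elim (1≢0 (trans (sym e) e′))
    ... | no _   = refl

    tr-⊕ : ∀ x y → tr (x ⊕ y) ≡ tr x xor tr y
    tr-⊕ x y with Tr≡0∨1 x | Tr≡0∨1 y
    ... | inj₁ e | inj₁ e′ = trans (Tr≡0⇒tr≡false (trans (frobSum-⊕ n x y) (trans (cong₂ _⊕_ e e′) (⊕-self 0F))))
                               (sym (cong₂ _xor_ (Tr≡0⇒tr≡false e) (Tr≡0⇒tr≡false e′)))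
    ... | inj₁ e | inj₂ e′ = trans (Tr≡1⇒tr≡true (trans (frobSum-⊕ n x y) (trans (cong₂ _⊕_ e e′) (⊕-identityˡ 1F))))
                               (sym (cong₂ _xor_ (Tr≡0⇒tr≡false e) (Tr≡1⇒tr≡true e′)))
    ... | inj₂ e | inj₁ e′ = trans (Tr≡1⇒tr≡true (trans (frobSum-⊕ n x y) (trans (cong₂ _⊕_ e e′) (⊕-identityʳ 1F))))
                               (sym (cong₂ _xor_ (Tr≡1⇒tr≡true e) (Tr≡0⇒tr≡false e′)))
    ... | inj₂ e | inj₂ e′ = trans (Tr≡0⇒tr≡false (trans (frobSum-⊕ n x y) (trans (cong₂ _⊕_ e e′) (⊕-self 1F))))
                               (sym (cong₂ _xor_ (Tr≡1⇒tr≡true e) (Tr≡1⇒tr≡true e′)))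

    tr-sq : ∀ x → tr (x · x) ≡ tr x
    tr-sq x = cong (λ t → not (does (t ≟F 0F))) (Tr-sq x)

  tr-0 : tr 0F ≡ false
  tr-0 = trans (cong tr (sym (⊕-self 0F))) (trans (tr-⊕ 0F 0F) (Bool.xor-same (tr 0F)))

  -- x + x⁴ + x¹⁶ + ⋯ with j + 1 terms. For n = 2j + 1 it is the classical half trace, an explicit
  -- and additive solution y of y² + y = x for x of trace 0.
  halfTrace : ℕ → F n → F n
  halfTrace zero    x = x
  halfTrace (suc j) x = x ⊕ halfTrace j ((x · x) · (x · x))

  halfTrace-⊕ : ∀ j x y → halfTrace j (x ⊕ y) ≡ halfTrace j x ⊕ halfTrace j y
  halfTrace-⊕ zero    x y = refl
  halfTrace-⊕ (suc j) x y = begin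
    (x ⊕ y) ⊕ halfTrace j _
      ≡⟨ cong (λ t → (x ⊕ y) ⊕ halfTrace j t) (trans (cong (λ t → t · t) (sq-⊕ x y)) (sq-⊕ (x · x) (y · y))) ⟩
    (x ⊕ y) ⊕ halfTrace j ((x · x) · (x · x) ⊕ (y · y) · (y · y))
      ≡⟨ cong ((x ⊕ y) ⊕_) (halfTrace-⊕ j _ _) ⟩
    (x ⊕ y) ⊕ (halfTrace j ((x · x) · (x · x)) ⊕ halfTrace j ((y · y) · (y · y)))
      ≡⟨ ⊕-interchange x y _ _ ⟩
    (x ⊕ halfTrace j ((x · x) · (x · x))) ⊕ (y ⊕ halfTrace j ((y · y) · (y · y))) ∎
    where open ≡-Reasoning

  -- The half trace has the even iterates of Frobenius and its square the odd ones. For n = 2j + 1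
  -- this makes n + 1 terms, and the last one, x^(2ⁿ) = x, is what survives when the trace vanishes.
  halfTrace-sq : ∀ j x → halfTrace j x · halfTrace j x ⊕ halfTrace j x ≡ frobSum (suc (suc (j ℕ.+ j))) x
  halfTrace-sq zero    x = trans (⊕-comm (x · x) x) (cong (x ⊕_) (sym (⊕-identityʳ (x · x))))
  halfTrace-sq (suc j) x = begin
    (x ⊕ h) · (x ⊕ h) ⊕ (x ⊕ h)
      ≡⟨ solve 2 (λ x h → (x :+ h) :* (x :+ h) :+ (x :+ h) := x :+ (x :* x :+ (h :* h :+ h))) refl x h ⟩
    x ⊕ (x · x ⊕ (h · h ⊕ h))
      ≡⟨ cong (λ t → x ⊕ (x · x ⊕ t)) (halfTrace-sq j ((x · x) · (x · x))) ⟩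
    frobSum (suc (suc (suc (suc (j ℕ.+ j))))) x
      ≡⟨ cong (λ t → frobSum (suc (suc (suc t))) x) (ℕ.+-suc j j) ⟨
    frobSum (suc (suc (suc j ℕ.+ suc j))) x ∎
    where
    open ≡-Reasoning
    open Solver
    h = halfTrace j ((x · x) · (x · x))

  module Odd (j : ℕ) (n≡ : n ≡ suc (j ℕ.+ j)) where

    tr-1 : tr 1F ≡ true
    tr-1 = Tr≡1⇒tr≡true (trans (cong (λ t → frobSum t 1F) n≡) (lemma j))
      where
      open ≡-Reasoning
      lemma : ∀ j → frobSum (suc (j ℕ.+ j)) 1F ≡ 1F
      lemma zero    = ⊕-identityʳ 1F
      lemma (suc j) = begin
        1F ⊕ frobSum (suc j ℕ.+ suc j) (1F · 1F)
          ≡⟨ cong₂ (λ s t → 1F ⊕ frobSum s t) (ℕ.+-suc (suc j) j) (·-identityˡ 1F) ⟩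
        1F ⊕ (1F ⊕ frobSum (suc (j ℕ.+ j)) (1F · 1F))
          ≡⟨ ⊕-cancel 1F _ ⟩
        frobSum (suc (j ℕ.+ j)) (1F · 1F)
          ≡⟨ cong (frobSum (suc (j ℕ.+ j))) (·-identityˡ 1F) ⟩
        frobSum (suc (j ℕ.+ j)) 1F
          ≡⟨ lemma j ⟩
        1F ∎

    half : F n → F n
    half = halfTrace j

    artin-schreier : ∀ x → tr x ≡ false → half x · half x ⊕ half x ≡ x
    artin-schreier x e = begin
      half x · half x ⊕ half x         ≡⟨ halfTrace-sq j x ⟩
      frobSum (suc (suc (j ℕ.+ j))) x  ≡⟨ cong (λ t → frobSum (suc t) x) n≡ ⟨
      frobSum (suc n) x                ≡⟨ frobSum-suc-n x ⟩
      Tr x ⊕ x                         ≡⟨ cong (_⊕ x) (tr≡false⇒Tr≡0 e) ⟩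
      0F ⊕ x                           ≡⟨ ⊕-identityˡ x ⟩
      x                                ∎
      where open ≡-Reasoning

    tr-artin-schreier : ∀ x → tr (x · x ⊕ x) ≡ false
    tr-artin-schreier x = trans (tr-⊕ (x · x) x) (trans (cong (_xor tr x) (tr-sq x)) (Bool.xor-same (tr x)))

    -- x² + x has trace 0, whereas 1 has trace 1 because n is odd.
    no-cube-root : ∀ x → x · x ⊕ x ⊕ 1F ≢ 0F
    no-cube-root x e with trans (sym (tr-artin-schreier x)) (trans (cong tr (⊕≡0⇒≡ _ _ e)) tr-1)
    ... | ()

-- Subspaces and sums of inverses

open import Data.Vec using (_++_; map)

combo-⊕ : ∀ {n k} (c d : Vec Bool k) (vs : Vec (F n) k) → combo (c ⊕ d) vs ≡ combo c vs ⊕ combo d vs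
combo-⊕ []      []      []       = sym (⊕-identityˡ 0F)
combo-⊕ (c ∷ cs) (d ∷ ds) (v ∷ vs) =
  trans (cong₂ _⊕_ (⊙-distribʳ c d v) (combo-⊕ cs ds vs)) (⊕-interchange (c ⊙ v) (d ⊙ v) _ _)

combo-0 : ∀ {n k} (vs : Vec (F n) k) → combo 0F vs ≡ 0F
combo-0 []       = refl
combo-0 (v ∷ vs) = trans (⊕-identityˡ _) (combo-0 vs)

combo-map : ∀ {m n k} (h : F m → F n) → h 0F ≡ 0F → (∀ x y → h (x ⊕ y) ≡ h x ⊕ h y) →
            ∀ (c : Vec Bool k) vs → combo c (map h vs) ≡ h (combo c vs)
combo-map h h0 h-⊕ []       []       = sym h0
combo-map h h0 h-⊕ (c ∷ cs) (v ∷ vs) =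
  trans (cong₂ _⊕_ (sym (⊙-homo h h0 c v)) (combo-map h h0 h-⊕ cs vs)) (sym (h-⊕ _ _))

LinIndep⇒injective : ∀ {n k} {vs : Vec (F n) k} → LinIndep vs → Injective _≡_ _≡_ (λ c → combo c vs)
LinIndep⇒injective {vs = vs} ind {c} {d} e =
  ⊕≡0⇒≡ c d (ind (c ⊕ d) (trans (combo-⊕ c d vs) (trans (cong (_⊕ combo d vs) e) (⊕-self _))))

0F-++ : ∀ k l → 0F {k ℕ.+ l} ≡ 0F {k} ++ 0F {l}
0F-++ zero    l = refl
0F-++ (suc k) l = cong (false ∷_) (0F-++ k l)

basis : ∀ k → Vec (Vec Bool k) k
basis zero    = []
basis (suc k) = 1F ∷ map (false ∷_) (basis k)

combo-basis : ∀ {k} (c : Vec Bool k) → combo c (basis k) ≡ c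
combo-basis []       = refl
combo-basis (c ∷ cs) =
  trans (cong (c ⊙ 1F ⊕_) (trans (combo-map (false ∷_) refl (λ _ _ → refl) cs _) (cong (false ∷_) (combo-basis cs)))) (lead c)
  where
  lead : ∀ c → c ⊙ 1F ⊕ (false ∷ cs) ≡ c ∷ cs
  lead false = ⊕-identityˡ (false ∷ cs)
  lead true  = cong (true ∷_) (⊕-identityˡ cs)

infix 4 _⊑_
-- Inclusion of spans, carrying coefficients: the first projection is a map of coordinates along
-- which sums can be reindexed.
_⊑_ : ∀ {n k l} → Vec (F n) k → Vec (F n) l → Set
us ⊑ vs = ∀ c → ∃[ d ] combo c us ≡ combo d vs

⊑-cons : ∀ {n k l} {u : F n} {us : Vec (F n) k} {vs : Vec (F n) l} →
         (∃[ d ] u ≡ combo d vs) → us ⊑ vs → (u ∷ us) ⊑ vs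
⊑-cons _        sub (false ∷ c) = proj₁ (sub c) , trans (⊕-identityˡ _) (proj₂ (sub c))
⊑-cons {vs = vs} (d , e) sub (true ∷ c) =
  d ⊕ proj₁ (sub c) , trans (cong₂ _⊕_ e (proj₂ (sub c))) (sym (combo-⊕ d _ vs))

-- With trivial kernel the additive map would be injective, against the cardinalities 2ᵐ < 2ⁿ. This
-- replaces any rank argument.
kernel : ∀ {m n} (φ : F n → F m) → (∀ x y → φ (x ⊕ y) ≡ φ x ⊕ φ y) → m < n → ∃[ b ] b ≢ 0F × φ b ≡ 0F
kernel φ φ-⊕ m<n with ∃? (λ b → ¬? (b ≟F 0F) ×-dec (φ b ≟F 0F))
... | yes found = found
... | no none   = ⊥-elim (ℕ.<⇒≱ m<n (injective⇒≤ {σ = φ} φ-injective))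
  where
  φ-injective : Injective _≡_ _≡_ φ
  φ-injective {x} {y} e with (x ⊕ y) ≟F 0F
  ... | yes e′ = ⊕≡0⇒≡ x y e′
  ... | no ne  = ⊥-elim (none (x ⊕ y , ne , trans (φ-⊕ x y) (trans (cong (_⊕ φ y) e) (⊕-self (φ y)))))

module Subspaces {n : ℕ} (𝔽 : BinaryField n) where

  open FieldProperties 𝔽
  open Sum (⊕-isCommutativeMonoid {n})

  -- The subspace polynomial ∏ (x + u) over the u in the span of vs.
  L : ∀ {k} → Vec (F n) k → F n → F n
  L []       x = x
  L (v ∷ vs) x = L vs x · L vs (x ⊕ v)

  -- The linear coefficient of L, i.e. the product of the nonzero elements of the span if vs is independent, and 0 otherwise.
  C : ∀ {k} → Vec (F n) k → F n
  C []       = 1F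
  C (v ∷ vs) = L vs v · C vs

  -- In characteristic 2 the map y ↦ y(y + c) is additive, and each new vector composes `L vs` with
  -- such a map.
  L-⊕ : ∀ {k} (vs : Vec (F n) k) x y → L vs (x ⊕ y) ≡ L vs x ⊕ L vs y
  L-⊕ []       x y = refl
  L-⊕ (v ∷ vs) x y = begin
    L vs (x ⊕ y) · L vs ((x ⊕ y) ⊕ v)
      ≡⟨ cong₂ _·_ (L-⊕ vs x y) (trans (L-⊕ vs (x ⊕ y) v) (cong (_⊕ L vs v) (L-⊕ vs x y))) ⟩
    (a ⊕ b) · ((a ⊕ b) ⊕ c)
      ≡⟨ solve 3 (λ a b c → (a :+ b) :* ((a :+ b) :+ c) := a :* (a :+ c) :+ b :* (b :+ c)) refl a b c ⟩
    a · (a ⊕ c) ⊕ b · (b ⊕ c)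
      ≡⟨ cong₂ (λ s t → a · s ⊕ b · t) (L-⊕ vs x v) (L-⊕ vs y v) ⟨
    L (v ∷ vs) x ⊕ L (v ∷ vs) y ∎
    where
    open ≡-Reasoning
    open Solver
    a = L vs x
    b = L vs y
    c = L vs v

  L-cons : ∀ {k} v (vs : Vec (F n) k) x → L (v ∷ vs) x ≡ L vs x · (L vs x ⊕ L vs v)
  L-cons v vs x = cong (L vs x ·_) (L-⊕ vs x v)

  L-combo : ∀ {k} (vs : Vec (F n) k) c → L vs (combo c vs) ≡ 0F
  L-combo []       []           = refl
  L-combo (v ∷ vs) (false ∷ cs) = trans (cong (_· L vs (combo (false ∷ cs) (v ∷ vs) ⊕ v)) (trans (cong (L vs) (⊕-identityˡ _)) (L-combo vs cs))) (·-zeroˡ _)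
  L-combo (v ∷ vs) (true ∷ cs)  = begin
    L vs (v ⊕ w) · L vs ((v ⊕ w) ⊕ v)  ≡⟨ cong (λ t → L vs (v ⊕ w) · L vs t) (trans (⊕-comm (v ⊕ w) v) (⊕-cancel v w)) ⟩
    L vs (v ⊕ w) · L vs w              ≡⟨ cong (L vs (v ⊕ w) ·_) (L-combo vs cs) ⟩
    L vs (v ⊕ w) · 0F                  ≡⟨ ·-zeroʳ _ ⟩
    0F                                 ∎
    where
    open ≡-Reasoning
    w = combo cs vs

  L≡0⇒combo : ∀ {k} (vs : Vec (F n) k) x → L vs x ≡ 0F → ∃[ c ] x ≡ combo c vs
  L≡0⇒combo []       x e = [] , e
  L≡0⇒combo (v ∷ vs) x e with ·≡0 _ _ e
  ... | inj₁ e′ = let c , x≡ = L≡0⇒combo vs x e′ in false ∷ c , trans x≡ (sym (⊕-identityˡ _))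
  ... | inj₂ e′ = let c , x⊕v≡ = L≡0⇒combo vs (x ⊕ v) e′ in
    true ∷ c , trans (sym (⊕-cancel v x)) (cong (v ⊕_) (trans (⊕-comm v x) x⊕v≡))

  C≢0⇒LinIndep : ∀ {k} (vs : Vec (F n) k) → C vs ≢ 0F → LinIndep vs
  C≢0⇒LinIndep []       _  []           _ = refl
  C≢0⇒LinIndep (v ∷ vs) C≢0 (false ∷ cs) e =
    cong (false ∷_) (C≢0⇒LinIndep vs (λ C≡0 → C≢0 (trans (cong (L vs v ·_) C≡0) (·-zeroʳ _))) cs (trans (sym (⊕-identityˡ _)) e))
  C≢0⇒LinIndep (v ∷ vs) C≢0 (true ∷ cs)  e = ⊥-elim (C≢0 (trans (cong (_· C vs) Lv≡0) (·-zeroˡ _)))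
    where
    Lv≡0 : L vs v ≡ 0F
    Lv≡0 = trans (cong (L vs) (⊕≡0⇒≡ v _ e)) (L-combo vs cs)

  LinIndep⇒C≢0 : ∀ {k} (vs : Vec (F n) k) → LinIndep vs → C vs ≢ 0F
  LinIndep⇒C≢0 []       _   e = 1≢0 e
  LinIndep⇒C≢0 (v ∷ vs) ind e with ·≡0 _ _ e
  ... | inj₂ C≡0 = LinIndep⇒C≢0 vs (λ c e′ → Vec.∷-injectiveʳ (ind (false ∷ c) (trans (⊕-identityˡ _) e′))) C≡0
  ... | inj₁ L≡0 with L≡0⇒combo vs v L≡0
  ... | c , v≡ with ind (true ∷ c) (trans (cong (v ⊕_) (sym v≡)) (⊕-self v))
  ... | ()

  A : ∀ {k} → Vec (F n) k → F n → F n
  A vs x = ∑ (λ c → inv (x ⊕ combo c vs))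

  A-[] : ∀ x → A [] x ≡ inv x
  A-[] x = trans (∑-zero _) (cong inv (⊕-identityʳ x))

  A-cons : ∀ {k} v (vs : Vec (F n) k) x → A (v ∷ vs) x ≡ A vs x ⊕ A vs (x ⊕ v)
  A-cons v vs x = trans (∑-suc _) (cong₂ _⊕_
    (∑-cong (λ c → cong (λ t → inv (x ⊕ t)) (⊕-identityˡ _)))
    (∑-cong (λ c → cong inv (sym (⊕-assoc x v _)))))

  -- The logarithmic derivative: Σ 1/(x + u) = L′(x)/L(x), and the derivative of an additive
  -- polynomial is the constant `C`. The induction merges two cosets by 1/a + 1/b = (a + b)/(ab).
  A-coset : ∀ {k} (vs : Vec (F n) k) x → L vs x ≢ 0F → A vs x ≡ C vs · inv (L vs x)
  A-coset []       x _   = trans (A-[] x) (sym (·-identityˡ _))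
  A-coset (v ∷ vs) x L≢0 = begin
    A (v ∷ vs) x                            ≡⟨ A-cons v vs x ⟩
    A vs x ⊕ A vs (x ⊕ v)                   ≡⟨ cong₂ _⊕_ (A-coset vs x a≢0) (A-coset vs (x ⊕ v) b≢0) ⟩
    C vs · inv a ⊕ C vs · inv b
      ≡⟨ cong₂ (λ s t → C vs · s ⊕ C vs · t)
           (trans (cong (_· inv a) (·-inverseʳ b b≢0)) (·-identityˡ (inv a)))
           (trans (cong (_· inv b) (·-inverseʳ a a≢0)) (·-identityˡ (inv b))) ⟨
    C vs · (b · inv b · inv a) ⊕ C vs · (a · inv a · inv b)
      ≡⟨ solve 5 (λ c a b p q → c :* (b :* q :* p) :+ c :* (a :* p :* q) := (a :+ b) :* c :* (p :* q)) refl (C vs) a b (inv a) (inv b) ⟩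
    (a ⊕ b) · C vs · (inv a · inv b)
      ≡⟨ cong₂ (λ s t → s · C vs · t) (trans (cong (a ⊕_) (L-⊕ vs x v)) (⊕-cancel a (L vs v))) (sym (inv-· a b)) ⟩
    L vs v · C vs · inv (a · b)             ∎
    where
    open ≡-Reasoning
    open Solver
    a b : F n
    a = L vs x
    b = L vs (x ⊕ v)
    a≢0 : a ≢ 0F
    a≢0 e = L≢0 (trans (cong (_· b) e) (·-zeroˡ b))
    b≢0 : b ≢ 0F
    b≢0 e = L≢0 (trans (cong (a ·_) e) (·-zeroʳ a))

  A-combo : ∀ {k} (vs : Vec (F n) k) x c → A vs (x ⊕ combo c vs) ≡ A vs x
  A-combo []       x []           = cong (A []) (⊕-identityʳ x)
  A-combo (v ∷ vs) x (false ∷ cs) = begin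
    A (v ∷ vs) (x ⊕ (0F ⊕ w))                ≡⟨ A-cons v vs _ ⟩
    A vs (x ⊕ (0F ⊕ w)) ⊕ A vs ((x ⊕ (0F ⊕ w)) ⊕ v)
      ≡⟨ cong₂ (λ s t → A vs s ⊕ A vs t) (cong (x ⊕_) (⊕-identityˡ w)) (solve 3 (λ x w v → (x :+ (con false :+ w)) :+ v := (x :+ v) :+ w) refl x w v) ⟩
    A vs (x ⊕ w) ⊕ A vs ((x ⊕ v) ⊕ w)        ≡⟨ cong₂ _⊕_ (A-combo vs x cs) (A-combo vs (x ⊕ v) cs) ⟩
    A vs x ⊕ A vs (x ⊕ v)                    ≡⟨ A-cons v vs x ⟨
    A (v ∷ vs) x                             ∎
    where
    open ≡-Reasoning
    open Solver
    w = combo cs vs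
  A-combo (v ∷ vs) x (true ∷ cs) = begin
    A (v ∷ vs) (x ⊕ (v ⊕ w))                 ≡⟨ A-cons v vs _ ⟩
    A vs (x ⊕ (v ⊕ w)) ⊕ A vs ((x ⊕ (v ⊕ w)) ⊕ v)
      ≡⟨ cong₂ (λ s t → A vs s ⊕ A vs t) (sym (⊕-assoc x v w)) (solve 3 (λ x w v → (x :+ (v :+ w)) :+ v := x :+ w) refl x w v) ⟩
    A vs ((x ⊕ v) ⊕ w) ⊕ A vs (x ⊕ w)        ≡⟨ cong₂ _⊕_ (A-combo vs (x ⊕ v) cs) (A-combo vs x cs) ⟩
    A vs (x ⊕ v) ⊕ A vs x                    ≡⟨ ⊕-comm _ _ ⟩
    A vs x ⊕ A vs (x ⊕ v)                    ≡⟨ A-cons v vs x ⟨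
    A (v ∷ vs) x                             ∎
    where
    open ≡-Reasoning
    open Solver
    w = combo cs vs

  A-swap : ∀ {k} u v (vs : Vec (F n) k) x → A (u ∷ v ∷ vs) x ≡ A (v ∷ u ∷ vs) x
  A-swap u v vs x = begin
    A (u ∷ v ∷ vs) x                                             ≡⟨ expand u v ⟩
    (A vs x ⊕ A vs (x ⊕ v)) ⊕ (A vs (x ⊕ u) ⊕ A vs ((x ⊕ u) ⊕ v)) ≡⟨ ⊕-interchange (A vs x) _ _ _ ⟩
    (A vs x ⊕ A vs (x ⊕ u)) ⊕ (A vs (x ⊕ v) ⊕ A vs ((x ⊕ u) ⊕ v)) ≡⟨ cong (λ t → (A vs x ⊕ A vs (x ⊕ u)) ⊕ (A vs (x ⊕ v) ⊕ A vs t)) commute ⟩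
    (A vs x ⊕ A vs (x ⊕ u)) ⊕ (A vs (x ⊕ v) ⊕ A vs ((x ⊕ v) ⊕ u)) ≡⟨ expand v u ⟨
    A (v ∷ u ∷ vs) x                                             ∎
    where
    open ≡-Reasoning
    expand : ∀ u v → A (u ∷ v ∷ vs) x ≡ (A vs x ⊕ A vs (x ⊕ v)) ⊕ (A vs (x ⊕ u) ⊕ A vs ((x ⊕ u) ⊕ v))
    expand u v = trans (A-cons u (v ∷ vs) x) (cong₂ _⊕_ (A-cons v vs x) (A-cons v vs (x ⊕ u)))
    commute : (x ⊕ u) ⊕ v ≡ (x ⊕ v) ⊕ u
    commute = trans (⊕-assoc x u v) (trans (cong (x ⊕_) (⊕-comm u v)) (sym (⊕-assoc x v u)))

  A-add : ∀ {k} v (vs : Vec (F n) k) x {w} c → w ≡ combo c vs → A ((v ⊕ w) ∷ vs) x ≡ A (v ∷ vs) x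
  A-add v vs x {w} c w≡ = begin
    A ((v ⊕ w) ∷ vs) x                ≡⟨ A-cons (v ⊕ w) vs x ⟩
    A vs x ⊕ A vs (x ⊕ (v ⊕ w))       ≡⟨ cong (λ t → A vs x ⊕ A vs t) (trans (sym (⊕-assoc x v w)) (cong ((x ⊕ v) ⊕_) w≡)) ⟩
    A vs x ⊕ A vs ((x ⊕ v) ⊕ combo c vs) ≡⟨ cong (A vs x ⊕_) (A-combo vs (x ⊕ v) c) ⟩
    A vs x ⊕ A vs (x ⊕ v)             ≡⟨ A-cons v vs x ⟨
    A (v ∷ vs) x                      ∎
    where open ≡-Reasoning

  -- For dependent vectors every element of the coset is listed an even number of times, so
  -- everything cancels. Degenerate triples can thus stay in the counts for dimension 4.
  C≡0⇒A≡0 : ∀ {k} (vs : Vec (F n) k) → C vs ≡ 0F → ∀ x → A vs x ≡ 0F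
  C≡0⇒A≡0 []       e x = ⊥-elim (1≢0 e)
  C≡0⇒A≡0 (v ∷ vs) e x with ·≡0 _ _ e
  ... | inj₂ C≡0 = trans (A-cons v vs x) (trans (cong₂ _⊕_ (C≡0⇒A≡0 vs C≡0 x) (C≡0⇒A≡0 vs C≡0 (x ⊕ v))) (⊕-self 0F))
  ... | inj₁ L≡0 with L≡0⇒combo vs v L≡0
  ... | c , v≡ = trans (A-cons v vs x) (trans (cong (λ t → A vs x ⊕ A vs (x ⊕ t)) v≡) (trans (cong (A vs x ⊕_) (A-combo vs x c)) (⊕-self _)))

  s : ∀ {k} → Vec (F n) k → F n
  s vs = A vs 0F

  s-cons : ∀ {k} v (vs : Vec (F n) k) → s (v ∷ vs) ≡ s vs ⊕ A vs v
  s-cons v vs = trans (A-cons v vs 0F) (cong (λ t → s vs ⊕ A vs t) (⊕-identityˡ v))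

  s-cons-indep : ∀ {k} v (vs : Vec (F n) k) → L vs v ≢ 0F → s (v ∷ vs) ≡ s vs ⊕ C vs · inv (L vs v)
  s-cons-indep v vs L≢0 = trans (s-cons v vs) (cong (s vs ⊕_) (A-coset vs v L≢0))

  L-++ : ∀ {k l} (ws : Vec (F n) l) (vs : Vec (F n) k) x → L (ws ++ vs) x ≡ L (map (L vs) ws) (L vs x)
  L-++ []       vs x = refl
  L-++ (w ∷ ws) vs x = cong₂ _·_ (L-++ ws vs x) (trans (L-++ ws vs (x ⊕ w)) (cong (L (map (L vs) ws)) (L-⊕ vs x w)))

  C-++ : ∀ {k l} (ws : Vec (F n) l) (vs : Vec (F n) k) → C (ws ++ vs) ≡ C (map (L vs) ws) · C vs
  C-++ []       vs = sym (·-identityˡ _)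
  C-++ (w ∷ ws) vs = trans (cong₂ _·_ (L-++ ws vs w) (C-++ ws vs)) (sym (·-assoc _ _ _))

  C-cons≢0 : ∀ {k} v (vs : Vec (F n) k) → C (v ∷ vs) ≢ 0F → L vs v ≢ 0F × C vs ≢ 0F
  C-cons≢0 v vs ne = (λ e → ne (trans (cong (_· C vs) e) (·-zeroˡ _))) , (λ e → ne (trans (cong (L vs v ·_) e) (·-zeroʳ _)))

  -- Group the cosets of span vs: a coset w + span vs contributes C vs / L vs w.
  s-++ : ∀ {k l} (ws : Vec (F n) l) (vs : Vec (F n) k) → C (ws ++ vs) ≢ 0F →
         s (ws ++ vs) ≡ s vs ⊕ C vs · s (map (L vs) ws)
  s-++ []       vs _  = sym (trans (cong (λ t → s vs ⊕ C vs · t) (trans (A-[] 0F) inv-0)) (trans (cong (s vs ⊕_) (·-zeroʳ _)) (⊕-identityʳ _)))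
  s-++ (w ∷ ws) vs ne with C-cons≢0 w (ws ++ vs) ne
  ... | L≢0 , C≢0 = begin
    s (w ∷ (ws ++ vs))                                       ≡⟨ s-cons-indep w (ws ++ vs) L≢0 ⟩
    s (ws ++ vs) ⊕ C (ws ++ vs) · inv (L (ws ++ vs) w)
      ≡⟨ cong₂ _⊕_ (s-++ ws vs C≢0) (cong₂ (λ p q → p · inv q) (C-++ ws vs) (L-++ ws vs w)) ⟩
    (s vs ⊕ C vs · s ws′) ⊕ (C ws′ · C vs) · inv (L ws′ (L vs w))
      ≡⟨ solve 5 (λ a c t d i → (a :+ c :* t) :+ (d :* c) :* i := a :+ c :* (t :+ d :* i)) refl (s vs) (C vs) (s ws′) (C ws′) (inv (L ws′ (L vs w))) ⟩
    s vs ⊕ C vs · (s ws′ ⊕ C ws′ · inv (L ws′ (L vs w)))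
      ≡⟨ cong (λ t → s vs ⊕ C vs · t) (s-cons-indep (L vs w) ws′ (λ e → L≢0 (trans (L-++ ws vs w) e))) ⟨
    s vs ⊕ C vs · s (L vs w ∷ ws′)                           ∎
    where
    open ≡-Reasoning
    open Solver
    ws′ = map (L vs) ws

  ZeroSum : ∀ {k} → Vec (F n) k → Set
  ZeroSum vs = C vs ≢ 0F × s vs ≡ 0F

  ZS : ℕ → Set
  ZS k = ∃[ vs ] ZeroSum {k} vs

  sumAffine≡A : ∀ {k} x (vs : Vec (F n) k) → sumAffine inv x vs ≡ A vs x
  sumAffine≡A x vs = sym (∑-foldr _)

  ZS⇒¬SumFree : ∀ {k} → ZS k → ¬ SumFree k inv
  ZS⇒¬SumFree (vs , C≢0 , s≡0) sf = sf 0F vs (C≢0⇒LinIndep vs C≢0) (trans (sumAffine≡A 0F vs) s≡0)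

  ¬ZS⇒SumFree : ∀ {k} → ¬ ZS k → SumFree k inv
  ¬ZS⇒SumFree ¬zs x vs ind e with L vs x ≟F 0F | LinIndep⇒C≢0 vs ind
  ... | no L≢0  | C≢0 = ·≢0 C≢0 (inv-≢0 L≢0) (trans (sym (A-coset vs x L≢0)) (trans (sym (sumAffine≡A x vs)) e))
  ... | yes L≡0 | C≢0 with L≡0⇒combo vs x L≡0
  ... | c , x≡ = ¬zs (vs , C≢0 , (begin
    s vs                     ≡⟨ A-combo vs 0F c ⟨
    A vs (0F ⊕ combo c vs)   ≡⟨ cong (A vs) (trans (⊕-identityˡ _) (sym x≡)) ⟩
    A vs x                   ≡⟨ sumAffine≡A x vs ⟨
    sumAffine inv x vs       ≡⟨ e ⟩
    0F                       ∎))
    where open ≡-Reasoning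

  -- Basis extension: if every combination of `hs` lay in the current span, coordinates in the
  -- shorter list would inject 2ᴺ vectors into fewer. New vectors go in front, where `s-++` expects
  -- them.
  extend : ∀ {N l} (hs : Vec (F n) N) (us : Vec (F n) l) → C hs ≢ 0F → C us ≢ 0F → us ⊑ hs →
           ∀ m → m ℕ.+ l ≤ N → ∃[ ws ] C {m ℕ.+ l} (ws ++ us) ≢ 0F × (ws ++ us) ⊑ hs
  extend hs us Chs Cus sub zero    _  = [] , Cus , sub
  extend {N} {l} hs us Chs Cus sub (suc m) m+l<N with extend hs us Chs Cus sub m (ℕ.<⇒≤ m+l<N)
  ... | ws , Cws , sub′ with ∃? {N} (λ c → ¬? (L (ws ++ us) (combo c hs) ≟F 0F))
  ... | yes (c , ne) = combo c hs ∷ ws , ·≢0 ne Cws , ⊑-cons (c , refl) sub′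
  ... | no none      = ⊥-elim (ℕ.<⇒≱ m+l<N (injective⇒≤ {σ = proj₁ ∘ coords} coords-injective))
    where
    coords : ∀ c → ∃[ d ] combo c hs ≡ combo d (ws ++ us)
    coords c with L (ws ++ us) (combo c hs) ≟F 0F
    ... | yes e = L≡0⇒combo (ws ++ us) _ e
    ... | no ne = ⊥-elim (none (c , ne))
    coords-injective : Injective _≡_ _≡_ (proj₁ ∘ coords)
    coords-injective {c} {d} e = LinIndep⇒injective (C≢0⇒LinIndep hs Chs)
      (trans (proj₂ (coords c)) (trans (cong (λ t → combo t (ws ++ us)) e) (sym (proj₂ (coords d)))))

  -- Both lists have length k, so independence of `us` makes the coordinate map injective and hence
  -- a permutation of the coefficient vectors.
  s-⊑ : ∀ {k} (us vs : Vec (F n) k) → C us ≢ 0F → us ⊑ vs → s us ≡ s vs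
  s-⊑ us vs Cus sub = trans (∑-cong (λ c → cong (λ t → inv (0F ⊕ t)) (proj₂ (sub c))))
                            (∑-reindex {σ = proj₁ ∘ sub} σ-injective _)
    where
    σ-injective : Injective _≡_ _≡_ (proj₁ ∘ sub)
    σ-injective {c} {d} e = LinIndep⇒injective (C≢0⇒LinIndep us Cus)
      (trans (proj₂ (sub c)) (trans (cong (λ t → combo t vs) e) (sym (proj₂ (sub d)))))

  combo-scale : ∀ {k} g (c : Vec Bool k) vs → combo c (map (g ·_) vs) ≡ g · combo c vs
  combo-scale g = combo-map (g ·_) (·-zeroʳ g) (·-distribˡ g)

  C-scale : ∀ {k} {g} (vs : Vec (F n) k) → g ≢ 0F → C vs ≢ 0F → C (map (g ·_) vs) ≢ 0F
  C-scale {g = g} vs g≢0 Cvs = LinIndep⇒C≢0 _ λ c e →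
    C≢0⇒LinIndep vs Cvs c (·-cancelˡ g≢0 (trans (sym (combo-scale g c vs)) (trans e (sym (·-zeroʳ g)))))

  s-scale : ∀ {k} g (vs : Vec (F n) k) → s (map (g ·_) vs) ≡ inv g · s vs
  s-scale g vs = trans (∑-cong (λ c → trans (cong inv (trans (⊕-identityˡ _) (trans (combo-scale g c vs) (cong (g ·_) (sym (⊕-identityˡ _)))))) (inv-· g _)))
                       (∑-homo (inv g ·_) (·-distribˡ (inv g)) _)

  -- Scaling by g permutes the span and multiplies s by g⁻¹.
  invariant⇒s≡0 : ∀ {k} {g} (vs : Vec (F n) k) → C vs ≢ 0F → g ≢ 0F → g ≢ 1F → map (g ·_) vs ⊑ vs → s vs ≡ 0F
  invariant⇒s≡0 {g = g} vs Cvs g≢0 g≢1 sub with ·≡0 (1F ⊕ inv g) (s vs) (begin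
    (1F ⊕ inv g) · s vs     ≡⟨ solve 2 (λ i t → (con true :+ i) :* t := t :+ i :* t) refl (inv g) (s vs) ⟩
    s vs ⊕ inv g · s vs     ≡⟨ cong (s vs ⊕_) (trans (sym (s-scale g vs)) (s-⊑ _ vs (C-scale vs g≢0 Cvs) sub)) ⟩
    s vs ⊕ s vs             ≡⟨ ⊕-self _ ⟩
    0F                      ∎)
    where
    open ≡-Reasoning
    open Solver
  ... | inj₂ e = e
  ... | inj₁ e = ⊥-elim (g≢1 (inv-injective (trans (sym (⊕≡0⇒≡ 1F (inv g) e)) (sym inv-1))))

  -- `L us` vanishes exactly on the span of `us`, so it carries a complement inside `hs` injectively
  -- to a space of dimension k.
  difference : ∀ {k l} (hs : Vec (F n) (k ℕ.+ l)) (us : Vec (F n) l) → ZeroSum hs → ZeroSum us → us ⊑ hs → ZS k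
  difference {k} hs us (Chs , shs) (Cus , sus) sub with extend hs us Chs Cus sub k ℕ.≤-refl
  ... | ws , Cws , sub′ = map (L us) ws , C≢0 , s≡0
    where
    open ≡-Reasoning
    C≢0 : C (map (L us) ws) ≢ 0F
    C≢0 e = Cws (trans (C-++ ws us) (trans (cong (_· C us) e) (·-zeroˡ _)))
    s≡0 : s (map (L us) ws) ≡ 0F
    s≡0 = ·-cancelˡ Cus (begin
      C us · s (map (L us) ws)           ≡⟨ ⊕-identityˡ _ ⟨
      0F ⊕ C us · s (map (L us) ws)      ≡⟨ cong (_⊕ C us · s (map (L us) ws)) sus ⟨
      s us ⊕ C us · s (map (L us) ws)    ≡⟨ s-++ ws us Cws ⟨
      s (ws ++ us)                       ≡⟨ s-⊑ (ws ++ us) hs Cws sub′ ⟩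
      s hs                               ≡⟨ shs ⟩
      0F                                 ≡⟨ ·-zeroʳ (C us) ⟨
      C us · 0F                          ∎)

  C-basis : C (basis n) ≢ 0F
  C-basis = LinIndep⇒C≢0 (basis n) (λ c e → trans (sym (combo-basis c)) e)

  ⊑-basis : ∀ {k} (us : Vec (F n) k) → us ⊑ basis n
  ⊑-basis us c = combo c us , sym (combo-basis _)

  module WithScalar {g : F n} (g≢0 : g ≢ 0F) (g≢1 : g ≢ 1F) where

    -- The whole field is invariant under every scaling, so one scalar outside 𝔽₂ is enough.
    s-basis : s (basis n) ≡ 0F
    s-basis = invariant⇒s≡0 (basis n) C-basis g≢0 g≢1 (⊑-basis _)

    duality : ∀ {k l} → k ℕ.+ l ≡ n → ZS l → ZS k
    duality {k} {l} e (us , zs) = lemma e (basis n) (C-basis , s-basis) (⊑-basis us)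
      where
      lemma : ∀ {m} → k ℕ.+ l ≡ m → (hs : Vec (F n) m) → ZeroSum hs → us ⊑ hs → ZS k
      lemma refl hs zhs sub = difference hs us zhs zs sub

  s-single : ∀ v → s (v ∷ []) ≡ inv v
  s-single v = trans (s-cons v []) (trans (cong₂ _⊕_ (trans (A-[] 0F) inv-0) (A-[] v)) (⊕-identityˡ _))

  s-pair : ∀ u v → s (u ∷ v ∷ []) ≡ inv v ⊕ inv u ⊕ inv (v ⊕ u)
  s-pair u v = begin
    s (u ∷ v ∷ [])                           ≡⟨ s-cons u (v ∷ []) ⟩
    s (v ∷ []) ⊕ A (v ∷ []) u                ≡⟨ cong₂ _⊕_ (s-single v) (trans (A-cons v [] u) (cong₂ _⊕_ (A-[] u) (trans (A-[] _) (cong inv (⊕-comm u v))))) ⟩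
    inv v ⊕ (inv u ⊕ inv (v ⊕ u))            ≡⟨ ⊕-assoc _ _ _ ⟨
    inv v ⊕ inv u ⊕ inv (v ⊕ u)              ∎
    where open ≡-Reasoning

  ¬ZS-1 : ¬ ZS 1
  ¬ZS-1 (v ∷ [] , C≢0 , e) = inv-≢0 (proj₁ (C-cons≢0 v [] C≢0)) (trans (sym (s-single v)) e)

  -- Odd degree: images of subspace polynomials and sums of dimensions

  module OddSubspaces (j : ℕ) (n≡ : n ≡ suc (j ℕ.+ j)) where

    open Odd j n≡

    quadratic≢0 : ∀ x y → y ≢ 0F → x · x ⊕ x · y ⊕ y · y ≢ 0F
    quadratic≢0 x y y≢0 e = no-cube-root (x · inv y) (begin
      (x · i) · (x · i) ⊕ x · i ⊕ 1F
        ≡⟨ cong₂ (λ p q → (x · i) · (x · i) ⊕ p ⊕ q)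
             (trans (cong (x · i ·_) (·-inverseʳ y y≢0)) (·-identityʳ (x · i)))
             (trans (cong₂ _·_ (·-inverseʳ y y≢0) (·-inverseʳ y y≢0)) (·-identityˡ 1F)) ⟨
      (x · i) · (x · i) ⊕ x · i · (y · i) ⊕ (y · i) · (y · i)
        ≡⟨ solve 3 (λ x y i → (x :* i) :* (x :* i) :+ x :* i :* (y :* i) :+ (y :* i) :* (y :* i) := (x :* x :+ x :* y :+ y :* y) :* (i :* i)) refl x y i ⟩
      (x · x ⊕ x · y ⊕ y · y) · (i · i)
        ≡⟨ cong (_· (i · i)) e ⟩
      0F · (i · i)
        ≡⟨ ·-zeroˡ _ ⟩
      0F ∎)
      where
      open ≡-Reasoning
      open Solver
      i = inv y

    -- Multiplication by xy(x + y) turns the sum into x² + xy + y², the homogeneous form of t² + t +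
    -- 1.
    inv-sum≢0 : ∀ x y → x ≢ 0F → y ≢ 0F → x ⊕ y ≢ 0F → inv x ⊕ inv y ⊕ inv (x ⊕ y) ≢ 0F
    inv-sum≢0 x y x≢0 y≢0 x⊕y≢0 e = quadratic≢0 x y y≢0 (begin
      x · x ⊕ x · y ⊕ y · y
        ≡⟨ solve 2 (λ x y → x :* x :+ x :* y :+ y :* y := con true :* y :* (x :+ y) :+ con true :* x :* (x :+ y) :+ con true :* x :* y) refl x y ⟩
      1F · y · (x ⊕ y) ⊕ 1F · x · (x ⊕ y) ⊕ 1F · x · y
        ≡⟨ cong₂ _⊕_ (cong₂ (λ p q → p · y · (x ⊕ y) ⊕ q · x · (x ⊕ y)) (·-inverseʳ x x≢0) (·-inverseʳ y y≢0))
                     (cong (λ p → p · x · y) (·-inverseʳ (x ⊕ y) x⊕y≢0)) ⟨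
      x · i · y · (x ⊕ y) ⊕ y · j′ · x · (x ⊕ y) ⊕ (x ⊕ y) · k · x · y
        ≡⟨ solve 5 (λ x y i j k → x :* i :* y :* (x :+ y) :+ y :* j :* x :* (x :+ y) :+ (x :+ y) :* k :* x :* y := (x :* y :* (x :+ y)) :* (i :+ j :+ k)) refl x y i j′ k ⟩
      (x · y · (x ⊕ y)) · (i ⊕ j′ ⊕ k)
        ≡⟨ cong ((x · y · (x ⊕ y)) ·_) e ⟩
      (x · y · (x ⊕ y)) · 0F
        ≡⟨ ·-zeroʳ _ ⟩
      0F ∎)
      where
      open ≡-Reasoning
      open Solver
      i = inv x
      j′ = inv y
      k = inv (x ⊕ y)

    ¬ZS-2 : ¬ ZS 2
    ¬ZS-2 (u ∷ v ∷ [] , C≢0 , e) with C-cons≢0 u (v ∷ []) C≢0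
    ... | L≢0 , C′≢0 = inv-sum≢0 v u (proj₁ (C-cons≢0 v [] C′≢0)) u≢0 v⊕u≢0 (trans (sym (s-pair u v)) e)
      where
      u≢0 : u ≢ 0F
      u≢0 refl = L≢0 (·-zeroˡ _)
      v⊕u≢0 : v ⊕ u ≢ 0F
      v⊕u≢0 e′ = L≢0 (trans (cong (u ·_) (trans (⊕-comm u v) e′)) (·-zeroʳ u))

    -- π vs z vanishes only if z lies in the image of L vs; the equation L (v ∷ vs) x = z is
    -- the Artin–Schreier equation y² + a y = z for y = L vs x, where a = L vs v.
    π : ∀ {k} → Vec (F n) k → F n → Vec Bool k
    π []       z = []
    π (v ∷ vs) z = let a = L vs v ; w = z · inv (a · a) in tr w ∷ π vs (a · half w)

    -- `half` is additive on the whole field, also where it does not solve the Artin-Schreier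
    -- equation. Hence k bits cut out a subspace of codimension at most k.
    π-⊕ : ∀ {k} (vs : Vec (F n) k) x y → π vs (x ⊕ y) ≡ π vs x ⊕ π vs y
    π-⊕ []       x y = refl
    π-⊕ (v ∷ vs) x y = cong₂ _∷_
      (trans (cong tr (·-distribʳ i x y)) (tr-⊕ (x · i) (y · i)))
      (begin
        π vs (a · half ((x ⊕ y) · i))
          ≡⟨ cong (λ t → π vs (a · t)) (trans (cong half (·-distribʳ i x y)) (halfTrace-⊕ j (x · i) (y · i))) ⟩
        π vs (a · (half (x · i) ⊕ half (y · i)))
          ≡⟨ cong (π vs) (·-distribˡ a _ _) ⟩
        π vs (a · half (x · i) ⊕ a · half (y · i))
          ≡⟨ π-⊕ vs _ _ ⟩
        π vs (a · half (x · i)) ⊕ π vs (a · half (y · i)) ∎)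
      where
      open ≡-Reasoning
      a = L vs v
      i = inv (a · a)

    π≡0⇒image : ∀ {k} (vs : Vec (F n) k) → C vs ≢ 0F → ∀ z → π vs z ≡ 0F → ∃[ x ] L vs x ≡ z
    π≡0⇒image []       _  z _ = z , refl
    π≡0⇒image (v ∷ vs) ne z e with C-cons≢0 v vs ne
    ... | a≢0 , Cvs with π≡0⇒image vs Cvs _ (Vec.∷-injectiveʳ e)
    ... | x , Lx≡ = x , (begin
      L (v ∷ vs) x                       ≡⟨ L-cons v vs x ⟩
      L vs x · (L vs x ⊕ a)              ≡⟨ cong (λ t → t · (t ⊕ a)) Lx≡ ⟩
      -- The substitution y = a h reduces y² + a y = z to h² + h = z/a², which the half trace
      -- solves.
      (a · h) · (a · h ⊕ a)              ≡⟨ solve 2 (λ a h → (a :* h) :* (a :* h :+ a) := (a :* a) :* (h :* h :+ h)) refl a h ⟩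
      (a · a) · (h · h ⊕ h)              ≡⟨ cong ((a · a) ·_) (artin-schreier w (Vec.∷-injectiveˡ e)) ⟩
      (a · a) · (z · inv (a · a))        ≡⟨ solve 3 (λ p z i → p :* (z :* i) := z :* (p :* i)) refl (a · a) z (inv (a · a)) ⟩
      z · ((a · a) · inv (a · a))        ≡⟨ cong (z ·_) (·-inverseʳ _ (·≢0 a≢0 a≢0)) ⟩
      z · 1F                             ≡⟨ ·-identityʳ z ⟩
      z                                  ∎)
      where
      open ≡-Reasoning
      open Solver
      a = L vs v
      w = z · inv (a · a)
      h = half w

    -- {b : b·u ∈ image of L vs for all u in us} has codimension at most k·l, so it contains some b ≠ 0.
    sum : ∀ {k l} → ZS l → ZS k → l ℕ.* k < n → ZS (l ℕ.+ k)
    sum {k} (us , Cus , sus) (vs , Cvs , svs) lk<n = conclude (kernel (Φ us) (Φ-⊕ us) lk<n)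
      where
      Φ : ∀ {l} → Vec (F n) l → F n → Vec Bool (l ℕ.* k)
      Φ []       b = []
      Φ (u ∷ us) b = π vs (b · u) ++ Φ us b
      Φ-⊕ : ∀ {l} (us : Vec (F n) l) b c → Φ us (b ⊕ c) ≡ Φ us b ⊕ Φ us c
      Φ-⊕ []       b c = refl
      Φ-⊕ (u ∷ us) b c = trans
        (cong₂ _++_ (trans (cong (π vs) (·-distribʳ u b c)) (π-⊕ vs (b · u) (c · u))) (Φ-⊕ us b c))
        (sym (Vec.zipWith-++ _xor_ (π vs (b · u)) (Φ us b) (π vs (c · u)) (Φ us c)))
      lift : ∀ {l} (us : Vec (F n) l) b → Φ us b ≡ 0F → ∃[ ws ] map (L vs) ws ≡ map (b ·_) us
      lift []       b e = [] , refl
      lift {suc l} (u ∷ us) b e with Vec.++-injective (π vs (b · u)) 0F (trans e (0F-++ k (l ℕ.* k)))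
      ... | e₁ , e₂ = let w , Lw = π≡0⇒image vs Cvs (b · u) e₁ ; ws , Lws = lift us b e₂ in w ∷ ws , cong₂ _∷_ Lw Lws
      conclude : (∃[ b ] b ≢ 0F × Φ us b ≡ 0F) → _
      conclude (b , b≢0 , Φ≡0) with lift us b Φ≡0
      ... | ws , Lws = ws ++ vs , C≢0 , (begin
        s (ws ++ vs)                       ≡⟨ s-++ ws vs C≢0 ⟩
        s vs ⊕ C vs · s (map (L vs) ws)    ≡⟨ cong₂ (λ p q → p ⊕ C vs · s q) svs Lws ⟩
        0F ⊕ C vs · s (map (b ·_) us)      ≡⟨ cong (λ t → 0F ⊕ C vs · t) (trans (s-scale b us) (trans (cong (inv b ·_) sus) (·-zeroʳ _))) ⟩
        0F ⊕ C vs · 0F                     ≡⟨ trans (⊕-identityˡ _) (·-zeroʳ _) ⟩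
        0F                                 ∎)
        where
        open ≡-Reasoning
        C≢0 : C (ws ++ vs) ≢ 0F
        C≢0 e = ·≢0 (subst (λ t → C t ≢ 0F) (sym Lws) (C-scale us b≢0 Cus)) Cvs (trans (sym (C-++ ws vs)) e)

-- The subfield with 32 elements

combo-++ : ∀ {n k l} (c : Vec Bool k) (d : Vec Bool l) (us : Vec (F n) k) vs → combo (c ++ d) (us ++ vs) ≡ combo c us ⊕ combo d vs
combo-++ []       d []       vs = sym (⊕-identityˡ _)
combo-++ (c ∷ cs) d (u ∷ us) vs = trans (cong (c ⊙ u ⊕_) (combo-++ cs d us vs)) (sym (⊕-assoc (c ⊙ u) _ _))

-- Computations with binary polynomials for degree five

module BinaryPolynomials where

  -- Polynomials over 𝔽₂ as coefficient lists, constant term first.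
  _+ₚ_ _*ₚ_ : List Bool → List Bool → List Bool
  []      +ₚ q       = q
  (a ∷ p) +ₚ []      = a ∷ p
  (a ∷ p) +ₚ (b ∷ q) = (a xor b) ∷ (p +ₚ q)
  []      *ₚ q = []
  (a ∷ p) *ₚ q = (if a then q else []) +ₚ (false ∷ (p *ₚ q))

  -- The first k coefficients of the power series p / c, once the leading zeros of c are cancelled.
  divide : ℕ → List Bool → List Bool → List Bool
  divide zero    _       _           = []
  divide (suc k) []      _           = []
  divide (suc k) (a ∷ p) []          = []
  divide (suc k) (a ∷ p) (false ∷ c) = divide k p c
  divide (suc k) (a ∷ p) (true ∷ c)  = a ∷ divide k (if a then p +ₚ c else p) (true ∷ c)

  xᵏ : ℕ → List Bool
  xᵏ zero    = true ∷ []
  xᵏ (suc k) = false ∷ xᵏ k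

  isZero : List Bool → Bool
  isZero []          = true
  isZero (false ∷ p) = isZero p
  isZero (true ∷ p)  = false

  opaque
    -- Every nonzero polynomial of degree at most 4 divides M.
    M : List Bool
    -- x⁶⁴ + x⁴ = (x¹⁶ + x)⁴ supplies the irreducible factors of degrees 1, 2 and 4, each four
    -- times; x⁸ + x supplies those of degree 3.
    M = (xᵏ 64 +ₚ xᵏ 4) *ₚ (xᵏ 8 +ₚ xᵏ 1)

    M≡ : M ≡ (xᵏ 64 +ₚ xᵏ 4) *ₚ (xᵏ 8 +ₚ xᵏ 1)
    M≡ = refl

    divides-M : ∀ (c : Vec Bool 5) → c ≢ 0F → ∃[ d ] isZero ((toList c *ₚ d) +ₚ M) ≡ true
    -- `M` has degree 72, so 73 coefficients contain the whole quotient. Divisibility is then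
    -- checked by evaluation for every c.
    divides-M c c≢0 = divide 73 M (toList c) ,
      All.lookup (toWitness {a? = All.all? (λ c → ¬? (c ≟F 0F) →-dec (isZero ((toList c *ₚ divide 73 M (toList c)) +ₚ M) Bool.≟ true)) (allVecs 5)} tt)
        (∈-allVecs c) c≢0

  -- The lower coefficients of the six irreducible polynomials of degree 5.
  quintics : List (Vec Bool 5)
  quintics =
    (true ∷ false ∷ true ∷ false ∷ false ∷ []) ∷ (true ∷ false ∷ false ∷ true ∷ false ∷ []) ∷
    (true ∷ true ∷ true ∷ true ∷ false ∷ []) ∷ (true ∷ true ∷ true ∷ false ∷ true ∷ []) ∷
    (true ∷ true ∷ false ∷ true ∷ true ∷ []) ∷ (true ∷ false ∷ true ∷ true ∷ true ∷ []) ∷ []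

  monic : ∀ {k} → Vec Bool k → List Bool
  monic {k} q = toList q +ₚ xᵏ k

  ∏monic : ∀ {k} → List (Vec Bool k) → List Bool
  ∏monic = List.foldr (λ q → monic q *ₚ_) (true ∷ [])

  -- The roots of x³¹ + 1 are the nonzero elements of the field with 32 elements: 1 and the 30 roots
  -- of the six quintics.
  x³¹+1-factors : isZero (((true ∷ true ∷ []) *ₚ ∏monic quintics) +ₚ (xᵏ 31 +ₚ xᵏ 0)) ≡ true
  x³¹+1-factors = refl

  -- N m = (32ᵐ − 1) / 31.
  N : ℕ → ℕ
  N zero    = 0
  N (suc m) = 1 ℕ.+ 32 ℕ.* N m

  2^5m : ∀ m → 2 ℕ.^ (m ℕ.* 5) ≡ 1 ℕ.+ N m ℕ.* 31
  2^5m zero    = refl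
  2^5m (suc m) = begin
    2 ℕ.^ (5 ℕ.+ m ℕ.* 5)             ≡⟨ ℕ.^-distribˡ-+-* 2 5 (m ℕ.* 5) ⟩
    32 ℕ.* 2 ℕ.^ (m ℕ.* 5)            ≡⟨ cong (32 ℕ.*_) (2^5m m) ⟩
    32 ℕ.* (1 ℕ.+ N m ℕ.* 31)         ≡⟨ lemma (N m) ⟩
    1 ℕ.+ (1 ℕ.+ 32 ℕ.* N m) ℕ.* 31   ∎
    where
    open ≡-Reasoning
    lemma : ∀ k → 32 ℕ.* (1 ℕ.+ k ℕ.* 31) ≡ 1 ℕ.+ (1 ℕ.+ 32 ℕ.* k) ℕ.* 31
    lemma = ℕSolver.solve-∀

-- An element of order 31

module Roots {n : ℕ} (𝔽 : BinaryField n) where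

  open FieldProperties 𝔽
  open BinaryPolynomials using (N; 2^5m)

  -- A monic polynomial, given by its lower coefficients.
  eval : List (F n) → F n → F n
  eval []       x = 1F
  eval (c ∷ cs) x = c ⊕ x · eval cs x

  -- Synthetic division by x + a: the coefficients are the values at a of the tails in Horner's
  -- scheme.
  quotient : F n → List (F n) → List (F n)
  quotient a []            = []
  quotient a (_ ∷ [])      = []
  quotient a (_ ∷ c ∷ cs)  = eval (c ∷ cs) a ∷ quotient a (c ∷ cs)

  quotient-length : ∀ a c cs → suc (length (quotient a (c ∷ cs))) ≡ length (c ∷ cs)
  quotient-length a c []        = refl
  quotient-length a c (d ∷ cs)  = cong suc (quotient-length a d cs)

  eval-quotient : ∀ a x c cs → eval (c ∷ cs) x ⊕ eval (c ∷ cs) a ≡ (x ⊕ a) · eval (quotient a (c ∷ cs)) x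
  eval-quotient a x c [] =
    solve 3 (λ a x c → (c :+ x :* con true) :+ (c :+ a :* con true) := (x :+ a) :* con true) refl a x c
    where open Solver
  eval-quotient a x c (d ∷ cs) = begin
    (c ⊕ x · p) ⊕ (c ⊕ a · p′)       ≡⟨ solve 5 (λ a x c p p′ → (c :+ x :* p) :+ (c :+ a :* p′) := x :* (p :+ p′) :+ (x :+ a) :* p′) refl a x c p p′ ⟩
    x · (p ⊕ p′) ⊕ (x ⊕ a) · p′      ≡⟨ cong (λ t → x · t ⊕ (x ⊕ a) · p′) (eval-quotient a x d cs) ⟩
    x · ((x ⊕ a) · r) ⊕ (x ⊕ a) · p′ ≡⟨ solve 4 (λ a x r p′ → x :* ((x :+ a) :* r) :+ (x :+ a) :* p′ := (x :+ a) :* (p′ :+ x :* r)) refl a x r p′ ⟩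
    (x ⊕ a) · (p′ ⊕ x · r)           ∎
    where
    open ≡-Reasoning
    open Solver
    p  = eval (d ∷ cs) x
    p′ = eval (d ∷ cs) a
    r  = eval (quotient a (d ∷ cs)) x

  root-bound : ∀ cs rs → Unique rs → All (λ r → eval cs r ≡ 0F) rs → length rs ≤ length cs
  root-bound cs       []       _        _        = z≤n
  root-bound []       (r ∷ rs) _        (e ∷ _)  = ⊥-elim (1≢0 e)
  root-bound (c ∷ cs) (r ∷ rs) (r∉ ∷ u) (e ∷ es) =
    subst (suc (length rs) ≤_) (quotient-length r c cs) (s≤s (root-bound (quotient r (c ∷ cs)) rs u (All.zipWith root (r∉ , es))))
    where
    root : ∀ {x} → r ≢ x × eval (c ∷ cs) x ≡ 0F → eval (quotient r (c ∷ cs)) x ≡ 0F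
    root {x} (r≢x , ex) with ·≡0 (x ⊕ r) _ (trans (sym (eval-quotient r x c cs)) (trans (cong₂ _⊕_ ex e) (⊕-self 0F)))
    ... | inj₁ x⊕r≡0 = ⊥-elim (r≢x (sym (⊕≡0⇒≡ x r x⊕r≡0)))
    ... | inj₂ e′    = e′

  eval-replicate : ∀ k x → eval (List.replicate k 0F) x ≡ x ^ k
  eval-replicate zero    x = refl
  eval-replicate (suc k) x = trans (⊕-identityˡ _) (cong (x ·_) (eval-replicate k x))

  private
    -- For x ≠ 0 the power x^N satisfies (x^N)³¹ = x^(q-1) = 1. If it were 1 for all x ≠ 0, the
    -- polynomial x^(N+1) + x would have q roots, more than its degree.
    31-torsion : ∀ N → 0 < N → 2 ℕ.^ n ≡ 1 ℕ.+ N ℕ.* 31 → ∃[ g ] g ^ 31 ≡ 1F × g ≢ 1F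
    31-torsion (suc N) _ e with ∃? (λ x → ¬? ((x · (x ^ suc N ⊕ 1F)) ≟F 0F))
    ... | yes (x , ne) = x ^ suc N , ·-cancelˡ x≢0 (begin
      x · (x ^ suc N) ^ 31        ≡⟨ cong (x ·_) (^-assocʳ x (suc N) 31) ⟩
      x ^ (1 ℕ.+ suc N ℕ.* 31)    ≡⟨ cong (x ^_) e ⟨
      x ^ (2 ℕ.^ n)               ≡⟨ fermat x ⟩
      x                           ≡⟨ ·-identityʳ x ⟨
      x · 1F                      ∎) , λ e′ → ne (trans (cong (λ t → x · (t ⊕ 1F)) e′) (trans (cong (x ·_) (⊕-self 1F)) (·-zeroʳ x)))
      where
      open ≡-Reasoning
      x≢0 : x ≢ 0F
      x≢0 refl = ne (·-zeroˡ _)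
    ... | no none = ⊥-elim (ℕ.<⇒≱ too-many (subst₂ _≤_ (allVecs-length n) (cong (suc ∘ suc) (List.length-replicate N))
                      -- The lower coefficients of x^(N+2) + x; the exponent called N in the type is
                      -- `suc N` here.
                      (root-bound (0F ∷ 1F ∷ List.replicate N 0F) (allVecs n) (allVecs-unique n) (All.universal root (allVecs n)))))
      where
      root : ∀ x → eval (0F ∷ 1F ∷ List.replicate N 0F) x ≡ 0F
      root x with (x · (x ^ suc N ⊕ 1F)) ≟F 0F
      ... | no ne  = ⊥-elim (none (x , ne))
      ... | yes e′ = begin
        0F ⊕ x · (1F ⊕ x · eval (List.replicate N 0F) x)  ≡⟨ ⊕-identityˡ _ ⟩
        x · (1F ⊕ x · eval (List.replicate N 0F) x)       ≡⟨ cong (λ t → x · (1F ⊕ x · t)) (eval-replicate N x) ⟩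
        x · (1F ⊕ x ^ suc N)                              ≡⟨ cong (x ·_) (⊕-comm 1F _) ⟩
        x · (x ^ suc N ⊕ 1F)                              ≡⟨ e′ ⟩
        0F                                                ∎
        where open ≡-Reasoning
      too-many : suc (suc N) < 2 ℕ.^ n
      too-many = subst (suc (suc N) <_) (sym e) (s≤s (s≤s (ℕ.≤-trans (s≤s (ℕ.m≤m*n N 31)) (ℕ.+-monoˡ-≤ (N ℕ.* 31) (s≤s (z≤n {29}))))))

  31-torsion-element : ∀ m → 0 < m → n ≡ m ℕ.* 5 → ∃[ g ] g ^ 31 ≡ 1F × g ≢ 1F
  31-torsion-element (suc m) _ e = 31-torsion (N (suc m)) (s≤s z≤n) (trans (cong (2 ℕ.^_) e) (2^5m (suc m)))

-- Vector spaces over the field generated by an element of order 31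

module Subfield {n : ℕ} (𝔽 : BinaryField n) {g : F n} where

  open BinaryPolynomials
  open FieldProperties 𝔽
  open Subspaces 𝔽

  ev : List Bool → F n
  ev []      = 0F
  ev (a ∷ p) = a ⊙ 1F ⊕ g · ev p

  ev-+ : ∀ p q → ev (p +ₚ q) ≡ ev p ⊕ ev q
  ev-+ []      q       = sym (⊕-identityˡ _)
  ev-+ (a ∷ p) []      = sym (⊕-identityʳ _)
  ev-+ (a ∷ p) (b ∷ q) = trans
    (cong₂ _⊕_ (⊙-distribʳ a b 1F) (trans (cong (g ·_) (ev-+ p q)) (·-distribˡ g _ _)))
    (⊕-interchange (a ⊙ 1F) _ _ _)

  ev-* : ∀ p q → ev (p *ₚ q) ≡ ev p · ev q
  ev-* []          q = sym (·-zeroˡ _)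
  ev-* (false ∷ p) q = trans (cong (λ t → 0F ⊕ g · t) (ev-* p q))
    (solve 3 (λ g p q → con false :+ g :* (p :* q) := (con false :+ g :* p) :* q) refl g (ev p) (ev q))
    where open Solver
  ev-* (true ∷ p)  q = trans (ev-+ q _) (trans (cong (λ t → ev q ⊕ (0F ⊕ g · t)) (ev-* p q))
    (solve 3 (λ g p q → q :+ (con false :+ g :* (p :* q)) := (con true :+ g :* p) :* q) refl g (ev p) (ev q)))
    where open Solver

  ev-xᵏ : ∀ k → ev (xᵏ k) ≡ g ^ k
  ev-xᵏ zero    = trans (cong (1F ⊕_) (·-zeroʳ g)) (⊕-identityʳ 1F)
  ev-xᵏ (suc k) = trans (⊕-identityˡ _) (cong (g ·_) (ev-xᵏ k))

  ev-isZero : ∀ p → isZero p ≡ true → ev p ≡ 0F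
  ev-isZero []          _ = refl
  ev-isZero (false ∷ p) e = trans (⊕-identityˡ _) (trans (cong (g ·_) (ev-isZero p e)) (·-zeroʳ g))
  ev-isZero (true ∷ p)  ()

  ev-≈ : ∀ p q → isZero (p +ₚ q) ≡ true → ev p ≡ ev q
  ev-≈ p q e = ⊕≡0⇒≡ _ _ (trans (sym (ev-+ p q)) (ev-isZero (p +ₚ q) e))

  module Degree5 (g³¹≡1 : g ^ 31 ≡ 1F) (g≢1 : g ≢ 1F) where

    open ≡-Reasoning

    g≢0 : g ≢ 0F
    g≢0 = ·≡1⇒≢0ˡ g³¹≡1

    -- By g³¹ = 1 the exponent 64 drops to 2, and the value becomes (g(g + 1))² · g(g⁷ + 1). Its
    -- last factor is nonzero because 7 and 31 are coprime.
    ev-M≢0 : ev M ≢ 0F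
    ev-M≢0 = subst (_≢ 0F) (sym ev-M) (·≢0 (·≢0 (·≢0 g≢0 g+1≢0) (·≢0 g≢0 g+1≢0)) (·≢0 g≢0 g⁷+1≢0))
      where
      g^31+ : ∀ k → g ^ (31 ℕ.+ k) ≡ g ^ k
      g^31+ k = trans (^-homo-* g 31 k) (trans (cong (_· g ^ k) g³¹≡1) (·-identityˡ _))
      g+1≢0 : g ⊕ 1F ≢ 0F
      g+1≢0 e = g≢1 (⊕≡0⇒≡ g 1F e)
      g⁷+1≢0 : g ^ 7 ⊕ 1F ≢ 0F
      -- If g⁷ = 1, then g³¹ = 1 gives g³ = 1, since 31 = 4 · 7 + 3. Exponents can now be changed by
      -- 7 and by 3: 1, 8, 5, 2, 9, 0.
      g⁷+1≢0 e = g≢1 (begin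
        g                        ≡⟨ ·-identityʳ g ⟨
        g ^ 1                    ≡⟨ g^7+ 1 ⟨
        g ^ 8                    ≡⟨ ^-homo-* g 3 5 ⟩
        g ^ 3 · g ^ 5            ≡⟨ cong (_· g ^ 5) g³≡1 ⟩
        1F · g ^ 5               ≡⟨ ·-identityˡ _ ⟩
        g ^ 5                    ≡⟨ ^-homo-* g 3 2 ⟩
        g ^ 3 · g ^ 2            ≡⟨ cong (_· g ^ 2) g³≡1 ⟩
        1F · g ^ 2               ≡⟨ ·-identityˡ _ ⟩
        g ^ 2                    ≡⟨ g^7+ 2 ⟨
        g ^ 9                    ≡⟨ ^-assocʳ g 3 3 ⟨
        (g ^ 3) ^ 3              ≡⟨ cong (_^ 3) g³≡1 ⟩
        1F ^ 3                   ≡⟨ trans (·-identityˡ _) (trans (·-identityˡ _) (·-identityˡ 1F)) ⟩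
        1F                       ∎)
        where
        g^7+ : ∀ k → g ^ (7 ℕ.+ k) ≡ g ^ k
        g^7+ k = trans (^-homo-* g 7 k) (trans (cong (_· g ^ k) (⊕≡0⇒≡ _ _ e)) (·-identityˡ _))
        g³≡1 : g ^ 3 ≡ 1F
        g³≡1 = begin
          g ^ 3   ≡⟨ trans (g^7+ 24) (trans (g^7+ 17) (trans (g^7+ 10) (g^7+ 3))) ⟨
          g ^ 31  ≡⟨ g³¹≡1 ⟩
          1F      ∎
      ev-binomials : ∀ a b c d → ev ((xᵏ a +ₚ xᵏ b) *ₚ (xᵏ c +ₚ xᵏ d)) ≡ (g ^ a ⊕ g ^ b) · (g ^ c ⊕ g ^ d)
      ev-binomials a b c d = trans (ev-* (xᵏ a +ₚ xᵏ b) (xᵏ c +ₚ xᵏ d)) (cong₂ _·_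
        (trans (ev-+ (xᵏ a) (xᵏ b)) (cong₂ _⊕_ (ev-xᵏ a) (ev-xᵏ b)))
        (trans (ev-+ (xᵏ c) (xᵏ d)) (cong₂ _⊕_ (ev-xᵏ c) (ev-xᵏ d))))
      ev-M : ev M ≡ ((g · (g ⊕ 1F)) · (g · (g ⊕ 1F))) · (g · (g ^ 7 ⊕ 1F))
      ev-M = begin
        ev M ≡⟨ trans (cong ev M≡) (ev-binomials 64 4 8 1) ⟩
        (g ^ 64 ⊕ g ^ 4) · (g · g ^ 7 ⊕ g ^ 1)
          ≡⟨ cong (λ t → (t ⊕ g ^ 4) · (g · g ^ 7 ⊕ g ^ 1)) (trans (g^31+ 33) (g^31+ 2)) ⟩
        (g ^ 2 ⊕ g ^ 4) · (g · g ^ 7 ⊕ g ^ 1)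
          ≡⟨ solve 2 (λ g p → (g :* (g :* con true) :+ g :* (g :* (g :* (g :* con true)))) :* (g :* p :+ g :* con true)
                          := ((g :* (g :+ con true)) :* (g :* (g :+ con true))) :* (g :* (p :+ con true))) refl g (g ^ 7) ⟩
        ((g · (g ⊕ 1F)) · (g · (g ⊕ 1F))) · (g · (g ^ 7 ⊕ 1F)) ∎
        where open Solver

    opaque
      -- A polynomial vanishing at g cannot divide `M`. Hence 1, g, ..., g⁴ are independent over 𝔽₂.
      ev≢0 : ∀ (c : Vec Bool 5) → c ≢ 0F → ev (toList c) ≢ 0F
      ev≢0 c c≢0 e with divides-M c c≢0
      ... | d , c*d≈M = ev-M≢0 (begin
        ev M                                ≡⟨ ev-≈ (toList c *ₚ d) M c*d≈M ⟨
        ev (toList c *ₚ d)                  ≡⟨ ev-* (toList c) d ⟩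
        ev (toList c) · ev d                ≡⟨ cong (_· ev d) e ⟩
        0F · ev d                           ≡⟨ ·-zeroˡ _ ⟩
        0F                                  ∎)

    monic-root : ∀ {k} (qs : List (Vec Bool k)) → ev (∏monic qs) ≡ 0F → ∃[ q ] ev (toList {n = k} q) ≡ g ^ k
    monic-root     []       e = ⊥-elim (1≢0 (trans (sym (ev-xᵏ 0)) e))
    monic-root {k} (q ∷ qs) e with ·≡0 _ _ (trans (sym (ev-* (monic q) (∏monic qs))) e)
    ... | inj₂ e′ = monic-root qs e′
    ... | inj₁ e′ = q , ⊕≡0⇒≡ _ _ (trans (cong (ev (toList q) ⊕_) (sym (ev-xᵏ k))) (trans (sym (ev-+ (toList q) (xᵏ k))) e′))

    factor-root : ∀ k p → isZero (((true ∷ true ∷ []) *ₚ p) +ₚ (xᵏ k +ₚ xᵏ 0)) ≡ true → g ^ k ≡ 1F → ev p ≡ 0F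
    factor-root k p factors g^k≡1 with ·≡0 (ev (true ∷ true ∷ [])) (ev p) (begin
      ev (true ∷ true ∷ []) · ev p          ≡⟨ ev-* (true ∷ true ∷ []) p ⟨
      ev ((true ∷ true ∷ []) *ₚ p)          ≡⟨ ev-≈ ((true ∷ true ∷ []) *ₚ p) (xᵏ k +ₚ xᵏ 0) factors ⟩
      ev (xᵏ k +ₚ xᵏ 0)                     ≡⟨ ev-+ (xᵏ k) (xᵏ 0) ⟩
      ev (xᵏ k) ⊕ ev (xᵏ 0)                 ≡⟨ cong₂ _⊕_ (trans (ev-xᵏ k) g^k≡1) (ev-xᵏ 0) ⟩
      1F ⊕ 1F                               ≡⟨ ⊕-self 1F ⟩
      0F                                    ∎)
    ... | inj₂ e = e
    ... | inj₁ e = ⊥-elim (g≢1 (sym (⊕≡0⇒≡ 1F g (trans (cong (1F ⊕_) (sym (trans (ev-xᵏ 1) (·-identityʳ g)))) (trans (ev-1+x) e)))))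
      where
      ev-1+x : 1F ⊕ ev (xᵏ 1) ≡ ev (true ∷ true ∷ [])
      ev-1+x = trans (cong (_⊕ ev (xᵏ 1)) (sym (ev-xᵏ 0))) (sym (ev-+ (xᵏ 0) (xᵏ 1)))

    opaque
      -- Expresses g⁵ through 1, g, ..., g⁴, so that five consecutive multiples e, g e, ..., g⁴ e
      -- span a space closed under g.
      quintic-root : ∃[ q ] ev (toList {n = 5} q) ≡ g ^ 5
      quintic-root = monic-root quintics (factor-root 31 (∏monic quintics) x³¹+1-factors g³¹≡1)

    powers : ∀ k → F n → Vec (F n) k
    powers zero    e = []
    powers (suc k) e = e ∷ powers k (g · e)

    combo-powers : ∀ {k} (c : Vec Bool k) e → combo c (powers k e) ≡ ev (toList c) · e
    combo-powers []          e = sym (·-zeroˡ e)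
    combo-powers (false ∷ c) e = trans (cong (0F ⊕_) (combo-powers c (g · e)))
      (solve 3 (λ g p e → con false :+ p :* (g :* e) := (con false :+ g :* p) :* e) refl g (ev (toList c)) e)
      where open Solver
    combo-powers (true ∷ c)  e = trans (cong (e ⊕_) (combo-powers c (g · e)))
      (solve 3 (λ g p e → e :+ p :* (g :* e) := (con true :+ g :* p) :* e) refl g (ev (toList c)) e)
      where open Solver

    ev-push : ∀ {k} b (c : Vec Bool k) → ev (b ∷ toList c) ≡ ev (toList (proj₁ (push b c))) ⊕ proj₂ (push b c) ⊙ g ^ k
    ev-push b [] = trans (cong (b ⊙ 1F ⊕_) (·-zeroʳ g)) (⊕-comm _ _)
    ev-push {suc k} b (x ∷ c) = begin
      b ⊙ 1F ⊕ g · ev (x ∷ toList c)                     ≡⟨ cong (λ t → b ⊙ 1F ⊕ g · t) (ev-push x c) ⟩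
      b ⊙ 1F ⊕ g · (ev (toList ys) ⊕ o ⊙ g ^ k)          ≡⟨ cong (b ⊙ 1F ⊕_) (·-distribˡ g _ _) ⟩
      b ⊙ 1F ⊕ (g · ev (toList ys) ⊕ g · o ⊙ g ^ k)      ≡⟨ ⊕-assoc (b ⊙ 1F) _ _ ⟨
      ev (b ∷ toList ys) ⊕ g · o ⊙ g ^ k                 ≡⟨ cong (ev (b ∷ toList ys) ⊕_) (⊙-homo (g ·_) (·-zeroʳ g) o _) ⟩
      ev (b ∷ toList ys) ⊕ o ⊙ g ^ suc k                 ∎
      where
      ys : Vec Bool k
      ys = proj₁ (push x c)
      o : Bool
      o = proj₂ (push x c)

    ev-⊕ : ∀ {k} (c d : Vec Bool k) → ev (toList (c ⊕ d)) ≡ ev (toList c) ⊕ ev (toList d)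
    ev-⊕ []      []      = sym (⊕-identityˡ _)
    ev-⊕ (a ∷ p) (b ∷ q) = trans
      (cong₂ _⊕_ (⊙-distribʳ a b 1F) (trans (cong (g ·_) (ev-⊕ p q)) (·-distribˡ g _ _)))
      (⊕-interchange (a ⊙ 1F) _ _ _)

    ev-0F : ∀ k → ev (toList (0F {k})) ≡ 0F
    ev-0F zero    = refl
    ev-0F (suc k) = trans (⊕-identityˡ _) (trans (cong (g ·_) (ev-0F k)) (·-zeroʳ g))

    opaque
      g·ev : ∀ (c : Vec Bool 5) → ∃[ d ] g · ev (toList c) ≡ ev (toList {n = 5} d)
      g·ev c = let q , ev-q = quintic-root in s′ ⊕ o ⊙ q , (begin
        g · ev (toList c)                              ≡⟨ ⊕-identityˡ _ ⟨
        ev (false ∷ toList c)                          ≡⟨ ev-push false c ⟩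
        ev (toList s′) ⊕ o ⊙ g ^ 5                     ≡⟨ cong (λ t → ev (toList s′) ⊕ o ⊙ t) ev-q ⟨
        ev (toList s′) ⊕ o ⊙ ev (toList q)             ≡⟨ cong (ev (toList s′) ⊕_) (⊙-homo (ev ∘ toList) (ev-0F 5) o q) ⟨
        ev (toList s′) ⊕ ev (toList (o ⊙ q))           ≡⟨ ev-⊕ s′ (o ⊙ q) ⟨
        ev (toList (s′ ⊕ o ⊙ q))                       ∎)
        where
        s′ : Vec Bool 5
        s′ = proj₁ (push false c)
        o : Bool
        o = proj₂ (push false c)

    -- The span is a vector space over 𝔽₂(g), the field with 32 elements, expressed without
    -- constructing that field.
    Closed : ∀ {k} → Vec (F n) k → Set
    Closed hs = map (g ·_) hs ⊑ hs

    closed-ev : ∀ {k} (hs : Vec (F n) k) → Closed hs → ∀ p c → ∃[ d ] ev p · combo c hs ≡ combo d hs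
    closed-ev hs cl []      c = 0F , trans (·-zeroˡ _) (sym (combo-0 hs))
    closed-ev hs cl (a ∷ p) c with closed-ev hs cl p c
    ... | d , e with cl d
    ... | d′ , e′ = a ⊙ c ⊕ d′ , (begin
      (a ⊙ 1F ⊕ g · ev p) · x          ≡⟨ ·-distribʳ x (a ⊙ 1F) _ ⟩
      a ⊙ 1F · x ⊕ g · ev p · x        ≡⟨ cong₂ _⊕_ (⊙-homo (_· x) (·-zeroˡ x) a 1F) (·-assoc g (ev p) x) ⟩
      a ⊙ (1F · x) ⊕ g · (ev p · x)    ≡⟨ cong₂ _⊕_ (cong (a ⊙_) (·-identityˡ x)) (cong (g ·_) e) ⟩
      a ⊙ x ⊕ g · combo d hs           ≡⟨ cong₂ _⊕_ (⊙-homo (λ c → combo c hs) (combo-0 hs) a c) (combo-scale g d hs) ⟨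
      combo (a ⊙ c) hs ⊕ combo d (map (g ·_) hs)  ≡⟨ cong (combo (a ⊙ c) hs ⊕_) e′ ⟩
      combo (a ⊙ c) hs ⊕ combo d′ hs   ≡⟨ combo-⊕ (a ⊙ c) d′ hs ⟨
      combo (a ⊙ c ⊕ d′) hs            ∎)
      where x = combo c hs

    -- Multiplication by ev p ≠ 0 is injective on the finite span of hs, hence onto it.
    closed-cancel : ∀ {k} (hs : Vec (F n) k) → C hs ≢ 0F → Closed hs → ∀ p → ev p ≢ 0F → ∀ e d →
                    ev p · e ≡ combo d hs → ∃[ c ] e ≡ combo c hs
    closed-cancel hs Chs cl p p≢0 e d eq with injective⇒surjective {σ = proj₁ ∘ σ} σ-injective d
      where
      σ : ∀ c → ∃[ d ] ev p · combo c hs ≡ combo d hs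
      σ = closed-ev hs cl p
      σ-injective : Injective _≡_ _≡_ (proj₁ ∘ σ)
      σ-injective {c} {c′} e = LinIndep⇒injective (C≢0⇒LinIndep hs Chs) (·-cancelˡ p≢0
        (trans (proj₂ (σ c)) (trans (cong (λ t → combo t hs) e) (sym (proj₂ (σ c′))))))
    ... | c , d≡ = c , ·-cancelˡ p≢0 (trans eq (trans (cong (λ t → combo t hs) d≡) (sym (proj₂ (closed-ev hs cl p c)))))

    module _ {k : ℕ} (hs : Vec (F n) k) (Chs : C hs ≢ 0F) (cl : Closed hs) (e : F n) (e∉ : L hs e ≢ 0F) where

      adjoin : Vec (F n) (5 ℕ.+ k)
      adjoin = powers 5 e ++ hs

      combo-adjoin : ∀ c d → combo (c ++ d) adjoin ≡ ev (toList c) · e ⊕ combo d hs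
      combo-adjoin c d = trans (combo-++ c d (powers 5 e) hs) (cong (_⊕ combo d hs) (combo-powers c e))

      adjoin-C : C adjoin ≢ 0F
      adjoin-C = LinIndep⇒C≢0 adjoin independent
        where
        independent : LinIndep adjoin
        independent c e≡0 with Vec.splitAt 5 c
        ... | c₁ , c₂ , refl with c₁ ≟F 0F
        ... | yes refl = cong (0F {5} ++_) (C≢0⇒LinIndep hs Chs c₂ (begin
          combo c₂ hs                                ≡⟨ ⊕-identityˡ _ ⟨
          0F ⊕ combo c₂ hs                           ≡⟨ cong (_⊕ combo c₂ hs) (trans (cong (_· e) (ev-0F 5)) (·-zeroˡ e)) ⟨
          ev (toList (0F {5})) · e ⊕ combo c₂ hs     ≡⟨ combo-adjoin 0F c₂ ⟨
          combo (0F {5} ++ c₂) adjoin                ≡⟨ e≡0 ⟩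
          0F                                         ∎))
        -- The span of `hs` admits division by nonzero polynomials in g, so a nonzero first block
        -- would place e itself in it.
        ... | no c₁≢0 with closed-cancel hs Chs cl (toList c₁) (ev≢0 c₁ c₁≢0) e c₂ (⊕≡0⇒≡ _ _ (trans (sym (combo-adjoin c₁ c₂)) e≡0))
        ... | d , e≡ = ⊥-elim (e∉ (trans (cong (L hs) e≡) (L-combo hs d)))

      adjoin-closed : Closed adjoin
      adjoin-closed c with Vec.splitAt 5 c
      ... | c₁ , c₂ , refl with g·ev c₁ | cl c₂
      ... | d₁ , e₁ | d₂ , e₂ = d₁ ++ d₂ , (begin
        combo (c₁ ++ c₂) (map (g ·_) adjoin)           ≡⟨ combo-scale g (c₁ ++ c₂) adjoin ⟩
        g · combo (c₁ ++ c₂) adjoin                    ≡⟨ cong (g ·_) (combo-adjoin c₁ c₂) ⟩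
        g · (ev (toList c₁) · e ⊕ combo c₂ hs)         ≡⟨ ·-distribˡ g _ _ ⟩
        g · (ev (toList c₁) · e) ⊕ g · combo c₂ hs     ≡⟨ cong₂ _⊕_ (sym (·-assoc g _ e)) (sym (combo-scale g c₂ hs)) ⟩
        g · ev (toList c₁) · e ⊕ combo c₂ (map (g ·_) hs) ≡⟨ cong₂ (λ s t → s · e ⊕ t) e₁ e₂ ⟩
        ev (toList d₁) · e ⊕ combo d₂ hs               ≡⟨ combo-adjoin d₁ d₂ ⟨
        combo (d₁ ++ d₂) adjoin                        ∎)

      adjoin-⊒ : ∀ {l} {us : Vec (F n) l} → us ⊑ hs → us ⊑ adjoin
      adjoin-⊒ sub c = let d , eq = sub c in 0F {5} ++ d , (begin
        combo c _                                   ≡⟨ eq ⟩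
        combo d hs                                  ≡⟨ ⊕-identityˡ _ ⟨
        0F ⊕ combo d hs                             ≡⟨ cong (_⊕ combo d hs) (trans (cong (_· e) (ev-0F 5)) (·-zeroˡ e)) ⟨
        ev (toList (0F {5})) · e ⊕ combo d hs       ≡⟨ combo-adjoin 0F d ⟨
        combo (0F {5} ++ d) adjoin                  ∎)

      adjoin-∋ : ∃[ d ] e ≡ combo d adjoin
      adjoin-∋ = 1F {5} ++ 0F , (begin
        e                                           ≡⟨ trans (⊕-identityʳ _) (·-identityˡ e) ⟨
        1F · e ⊕ 0F                                 ≡⟨ cong₂ (λ p q → p · e ⊕ q) (sym ev-1F) (sym (combo-0 hs)) ⟩
        ev (toList (1F {5})) · e ⊕ combo 0F hs      ≡⟨ combo-adjoin 1F 0F ⟨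
        combo (1F {5} ++ 0F) adjoin                 ∎)
        where
        ev-1F : ev (toList (1F {5})) ≡ 1F
        ev-1F = trans (cong (λ t → 1F ⊕ g · t) (ev-0F 4)) (trans (cong (1F ⊕_) (·-zeroʳ g)) (⊕-identityʳ 1F))

    -- Each vector of `us` either lies in the space built so far or adds one dimension over 𝔽₂(g),
    -- whence i ≤ l.
    hull : ∀ {l} (us : Vec (F n) l) → ∃[ i ] i ≤ l × ∃[ hs ] C {i ℕ.* 5} hs ≢ 0F × Closed hs × us ⊑ hs
    hull []       = 0 , z≤n , [] , 1≢0 , (λ { [] → [] , refl }) , (λ { [] → [] , refl })
    hull (u ∷ us) with hull us
    ... | i , i≤l , hs , Chs , cl , sub with L hs u ≟F 0F
    ... | yes e = i , ℕ.m≤n⇒m≤1+n i≤l , hs , Chs , cl , ⊑-cons (L≡0⇒combo hs u e) sub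
    ... | no ne = suc i , s≤s i≤l , adjoin hs Chs cl u ne , adjoin-C hs Chs cl u ne , adjoin-closed hs Chs cl u ne ,
                  ⊑-cons (adjoin-∋ hs Chs cl u ne) (adjoin-⊒ hs Chs cl u ne sub)

    -- A hull that is too small is enlarged by arbitrary outside vectors, each worth exactly five
    -- dimensions; 5h ≤ n guarantees that they exist.
    hull-of-dimension : ∀ {l} (us : Vec (F n) l) h → l ≤ h → h ℕ.* 5 ≤ n → ∃[ hs ] ZeroSum {h ℕ.* 5} hs × us ⊑ hs
    hull-of-dimension {l} us h l≤h 5h≤n with hull us
    ... | i , i≤l , start with enlarge (ℕ.≤⇒≤′ (ℕ.≤-trans i≤l l≤h)) 5h≤n
      where
      enlarge : ∀ {h} → i ℕ.≤′ h → h ℕ.* 5 ≤ n → ∃[ hs ] C {h ℕ.* 5} hs ≢ 0F × Closed hs × us ⊑ hs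
      enlarge ℕ.≤′-refl _ = start
      enlarge {suc h} (ℕ.≤′-step i≤h) 5h<n with enlarge i≤h (ℕ.≤-trans (ℕ.m≤n+m (h ℕ.* 5) 5) 5h<n)
      ... | hs , Chs , cl , sub with ∃? (λ e → ¬? (L hs e ≟F 0F))
      ... | yes (e , e∉) = adjoin hs Chs cl e e∉ , adjoin-C hs Chs cl e e∉ , adjoin-closed hs Chs cl e e∉ , adjoin-⊒ hs Chs cl e e∉ sub
      ... | no none = ⊥-elim (ℕ.<⇒≱ (ℕ.<-≤-trans (ℕ.m<n+m (h ℕ.* 5) (s≤s z≤n)) 5h<n) (injective⇒≤ {σ = proj₁ ∘ coords} coords-injective))
        where
        coords : ∀ x → ∃[ c ] x ≡ combo c hs
        coords x with L hs x ≟F 0F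
        ... | yes e = L≡0⇒combo hs x e
        ... | no ne = ⊥-elim (none (x , ne))
        coords-injective : Injective _≡_ _≡_ (proj₁ ∘ coords)
        coords-injective {x} {y} e = trans (proj₂ (coords x)) (trans (cong (λ c → combo c hs) e) (sym (proj₂ (coords y))))
    ... | hs , Chs , cl , sub = hs , (Chs , invariant⇒s≡0 hs Chs g≢0 g≢1 cl) , sub

    ZS-5h∸ : ∀ {k l} h → ZS l → l ≤ h → h ℕ.* 5 ≤ n → k ℕ.+ l ≡ h ℕ.* 5 → ZS k
    ZS-5h∸ {k} {l} h (us , zs) l≤h 5h≤n e with hull-of-dimension us h l≤h 5h≤n
    ... | hs , zhs , sub = lemma e hs zhs sub
      where
      lemma : ∀ {m} → k ℕ.+ l ≡ m → (hs : Vec (F n) m) → ZeroSum hs → us ⊑ hs → ZS k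
      lemma refl hs zhs sub = difference hs us zhs zs sub

    -- The case l = 0 of `ZS-5h∸`, from which all multiples of five arise.
    ZS-0 : ZS 0
    ZS-0 = [] , 1≢0 , trans (A-[] 0F) inv-0

-- Zero-sum subspaces of dimension 3 and 4

module CharacterSumEstimates where

  open import Data.Integer as ℤ using (ℤ; +_; -[1+_]; _+_; _*_; -_; _-_; 0ℤ; 1ℤ; -1ℤ; +≤+; -≤+)
  import Data.Integer.Properties as ℤ
  import Data.Integer.Tactic.RingSolver as ℤSolver

  module ℤSum = Sum ℤ.+-0-isCommutativeMonoid

  -- Integer-valued sums

  module IntegerSums where

    open ℤSum public

    ∑-*ˡ : ∀ {k} c (f : Vec Bool k → ℤ) → ∑ (λ x → c * f x) ≡ c * ∑ f
    ∑-*ˡ c f = ∑-homo (c *_) (ℤ.*-distribˡ-+ c) f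

    ∑-*ʳ : ∀ {k} c (f : Vec Bool k → ℤ) → ∑ (λ x → f x * c) ≡ ∑ f * c
    ∑-*ʳ c f = ∑-homo (_* c) (ℤ.*-distribʳ-+ c) f

    ∑-const : ∀ k c → ∑ {k} (λ _ → c) ≡ + (2 ℕ.^ k) * c
    ∑-const zero    c = trans (∑-zero (λ _ → c)) (sym (ℤ.*-identityˡ c))
    ∑-const (suc k) c = begin
      ∑ {suc k} (λ _ → c)                     ≡⟨ ∑-suc {k} (λ _ → c) ⟩
      ∑ {k} (λ _ → c) + ∑ {k} (λ _ → c)       ≡⟨ cong₂ _+_ (∑-const k c) (∑-const k c) ⟩
      + (2 ℕ.^ k) * c + + (2 ℕ.^ k) * c       ≡⟨ ℤ.*-distribʳ-+ c (+ (2 ℕ.^ k)) (+ (2 ℕ.^ k)) ⟨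
      + (2 ℕ.^ k ℕ.+ 2 ℕ.^ k) * c             ≡⟨ cong (λ t → + (2 ℕ.^ k ℕ.+ t) * c) (ℕ.+-identityʳ (2 ℕ.^ k)) ⟨
      + (2 ℕ.^ suc k) * c                     ∎
      where open ≡-Reasoning

    ∑-mono : ∀ {k} {f g : Vec Bool k → ℤ} → (∀ x → f x ℤ.≤ g x) → ∑ f ℤ.≤ ∑ g
    ∑-mono {zero}  le = subst₂ ℤ._≤_ (sym (∑-zero _)) (sym (∑-zero _)) (le [])
    ∑-mono {suc k} le = subst₂ ℤ._≤_ (sym (∑-suc _)) (sym (∑-suc _))
      (ℤ.+-mono-≤ (∑-mono (le ∘ (false ∷_))) (∑-mono (le ∘ (true ∷_))))

    square≥0 : ∀ x → 0ℤ ℤ.≤ x * x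
    square≥0 (+ m)    = subst (0ℤ ℤ.≤_) (ℤ.pos-* m m) (+≤+ z≤n)
    square≥0 -[1+ m ] = +≤+ z≤n

    ≤-by-difference : ∀ {x y} d → 0ℤ ℤ.≤ d → y ≡ x + d → x ℤ.≤ y
    ≤-by-difference {x} d 0≤d refl = subst (ℤ._≤ x + d) (ℤ.+-identityʳ x) (ℤ.+-monoʳ-≤ x 0≤d)

    -- Induction on k: each halving of the domain costs one application of (a + b)² ≤ 2(a² + b²).
    cauchy-schwarz : ∀ {k} (f : Vec Bool k → ℤ) → ∑ f * ∑ f ℤ.≤ + (2 ℕ.^ k) * ∑ (λ x → f x * f x)
    cauchy-schwarz {zero} f = ℤ.≤-reflexive (trans (cong₂ _*_ (∑-zero f) (∑-zero f))
      (sym (trans (ℤ.*-identityˡ _) (∑-zero (λ x → f x * f x)))))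
    cauchy-schwarz {suc k} f = begin
      ∑ f * ∑ f                         ≡⟨ cong₂ _*_ (∑-suc f) (∑-suc f) ⟩
      (a + b) * (a + b)                 ≤⟨ ≤-by-difference ((a - b) * (a - b)) (square≥0 (a - b)) (parallelogram a b) ⟩
      + 2 * (a * a + b * b)             ≤⟨ ℤ.*-monoˡ-≤-nonNeg (+ 2) (ℤ.+-mono-≤ (cauchy-schwarz (f ∘ (false ∷_))) (cauchy-schwarz (f ∘ (true ∷_)))) ⟩
      + 2 * (+ (2 ℕ.^ k) * A + + (2 ℕ.^ k) * B) ≡⟨ regroup (+ (2 ℕ.^ k)) A B ⟩
      + 2 * + (2 ℕ.^ k) * (A + B)       ≡⟨ cong₂ _*_ (sym (ℤ.pos-* 2 (2 ℕ.^ k))) (sym (∑-suc (λ x → f x * f x))) ⟩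
      + (2 ℕ.^ suc k) * ∑ (λ x → f x * f x) ∎
      where
      open ℤ.≤-Reasoning
      a = ∑ (f ∘ (false ∷_))
      b = ∑ (f ∘ (true ∷_))
      A = ∑ (λ x → f (false ∷ x) * f (false ∷ x))
      B = ∑ (λ x → f (true ∷ x) * f (true ∷ x))
      parallelogram : ∀ a b → + 2 * (a * a + b * b) ≡ (a + b) * (a + b) + (a - b) * (a - b)
      parallelogram = ℤSolver.solve-∀
      regroup : ∀ p A B → + 2 * (p * A + p * B) ≡ + 2 * p * (A + B)
      regroup = ℤSolver.solve-∀

    ∑-product : ∀ {k l} (f : Vec Bool k → ℤ) (g : Vec Bool l → ℤ) → ∑ f * ∑ g ≡ ∑ (λ x → ∑ (λ y → f x * g y))
    ∑-product f g = trans (sym (∑-*ʳ (∑ g) f)) (∑-cong (λ x → sym (∑-*ˡ (f x) g)))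

    ⟦_⟧ : ∀ {P : Set} → Dec P → ℤ
    ⟦ d ⟧ = if does d then 1ℤ else 0ℤ

    ⟦⟧-yes : ∀ {P : Set} (d : Dec P) → P → ⟦ d ⟧ ≡ 1ℤ
    ⟦⟧-yes (yes _) _ = refl
    ⟦⟧-yes (no ¬p) p = ⊥-elim (¬p p)

    ⟦⟧-no : ∀ {P : Set} (d : Dec P) → ¬ P → ⟦ d ⟧ ≡ 0ℤ
    ⟦⟧-no (yes p) ¬p = ⊥-elim (¬p p)
    ⟦⟧-no (no _)  _  = refl

    ⟦⟧≥0 : ∀ {P : Set} (d : Dec P) → 0ℤ ℤ.≤ ⟦ d ⟧
    ⟦⟧≥0 (yes _) = +≤+ z≤n
    ⟦⟧≥0 (no _)  = +≤+ z≤n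

    δ : ∀ {k} → Vec Bool k → Vec Bool k → ℤ
    δ a x = ⟦ x ≟F a ⟧

    δ-refl : ∀ {k} (a : Vec Bool k) → δ a a ≡ 1ℤ
    δ-refl a = ⟦⟧-yes (a ≟F a) refl

    ∑-only : ∀ {k} (a : Vec Bool k) (f : Vec Bool k → ℤ) → (∀ x → x ≢ a → f x ≡ 0ℤ) → ∑ f ≡ f a
    ∑-only a f f≡0 = begin
      ∑ f                    ≡⟨ ∑-reindex {σ = a ⊕_} (λ {x} {y} e → trans (sym (⊕-cancel a x)) (trans (cong (a ⊕_) e) (⊕-cancel a y))) f ⟨
      ∑ (λ x → f (a ⊕ x))    ≡⟨ ∑-only-0 _ (λ x x≢0 → f≡0 (a ⊕ x) (λ e → x≢0 (trans (sym (⊕-cancel a x)) (trans (cong (a ⊕_) e) (⊕-self a))))) ⟩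
      f (a ⊕ 0F)             ≡⟨ cong f (⊕-identityʳ a) ⟩
      f a                    ∎
      where open ≡-Reasoning

    ∑-δ : ∀ {k} (a : Vec Bool k) → ∑ (δ a) ≡ 1ℤ
    ∑-δ a = trans (∑-only a (δ a) (λ x x≢a → ⟦⟧-no (x ≟F a) x≢a)) (δ-refl a)

    ∑-neg : ∀ {k} (f : Vec Bool k → ℤ) → ∑ (λ x → - f x) ≡ - ∑ f
    ∑-neg f = ∑-homo -_ ℤ.neg-distrib-+ f

  -- The fourth moment of Kloosterman sums

  module CharacterSums {n : ℕ} (𝔽 : BinaryField n) (j : ℕ) (n≡ : n ≡ suc (j ℕ.+ j)) where

    open FieldProperties 𝔽
    open Odd j n≡
    open Subspaces 𝔽
    open OddSubspaces j n≡
    open IntegerSums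

    Q : ℤ
    Q = + (2 ℕ.^ n)

    χ : F n → ℤ
    χ x = if tr x then -1ℤ else 1ℤ

    χ-⊕ : ∀ x y → χ (x ⊕ y) ≡ χ x * χ y
    χ-⊕ x y rewrite tr-⊕ x y with tr x | tr y
    ... | false | false = refl
    ... | false | true  = refl
    ... | true  | false = refl
    ... | true  | true  = refl

    χ-square : ∀ x → χ x * χ x ≡ 1ℤ
    χ-square x with tr x
    ... | false = refl
    ... | true  = refl

    χ-0 : χ 0F ≡ 1ℤ
    χ-0 rewrite tr-0 = refl

    χ-1 : χ 1F ≡ -1ℤ
    χ-1 rewrite tr-1 = refl

    χ-1⊕ : ∀ x → χ (1F ⊕ x) ≡ - χ x
    χ-1⊕ x = trans (χ-⊕ 1F x) (trans (cong (_* χ x) χ-1) (ℤ.-1*i≡-i (χ x)))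

    χ≥-1 : ∀ x → -1ℤ ℤ.≤ χ x
    χ≥-1 x with tr x
    ... | false = -≤+
    ... | true  = ℤ.≤-refl

    1+χ≡0 : ∀ {x} → tr x ≡ true → 1ℤ + χ x ≡ 0ℤ
    1+χ≡0 e = cong (λ b → 1ℤ + (if b then -1ℤ else 1ℤ)) e

    ∑-shift : ∀ a (f : F n → ℤ) → ∑ (λ x → f (x ⊕ a)) ≡ ∑ f
    ∑-shift a f = ∑-reindex (⊕-injective a) f

    -- Shifting β by 1/w adds 1 to β · w, and χ 1 = -1 for odd n; a sum equal to its own negative
    -- vanishes.
    orthogonality : ∀ w → w ≢ 0F → ∑ (λ β → χ (β · w)) ≡ 0ℤ
    orthogonality w w≢0 = self-opposite (∑ (λ β → χ (β · w))) (begin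
      ∑ (λ β → χ (β · w))              ≡⟨ ∑-shift (inv w) (λ β → χ (β · w)) ⟨
      ∑ (λ β → χ ((β ⊕ inv w) · w))    ≡⟨ ∑-cong (λ β → trans (cong χ (flip β)) (χ-1⊕ (β · w))) ⟩
      ∑ (λ β → - χ (β · w))            ≡⟨ ∑-neg _ ⟩
      - ∑ (λ β → χ (β · w))            ∎)
      where
      open ≡-Reasoning
      flip : ∀ β → (β ⊕ inv w) · w ≡ 1F ⊕ β · w
      flip β = trans (·-distribʳ w β (inv w)) (trans (cong (β · w ⊕_) (·-inverseˡ w w≢0)) (⊕-comm _ _))
      self-opposite : ∀ x → x ≡ - x → x ≡ 0ℤ
      self-opposite (+ zero)  _ = refl
      self-opposite (+ suc m) ()
      self-opposite -[1+ m ]  ()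

    -- The autocorrelation of χ ∘ `inv`. Its Fourier transform is the square of the Kloosterman sum,
    -- so by Parseval Q times `M` is the fourth moment of Kloosterman sums.
    G : F n → ℤ
    G a = ∑ (λ b → χ (inv b ⊕ inv (a ⊕ b)))

    M : ℤ
    M = ∑ (λ a → G a * G a)

    W : F n → F n → F n → F n
    W a b c = (inv b ⊕ inv (a ⊕ b)) ⊕ (inv c ⊕ inv (a ⊕ c))

    M≡∑χW : M ≡ ∑ (λ a → ∑ (λ b → ∑ (λ c → χ (W a b c))))
    M≡∑χW = ∑-cong λ a → trans (∑-product _ _) (∑-cong λ b → ∑-cong λ c → sym (χ-⊕ _ _))

    inv-⊕ : ∀ x y → x ≢ 0F → y ≢ 0F → inv x ⊕ inv y ≡ (x ⊕ y) · inv (x · y)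
    inv-⊕ x y x≢0 y≢0 = begin
      inv x ⊕ inv y                                  ≡⟨ cong₂ _⊕_ (sym (·-identityʳ _)) (sym (·-identityʳ _)) ⟩
      inv x · 1F ⊕ inv y · 1F                        ≡⟨ cong₂ (λ s t → inv x · s ⊕ inv y · t) (·-inverseʳ y y≢0) (·-inverseʳ x x≢0) ⟨
      inv x · (y · inv y) ⊕ inv y · (x · inv x)      ≡⟨ solve 4 (λ x y p q → p :* (y :* q) :+ q :* (x :* p) := (x :+ y) :* (p :* q)) refl x y (inv x) (inv y) ⟩
      (x ⊕ y) · (inv x · inv y)                      ≡⟨ cong ((x ⊕ y) ·_) (inv-· x y) ⟨
      (x ⊕ y) · inv (x · y)                          ∎
      where
      open ≡-Reasoning
      open Solver

    -- The pairs {b, a + b} and {c, a + c} have the same sum and the same sum of inverses.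
    W≡0 : ∀ a b c → W a b c ≡ 0F → a ≡ 0F ⊎ c ≡ b ⊎ c ≡ a ⊕ b
    W≡0 a b c e with a ≟F 0F
    ... | yes a≡0 = inj₁ a≡0
    ... | no a≢0 with c ≟F b
    ... | yes c≡b = inj₂ (inj₁ c≡b)
    ... | no c≢b with c ≟F (a ⊕ b)
    ... | yes c≡ = inj₂ (inj₂ c≡)
    ... | no c≢a⊕b = ⊥-elim (contradict (b ≟F 0F) ((a ⊕ b) ≟F 0F) (c ≟F 0F) ((a ⊕ c) ≟F 0F))
      where
      open ≡-Reasoning
      halves : inv b ⊕ inv (a ⊕ b) ≡ inv c ⊕ inv (a ⊕ c)
      halves = ⊕≡0⇒≡ _ _ e
      single : ∀ x y → x ≡ 0F ⊎ y ≡ 0F → x ⊕ y ≡ a → inv x ⊕ inv y ≡ inv a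
      single x y (inj₁ refl) e′ = trans (cong (_⊕ inv y) inv-0) (trans (⊕-identityˡ _) (cong inv (trans (sym (⊕-identityˡ y)) e′)))
      single x y (inj₂ refl) e′ = trans (cong (inv x ⊕_) inv-0) (trans (⊕-identityʳ _) (cong inv (trans (sym (⊕-identityʳ x)) e′)))
      sum-a : ∀ x → x ⊕ (a ⊕ x) ≡ a
      sum-a x = trans (cong (x ⊕_) (⊕-comm a x)) (⊕-cancel x a)
      -- For odd n no pair of nonzero elements with sum a shares the inverse sum 1/a of the pair {0,
      -- a}. Thus the convention 1/0 = 0 creates no further solutions.
      pair≢inv-a : ∀ x → x ≢ 0F → a ⊕ x ≢ 0F → inv x ⊕ inv (a ⊕ x) ≢ inv a
      pair≢inv-a x x≢0 ax≢0 e′ = inv-sum≢0 a x a≢0 x≢0 ax≢0 (trans (⊕-assoc _ _ _) (trans (cong (inv a ⊕_) e′) (⊕-self _)))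
      other : ∀ x y → x ≢ y → x ≢ a ⊕ y → (x ≡ 0F ⊎ a ⊕ x ≡ 0F) → y ≢ 0F × a ⊕ y ≢ 0F
      other x y x≢y x≢ay (inj₁ refl) = (λ y≡0 → x≢y (sym y≡0)) , (λ ay≡0 → x≢ay (sym ay≡0))
      other x y x≢y x≢ay (inj₂ ax≡0) with ⊕≡0⇒≡ a x ax≡0
      ... | refl = (λ { refl → x≢ay (sym (⊕-identityʳ a)) }) , (λ ay≡0 → x≢y (⊕≡0⇒≡ a y ay≡0))
      b≢a⊕c : b ≢ a ⊕ c
      b≢a⊕c e′ = c≢a⊕b (sym (trans (cong (a ⊕_) e′) (⊕-cancel a c)))
      zero-b : b ≡ 0F ⊎ a ⊕ b ≡ 0F → ⊥
      zero-b z with other b c (λ e′ → c≢b (sym e′)) b≢a⊕c z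
      ... | c≢0 , ac≢0 = pair≢inv-a c c≢0 ac≢0 (trans (sym halves) (single b (a ⊕ b) z (sum-a b)))
      zero-c : c ≡ 0F ⊎ a ⊕ c ≡ 0F → ⊥
      zero-c z with other c b c≢b c≢a⊕b z
      ... | b≢0 , ab≢0 = pair≢inv-a b b≢0 ab≢0 (trans halves (single c (a ⊕ c) z (sum-a c)))
      contradict : Dec (b ≡ 0F) → Dec (a ⊕ b ≡ 0F) → Dec (c ≡ 0F) → Dec (a ⊕ c ≡ 0F) → ⊥
      contradict (yes z) _ _ _ = zero-b (inj₁ z)
      contradict (no _) (yes z) _ _ = zero-b (inj₂ z)
      contradict (no _) (no _) (yes z) _ = zero-c (inj₁ z)
      contradict (no _) (no _) (no _) (yes z) = zero-c (inj₂ z)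
      contradict (no b≢0) (no ab≢0) (no c≢0) (no ac≢0) = split (·≡0 (b ⊕ c) (a ⊕ (b ⊕ c)) difference≡0)
        where
        -- The inverse sum is the sum a ≠ 0 divided by the product, so the products agree and both
        -- pairs are the roots of one quadratic.
        products : b · (a ⊕ b) ≡ c · (a ⊕ c)
        products = inv-injective (·-cancelˡ a≢0 (begin
          a · inv (b · (a ⊕ b))                  ≡⟨ cong (_· inv (b · (a ⊕ b))) (sum-a b) ⟨
          (b ⊕ (a ⊕ b)) · inv (b · (a ⊕ b))      ≡⟨ inv-⊕ b (a ⊕ b) b≢0 ab≢0 ⟨
          inv b ⊕ inv (a ⊕ b)                    ≡⟨ halves ⟩
          inv c ⊕ inv (a ⊕ c)                    ≡⟨ inv-⊕ c (a ⊕ c) c≢0 ac≢0 ⟩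
          (c ⊕ (a ⊕ c)) · inv (c · (a ⊕ c))      ≡⟨ cong (_· inv (c · (a ⊕ c))) (sum-a c) ⟩
          a · inv (c · (a ⊕ c))                  ∎))
        difference≡0 : (b ⊕ c) · (a ⊕ (b ⊕ c)) ≡ 0F
        difference≡0 = begin
          (b ⊕ c) · (a ⊕ (b ⊕ c))                ≡⟨ solve 3 (λ a b c → (b :+ c) :* (a :+ (b :+ c)) := b :* (a :+ b) :+ c :* (a :+ c)) refl a b c ⟩
          b · (a ⊕ b) ⊕ c · (a ⊕ c)              ≡⟨ cong (_⊕ c · (a ⊕ c)) products ⟩
          c · (a ⊕ c) ⊕ c · (a ⊕ c)              ≡⟨ ⊕-self _ ⟩
          0F                                     ∎
          where open Solver
        split : b ⊕ c ≡ 0F ⊎ a ⊕ (b ⊕ c) ≡ 0F → ⊥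
        split (inj₁ e′) = c≢b (sym (⊕≡0⇒≡ b c e′))
        split (inj₂ e′) = c≢a⊕b (sym (⊕≡0⇒≡ (a ⊕ b) c (trans (⊕-assoc a b c) e′)))

    W-scale : ∀ β → β ≢ 0F → ∀ a b c → β · W a b c ≡ W (inv β · a) (inv β · b) (inv β · c)
    W-scale β β≢0 a b c = begin
      β · W a b c
        ≡⟨ solve 5 (λ β p q r s → β :* ((p :+ q) :+ (r :+ s)) := (β :* p :+ β :* q) :+ (β :* r :+ β :* s)) refl β (inv b) (inv (a ⊕ b)) (inv c) (inv (a ⊕ c)) ⟩
      (β · inv b ⊕ β · inv (a ⊕ b)) ⊕ (β · inv c ⊕ β · inv (a ⊕ c))
        ≡⟨ cong₂ _⊕_ (cong₂ _⊕_ (scale b) (scale⊕ b)) (cong₂ _⊕_ (scale c) (scale⊕ c)) ⟩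
      W (inv β · a) (inv β · b) (inv β · c) ∎
      where
      open ≡-Reasoning
      open Solver
      scale : ∀ x → β · inv x ≡ inv (inv β · x)
      scale x = trans (cong (_· inv x) (sym (inv-involutive β))) (sym (inv-· (inv β) x))
      scale⊕ : ∀ x → β · inv (a ⊕ x) ≡ inv (inv β · a ⊕ inv β · x)
      scale⊕ x = trans (scale (a ⊕ x)) (cong inv (·-distribˡ (inv β) a x))

    ∑³ : (F n → F n → F n → ℤ) → ℤ
    ∑³ f = ∑ (λ a → ∑ (λ b → ∑ (λ c → f a b c)))

    ∑³-cong : ∀ {f g} → (∀ a b c → f a b c ≡ g a b c) → ∑³ f ≡ ∑³ g
    ∑³-cong e = ∑-cong λ a → ∑-cong λ b → ∑-cong λ c → e a b c

    ∑³-mono : ∀ {f g} → (∀ a b c → f a b c ℤ.≤ g a b c) → ∑³ f ℤ.≤ ∑³ g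
    ∑³-mono e = ∑-mono λ a → ∑-mono λ b → ∑-mono λ c → e a b c

    ∑³-const : ∀ c → ∑³ (λ _ _ _ → c) ≡ Q * (Q * (Q * c))
    ∑³-const c = trans (∑-cong {n} λ _ → trans (∑-cong {n} λ _ → ∑-const n c) (∑-const n _)) (∑-const n _)

    -- Scaling all three variables by 1/β absorbs β. All nonzero β therefore contribute alike, and
    -- averaging over β relates `M` to the number of zeros of `W`.
    M-scale : ∀ β → β ≢ 0F → ∑³ (λ a b c → χ (β · W a b c)) ≡ M
    M-scale β β≢0 = begin
      ∑³ (λ a b c → χ (β · W a b c))                        ≡⟨ ∑³-cong (λ a b c → cong χ (W-scale β β≢0 a b c)) ⟩
      ∑³ (λ a b c → χ (W (r a) (r b) (r c)))
        ≡⟨ ∑-cong (λ a → ∑-cong λ b → ∑-reindex r-injective (λ c → χ (W (r a) (r b) c))) ⟩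
      ∑³ (λ a b c → χ (W (r a) (r b) c))
        ≡⟨ ∑-cong (λ a → ∑-reindex r-injective (λ b → ∑ λ c → χ (W (r a) b c))) ⟩
      ∑³ (λ a b c → χ (W (r a) b c))                        ≡⟨ ∑-reindex r-injective (λ a → ∑ λ b → ∑ λ c → χ (W a b c)) ⟩
      ∑³ (λ a b c → χ (W a b c))                            ≡⟨ M≡∑χW ⟨
      M                                                     ∎
      where
      open ≡-Reasoning
      r : F n → F n
      r = inv β ·_
      r-injective : Injective _≡_ _≡_ r
      r-injective = ·-cancelˡ (inv-≢0 β≢0)

    ∑βM : ∑ (λ β → ∑³ (λ a b c → χ (β · W a b c))) ≡ Q * M + (Q * (Q * Q) - M)
    ∑βM = begin
      ∑ (λ β → ∑³ (λ a b c → χ (β · W a b c)))       ≡⟨ ∑-cong pointwise ⟩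
      ∑ (λ β → M + δ 0F β * (Q * (Q * Q) - M))       ≡⟨ ∑-∙ (λ _ → M) _ ⟩
      ∑ {n} (λ _ → M) + ∑ (λ β → δ 0F β * (Q * (Q * Q) - M))
        ≡⟨ cong₂ _+_ (∑-const n M) (trans (∑-*ʳ (Q * (Q * Q) - M) (δ 0F)) (trans (cong (_* (Q * (Q * Q) - M)) (∑-δ 0F)) (ℤ.*-identityˡ _))) ⟩
      Q * M + (Q * (Q * Q) - M)                      ∎
      where
      open ≡-Reasoning
      pointwise : ∀ β → ∑³ (λ a b c → χ (β · W a b c)) ≡ M + δ 0F β * (Q * (Q * Q) - M)
      pointwise β with β ≟F 0F
      ... | no β≢0 = trans (M-scale β β≢0) (sym (ℤ.+-identityʳ M))
      ... | yes refl = begin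
        ∑³ (λ a b c → χ (0F · W a b c))   ≡⟨ ∑³-cong (λ a b c → trans (cong χ (·-zeroˡ (W a b c))) χ-0) ⟩
        ∑³ (λ a b c → 1ℤ)                 ≡⟨ ∑³-const 1ℤ ⟩
        Q * (Q * (Q * 1ℤ))                ≡⟨ lemma Q M ⟩
        M + 1ℤ * (Q * (Q * Q) - M)        ∎
        where
        lemma : ∀ Q M → Q * (Q * (Q * 1ℤ)) ≡ M + 1ℤ * (Q * (Q * Q) - M)
        lemma = ℤSolver.solve-∀

    -- By orthogonality the sum over β is Q times the number of zeros of `W`, and these lie in the
    -- three families a = 0, c = b and c = a + b of Q² triples each.
    moment : Q * M + (Q * (Q * Q) - M) ℤ.≤ + 3 * (Q * (Q * Q))
    moment = begin
      Q * M + (Q * (Q * Q) - M)                                        ≡⟨ ∑βM ⟨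
      ∑ (λ β → ∑³ (λ a b c → χ (β · W a b c)))                         ≡⟨ swap ⟩
      ∑³ (λ a b c → ∑ (λ β → χ (β · W a b c)))                         ≤⟨ ∑³-mono pointwise ⟩
      ∑³ (λ a b c → indicators a b c * Q)                              ≡⟨ total ⟩
      + 3 * (Q * (Q * Q))                                              ∎
      where
      open ℤ.≤-Reasoning
      swap : ∑ (λ β → ∑³ (λ a b c → χ (β · W a b c))) ≡ ∑³ (λ a b c → ∑ (λ β → χ (β · W a b c)))
      swap = trans (∑-swap (λ β a → ∑ λ b → ∑ λ c → χ (β · W a b c)))
        (∑-cong λ a → trans (∑-swap (λ β b → ∑ λ c → χ (β · W a b c))) (∑-cong λ b → ∑-swap (λ β c → χ (β · W a b c))))
      indicators : F n → F n → F n → ℤ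
      indicators a b c = δ 0F a + δ b c + δ (a ⊕ b) c
      indicators≥0 : ∀ a b c → 0ℤ ℤ.≤ indicators a b c * Q
      indicators≥0 a b c = ℤ.*-monoʳ-≤-nonNeg Q {0ℤ} {indicators a b c}
        (ℤ.+-mono-≤ (ℤ.+-mono-≤ (⟦⟧≥0 (a ≟F 0F)) (⟦⟧≥0 (c ≟F b))) (⟦⟧≥0 (c ≟F (a ⊕ b))))
      ∑β≤Q : ∀ w → ∑ (λ β → χ (β · w)) ℤ.≤ Q
      ∑β≤Q w = subst (∑ (λ β → χ (β · w)) ℤ.≤_) (trans (∑-const n 1ℤ) (ℤ.*-identityʳ Q)) (∑-mono λ β → χ≤1 (β · w))
        where
        χ≤1 : ∀ x → χ x ℤ.≤ 1ℤ
        χ≤1 x with tr x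
        ... | false = ℤ.≤-refl
        ... | true  = -≤+
      one≤ : ∀ {x y z} → 0ℤ ℤ.≤ x → 0ℤ ℤ.≤ y → 0ℤ ℤ.≤ z → x ≡ 1ℤ ⊎ y ≡ 1ℤ ⊎ z ≡ 1ℤ → 1ℤ ℤ.≤ x + y + z
      one≤ 0≤x 0≤y 0≤z (inj₁ refl)        = ℤ.+-mono-≤ (ℤ.+-mono-≤ (ℤ.≤-refl {1ℤ}) 0≤y) 0≤z
      one≤ 0≤x 0≤y 0≤z (inj₂ (inj₁ refl)) = ℤ.+-mono-≤ (ℤ.+-mono-≤ 0≤x (ℤ.≤-refl {1ℤ})) 0≤z
      one≤ 0≤x 0≤y 0≤z (inj₂ (inj₂ refl)) = ℤ.+-mono-≤ (ℤ.+-mono-≤ 0≤x 0≤y) (ℤ.≤-refl {1ℤ})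
      cases : ∀ a b c → a ≡ 0F ⊎ c ≡ b ⊎ c ≡ a ⊕ b → δ 0F a ≡ 1ℤ ⊎ δ b c ≡ 1ℤ ⊎ δ (a ⊕ b) c ≡ 1ℤ
      cases a b c (inj₁ e)        = inj₁ (⟦⟧-yes (a ≟F 0F) e)
      cases a b c (inj₂ (inj₁ e)) = inj₂ (inj₁ (⟦⟧-yes (c ≟F b) e))
      cases a b c (inj₂ (inj₂ e)) = inj₂ (inj₂ (⟦⟧-yes (c ≟F (a ⊕ b)) e))
      pointwise : ∀ a b c → ∑ (λ β → χ (β · W a b c)) ℤ.≤ indicators a b c * Q
      pointwise a b c with W a b c ≟F 0F
      ... | no ne = subst (ℤ._≤ indicators a b c * Q) (sym (orthogonality (W a b c) ne)) (indicators≥0 a b c)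
      ... | yes e = ℤ.≤-trans (∑β≤Q (W a b c)) (subst (ℤ._≤ indicators a b c * Q) (ℤ.*-identityˡ Q)
        (ℤ.*-monoʳ-≤-nonNeg Q {1ℤ} {indicators a b c}
          (one≤ (⟦⟧≥0 (a ≟F 0F)) (⟦⟧≥0 (c ≟F b)) (⟦⟧≥0 (c ≟F (a ⊕ b))) (cases a b c (W≡0 a b c e)))))
      total : ∑³ (λ a b c → indicators a b c * Q) ≡ + 3 * (Q * (Q * Q))
      total = begin-equality
        ∑³ (λ a b c → indicators a b c * Q)
          ≡⟨ ∑-cong (λ a → ∑-cong λ b → trans (∑-*ʳ Q (indicators a b)) (cong (_* Q) (inner a b))) ⟩
        ∑ (λ a → ∑ {n} (λ b → (Q * δ 0F a + 1ℤ + 1ℤ) * Q))  ≡⟨ ∑-cong (λ a → ∑-const n _) ⟩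
        ∑ (λ a → Q * ((Q * δ 0F a + 1ℤ + 1ℤ) * Q))          ≡⟨ ∑-cong (λ a → lemma₁ Q (δ 0F a)) ⟩
        ∑ (λ a → (Q * (Q * Q)) * δ 0F a + + 2 * (Q * Q))    ≡⟨ ∑-∙ (λ a → (Q * (Q * Q)) * δ 0F a) (λ _ → + 2 * (Q * Q)) ⟩
        ∑ (λ a → (Q * (Q * Q)) * δ 0F a) + ∑ {n} (λ _ → + 2 * (Q * Q))
          ≡⟨ cong₂ _+_ (trans (∑-*ˡ (Q * (Q * Q)) (δ 0F)) (cong (Q * (Q * Q) *_) (∑-δ 0F))) (∑-const n _) ⟩
        Q * (Q * Q) * 1ℤ + Q * (+ 2 * (Q * Q))              ≡⟨ lemma₂ Q ⟩
        + 3 * (Q * (Q * Q))                                 ∎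
        where
        inner : ∀ a b → ∑ (indicators a b) ≡ Q * δ 0F a + 1ℤ + 1ℤ
        inner a b = trans (∑-∙ (λ c → δ 0F a + δ b c) (δ (a ⊕ b))) (cong₂ _+_ (trans (∑-∙ (λ _ → δ 0F a) (δ b)) (cong₂ _+_ (∑-const n (δ 0F a)) (∑-δ b))) (∑-δ (a ⊕ b)))
        lemma₁ : ∀ Q d → Q * ((Q * d + 1ℤ + 1ℤ) * Q) ≡ (Q * (Q * Q)) * d + + 2 * (Q * Q)
        lemma₁ = ℤSolver.solve-∀
        lemma₂ : ∀ Q → Q * (Q * Q) * 1ℤ + Q * (+ 2 * (Q * Q)) ≡ + 3 * (Q * (Q * Q))
        lemma₂ = ℤSolver.solve-∀

    M-bound : (Q - 1ℤ) * M ℤ.≤ + 2 * (Q * (Q * Q))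
    M-bound = begin
      (Q - 1ℤ) * M                                       ≡⟨ lemma₁ Q M ⟩
      (Q * M + (Q * (Q * Q) - M)) - Q * (Q * Q)          ≤⟨ ℤ.+-monoˡ-≤ (- (Q * (Q * Q))) moment ⟩
      + 3 * (Q * (Q * Q)) - Q * (Q * Q)                  ≡⟨ lemma₂ (Q * (Q * Q)) ⟩
      + 2 * (Q * (Q * Q))                                ∎
      where
      open ℤ.≤-Reasoning
      lemma₁ : ∀ Q M → (Q - 1ℤ) * M ≡ (Q * M + (Q * (Q * Q) - M)) - Q * (Q * Q)
      lemma₁ = ℤSolver.solve-∀
      lemma₂ : ∀ x → + 3 * x - x ≡ + 2 * x
      lemma₂ = ℤSolver.solve-∀

    -- Applied with signs ε that are values of χ, this bounds the square of the Kloosterman sum and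
    -- both sums `T₀` and `T₁`.
    signed-G : ∀ (ε : F n → ℤ) → (∀ a → ε a * ε a ≡ 1ℤ) → ∑ (λ a → ε a * G a) * ∑ (λ a → ε a * G a) ℤ.≤ Q * M
    signed-G ε ε²≡1 = begin
      ∑ (λ a → ε a * G a) * ∑ (λ a → ε a * G a)     ≤⟨ cauchy-schwarz (λ a → ε a * G a) ⟩
      Q * ∑ (λ a → (ε a * G a) * (ε a * G a))       ≡⟨ cong (Q *_) (∑-cong λ a → trans (lemma (ε a) (G a)) (trans (cong (_* (G a * G a)) (ε²≡1 a)) (ℤ.*-identityˡ _))) ⟩
      Q * M                                         ∎
      where
      open ℤ.≤-Reasoning
      lemma : ∀ (e g : ℤ) → (e * g) * (e * g) ≡ (e * e) * (g * g)
      lemma = ℤSolver.solve-∀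

  -- Numerical inequalities for q ≥ 2¹⁵

  module Estimates (q : ℕ) (32768≤q : 32768 ℕ.≤ q) (M : ℤ) (M-bound : (+ q - 1ℤ) * M ℤ.≤ + 2 * (+ q * (+ q * + q))) where

    _⁴ : ℕ → ℕ
    x ⁴ = (x ℕ.* x) ℕ.* (x ℕ.* x)

    pos-⁴ : ∀ x → + (x ⁴) ≡ (+ x * + x) * (+ x * + x)
    pos-⁴ x = trans (ℤ.pos-* (x ℕ.* x) (x ℕ.* x)) (cong₂ _*_ (ℤ.pos-* x x) (ℤ.pos-* x x))

    q≢0 : ℕ.NonZero q
    q≢0 = ℕ.>-nonZero (ℕ.<-≤-trans (s≤s z≤n) 32768≤q)

    q⁴≢0 : ℕ.NonZero (q ⁴)
    q⁴≢0 = ℕ.m*n≢0 (q ℕ.* q) (q ℕ.* q) {{ℕ.m*n≢0 q q {{q≢0}} {{q≢0}}}} {{ℕ.m*n≢0 q q {{q≢0}} {{q≢0}}}}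

    p : ℕ
    p = ℕ.pred q

    1+p≡q : suc p ≡ q
    1+p≡q = ℕ.suc-pred q {{q≢0}}

    32767≤p : 32767 ℕ.≤ p
    32767≤p = ℕ.pred-mono-≤ 32768≤q

    pM≤ : + p * M ℤ.≤ + 2 * (+ q * (+ q * + q))
    pM≤ = subst (λ t → (+ t - 1ℤ) * M ℤ.≤ + 2 * (+ q * (+ q * + q))) (sym 1+p≡q) M-bound

    fourth-power-bound : ∀ a → a ℤ.≤ + q * M → + p * a ℤ.≤ + (2 ℕ.* q ⁴)
    fourth-power-bound a a≤ = begin
      + p * a                                       ≤⟨ ℤ.*-monoˡ-≤-nonNeg (+ p) a≤ ⟩
      + p * (+ q * M)                               ≡⟨ swap (+ p) (+ q) M ⟩
      + q * (+ p * M)                               ≤⟨ ℤ.*-monoˡ-≤-nonNeg (+ q) pM≤ ⟩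
      + q * (+ 2 * (+ q * (+ q * + q)))             ≡⟨ regroup (+ q) ⟩
      + 2 * ((+ q * + q) * (+ q * + q))             ≡⟨ cong (+ 2 *_) (pos-⁴ q) ⟨
      + 2 * + (q ⁴)                                 ≡⟨ ℤ.pos-* 2 (q ⁴) ⟨
      + (2 ℕ.* q ⁴)                                 ∎
      where
      open ℤ.≤-Reasoning
      swap : ∀ (p q M : ℤ) → p * (q * M) ≡ q * (p * M)
      swap = ℤSolver.solve-∀
      regroup : ∀ (q : ℤ) → q * (+ 2 * (q * (q * q))) ≡ + 2 * ((q * q) * (q * q))
      regroup = ℤSolver.solve-∀

    -- Raising 3K = q + 4 to the fourth power gives p(q + 4)⁴ = 81 p K⁴ ≤ 162 q⁴, although p = q - 1
    -- exceeds 162.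
    kloosterman-contradiction : ∀ K → (K * K) * (K * K) ℤ.≤ + q * M → + 3 * K ≢ + q + + 4
    kloosterman-contradiction K K⁴≤ 3K≡ = ℕ.<⇒≱ less (ℤ.drop‿+≤+ (begin
      + (p ℕ.* (q ℕ.+ 4) ⁴)                                         ≡⟨ trans (ℤ.pos-* p ((q ℕ.+ 4) ⁴)) (cong (+ p *_) (pos-⁴ (q ℕ.+ 4))) ⟩
      + p * (((+ q + + 4) * (+ q + + 4)) * ((+ q + + 4) * (+ q + + 4))) ≡⟨ cong (λ y → + p * ((y * y) * (y * y))) 3K≡ ⟨
      + p * (((+ 3 * K) * (+ 3 * K)) * ((+ 3 * K) * (+ 3 * K)))     ≡⟨ regroup (+ p) K ⟩
      + 81 * (+ p * ((K * K) * (K * K)))                            ≤⟨ ℤ.*-monoˡ-≤-nonNeg (+ 81) (fourth-power-bound _ K⁴≤) ⟩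
      + 81 * + (2 ℕ.* q ⁴)                                          ≡⟨ ℤ.pos-* 81 (2 ℕ.* q ⁴) ⟨
      + (81 ℕ.* (2 ℕ.* q ⁴))                                        ≡⟨ cong +_ (ℕ.*-assoc 81 2 (q ⁴)) ⟨
      + (162 ℕ.* q ⁴)                                               ∎))
      where
      open ℤ.≤-Reasoning
      regroup : ∀ (p K : ℤ) → p * (((+ 3 * K) * (+ 3 * K)) * ((+ 3 * K) * (+ 3 * K))) ≡ + 81 * (p * ((K * K) * (K * K)))
      regroup = ℤSolver.solve-∀
      square-mono : ∀ {x y} → x ℕ.≤ y → x ℕ.* x ℕ.≤ y ℕ.* y
      square-mono le = ℕ.*-mono-≤ le le
      less : 162 ℕ.* q ⁴ ℕ.< p ℕ.* (q ℕ.+ 4) ⁴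
      less = ℕ.<-≤-trans (ℕ.*-monoˡ-< (q ⁴) {{q⁴≢0}} (ℕ.n<1+n 162))
        (ℕ.*-mono-≤ (ℕ.≤-trans (ℕ.m≤m+n 163 32604) 32767≤p) (square-mono (square-mono (ℕ.m≤m+n q 4))))

    -- From 100 T > q² and p T² ≤ 2q⁴ it would follow that p ≤ 20000, but p ≥ 32767. The factor 100
    -- leaves ample room in `count-contradiction`.
    T-bound : ∀ T → T * T ℤ.≤ + q * M → + 100 * T ℤ.≤ + q * + q
    T-bound -[1+ t ] _   = subst (+ 100 * -[1+ t ] ℤ.≤_) (ℤ.pos-* q q) -≤+
    T-bound (+ t)    T²≤ = subst₂ ℤ._≤_ (ℤ.pos-* 100 t) (ℤ.pos-* q q) (+≤+ (ℕ.≮⇒≥ contradict))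
      where
      pt²≤ : p ℕ.* (t ℕ.* t) ℕ.≤ 2 ℕ.* q ⁴
      pt²≤ = ℤ.drop‿+≤+ (subst (ℤ._≤ + (2 ℕ.* q ⁴)) (sym (trans (ℤ.pos-* p (t ℕ.* t)) (cong (+ p *_) (ℤ.pos-* t t)))) (fourth-power-bound _ T²≤))
      contradict : ¬ (q ℕ.* q ℕ.< 100 ℕ.* t)
      contradict q²<100t = ℕ.<⇒≱ (ℕ.*-monoˡ-< (q ⁴) {{q⁴≢0}} (ℕ.≤-trans (ℕ.m≤m+n 20001 12766) 32767≤p)) (begin
        p ℕ.* q ⁴                                        ≤⟨ ℕ.*-monoʳ-≤ p (ℕ.*-mono-≤ (ℕ.<⇒≤ q²<100t) (ℕ.<⇒≤ q²<100t)) ⟩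
        p ℕ.* ((100 ℕ.* t) ℕ.* (100 ℕ.* t))              ≡⟨ regroup p t ⟩
        10000 ℕ.* (p ℕ.* (t ℕ.* t))                      ≤⟨ ℕ.*-monoʳ-≤ 10000 pt²≤ ⟩
        10000 ℕ.* (2 ℕ.* q ⁴)                            ≡⟨ ℕ.*-assoc 10000 2 (q ⁴) ⟨
        20000 ℕ.* q ⁴                                    ∎)
        where
        open ℕ.≤-Reasoning
        regroup : ∀ p t → p ℕ.* ((100 ℕ.* t) ℕ.* (100 ℕ.* t)) ≡ 10000 ℕ.* (p ℕ.* (t ℕ.* t))
        regroup p t = begin-equality
          p ℕ.* ((100 ℕ.* t) ℕ.* (100 ℕ.* t))   ≡⟨ cong (p ℕ.*_) (ℕ.[m*n]*[o*p]≡[m*o]*[n*p] 100 t 100 t) ⟩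
          p ℕ.* (10000 ℕ.* (t ℕ.* t))           ≡⟨ ℕ.*-assoc p 10000 (t ℕ.* t) ⟨
          p ℕ.* 10000 ℕ.* (t ℕ.* t)             ≡⟨ cong (ℕ._* (t ℕ.* t)) (ℕ.*-comm p 10000) ⟩
          10000 ℕ.* p ℕ.* (t ℕ.* t)             ≡⟨ ℕ.*-assoc 10000 p (t ℕ.* t) ⟩
          10000 ℕ.* (p ℕ.* (t ℕ.* t))           ∎

    -- The hypotheses give S ≥ -(T₀ + 3T₁) ≥ -4q²/100, hence q² + 7S ≥ 72q²/100, which exceeds 80q.
    count-contradiction : ∀ S S′ T₀ T₁ → 0ℤ ℤ.≤ S + S′ → S′ ≡ T₀ + + 3 * T₁ →
                          + 100 * T₀ ℤ.≤ + q * + q → + 100 * T₁ ℤ.≤ + q * + q →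
                          ¬ (+ q * + q + + 7 * S ℤ.≤ + 80 * + q)
    count-contradiction S S′ T₀ T₁ S+S′≥0 refl T₀≤ T₁≤ total≤ = ℕ.<⇒≱ less (ℤ.drop‿+≤+ (begin
      + (100 ℕ.* (q ℕ.* q))                                       ≡⟨ trans (ℤ.pos-* 100 (q ℕ.* q)) (cong (+ 100 *_) (ℤ.pos-* q q)) ⟩
      + 100 * (+ q * + q)                                         ≡⟨ ℤ.+-identityʳ _ ⟨
      + 100 * (+ q * + q) + 0ℤ                                    ≤⟨ ℤ.+-monoʳ-≤ (+ 100 * (+ q * + q)) (ℤ.*-monoˡ-≤-nonNeg (+ 700) S+S′≥0) ⟩
      + 100 * (+ q * + q) + + 700 * (S + (T₀ + + 3 * T₁))         ≡⟨ regroup₁ (+ q) S T₀ T₁ ⟩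
      + 100 * (+ q * + q + + 7 * S) + (+ 7 * (+ 100 * T₀) + + 21 * (+ 100 * T₁))
        ≤⟨ ℤ.+-mono-≤ (ℤ.*-monoˡ-≤-nonNeg (+ 100) total≤) (ℤ.+-mono-≤ (ℤ.*-monoˡ-≤-nonNeg (+ 7) T₀≤) (ℤ.*-monoˡ-≤-nonNeg (+ 21) T₁≤)) ⟩
      + 100 * (+ 80 * + q) + (+ 7 * (+ q * + q) + + 21 * (+ q * + q)) ≡⟨ regroup₂ (+ q) ⟩
      + 8000 * + q + + 28 * (+ q * + q)                           ≡⟨ cong₂ _+_ (ℤ.pos-* 8000 q) (trans (ℤ.pos-* 28 (q ℕ.* q)) (cong (+ 28 *_) (ℤ.pos-* q q))) ⟨
      + (8000 ℕ.* q ℕ.+ 28 ℕ.* (q ℕ.* q))                         ∎))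
      where
      open ℤ.≤-Reasoning
      regroup₁ : ∀ (q S T₀ T₁ : ℤ) → + 100 * (q * q) + + 700 * (S + (T₀ + + 3 * T₁)) ≡
                 + 100 * (q * q + + 7 * S) + (+ 7 * (+ 100 * T₀) + + 21 * (+ 100 * T₁))
      regroup₁ = ℤSolver.solve-∀
      regroup₂ : ∀ (q : ℤ) → + 100 * (+ 80 * q) + (+ 7 * (q * q) + + 21 * (q * q)) ≡ + 8000 * q + + 28 * (q * q)
      regroup₂ = ℤSolver.solve-∀
      less : 8000 ℕ.* q ℕ.+ 28 ℕ.* (q ℕ.* q) ℕ.< 100 ℕ.* (q ℕ.* q)
      less = ℕ.≤-<-trans (ℕ.+-monoˡ-≤ (28 ℕ.* (q ℕ.* q)) (ℕ.*-monoˡ-≤ q (ℕ.≤-trans (ℕ.m≤m+n 8000 24768) 32768≤q)))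
        (ℕ.*-monoˡ-< (q ℕ.* q) {{ℕ.m*n≢0 q q {{q≢0}} {{q≢0}}}} (ℕ.m≤m+n 30 70))

  -- The Artin-Schreier map and dimension three

  module LowDimensional {n : ℕ} (𝔽 : BinaryField n) (j : ℕ) (n≡ : n ≡ suc (j ℕ.+ j)) (32768≤2^n : 32768 ℕ.≤ 2 ℕ.^ n) where

    open FieldProperties 𝔽
    open Odd j n≡
    open Subspaces 𝔽
    open OddSubspaces j n≡
    open IntegerSums
    open CharacterSums 𝔽 j n≡
    open Estimates (2 ℕ.^ n) 32768≤2^n M M-bound

    -- The subspace polynomial of the line spanned by 1; it unfolds to the same term as
    -- `L (1F ∷ [])`.
    ℘ : F n → F n
    ℘ x = x · (x ⊕ 1F)

    ℘-expand : ∀ x → ℘ x ≡ x · x ⊕ x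
    ℘-expand = solve 1 (λ x → x :* (x :+ con true) := x :* x :+ x) refl
      where open Solver

    ℘≡0 : ∀ x → ℘ x ≡ 0F → x ≡ 0F ⊎ x ≡ 1F
    ℘≡0 x e = idempotent⇒0∨1 x (trans (sym (℘-expand x)) e)

    ℘≢1 : ∀ x → ℘ x ≢ 1F
    ℘≢1 x e = no-cube-root x (trans (cong (_⊕ 1F) (trans (sym (℘-expand x)) e)) (⊕-self 1F))

    ℘-half : ∀ x → tr x ≡ false → ℘ (half x) ≡ x
    ℘-half x e = trans (℘-expand (half x)) (artin-schreier x e)

    inv-℘ : ∀ x → ℘ x ≢ 0F → inv x ⊕ inv (x ⊕ 1F) ≡ inv (℘ x)
    inv-℘ x ℘≢0 = begin
      inv x ⊕ inv (x ⊕ 1F)                    ≡⟨ inv-⊕ x (x ⊕ 1F) (λ { refl → ℘≢0 (·-zeroˡ _) }) (λ e → ℘≢0 (trans (cong (x ·_) e) (·-zeroʳ x))) ⟩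
      (x ⊕ (x ⊕ 1F)) · inv (℘ x)              ≡⟨ cong (_· inv (℘ x)) (⊕-cancel x 1F) ⟩
      1F · inv (℘ x)                          ≡⟨ ·-identityˡ _ ⟩
      inv (℘ x)                               ∎
      where open ≡-Reasoning

    -- For t other than 0 and 1, α is the inverse sum of ⟨1, t⟩ and β = α t. So α · ⟨1, t⟩ has
    -- inverse sum 1, and its preimage under `℘` is the desired space if α and β have trace 0.
    α β : F n → F n
    α t = 1F ⊕ (inv t ⊕ inv (t ⊕ 1F))
    β t = t ⊕ inv (t ⊕ 1F)

    -- As 1 has trace 1, the degenerate values t = 0 and t = 1 already fail the trace condition on
    -- β.
    β-01 : ∀ t → ℘ t ≡ 0F → β t ≡ 1F
    β-01 t e with ℘≡0 t e
    ... | inj₁ refl = trans (⊕-identityˡ _) (trans (cong inv (⊕-identityˡ 1F)) inv-1)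
    ... | inj₂ refl = trans (cong (1F ⊕_) (trans (cong inv (⊕-self 1F)) inv-0)) (⊕-identityʳ 1F)

    α-01 : ∀ t → ℘ t ≡ 0F → α (inv t) ≡ 0F
    α-01 t e with ℘≡0 t e
    ... | inj₁ refl = trans (cong α inv-0) (trans (cong (1F ⊕_) (trans (cong₂ _⊕_ inv-0 (trans (cong inv (⊕-identityˡ 1F)) inv-1)) (⊕-identityˡ 1F))) (⊕-self 1F))
    ... | inj₂ refl = trans (cong α inv-1) (trans (cong (1F ⊕_) (trans (cong₂ _⊕_ inv-1 (trans (cong inv (⊕-self 1F)) inv-0)) (⊕-identityʳ 1F))) (⊕-self 1F))

    α-inv : ∀ t → ℘ t ≢ 0F → α (inv t) ≡ β t
    α-inv t ℘≢0 = begin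
      1F ⊕ (inv (inv t) ⊕ inv (inv t ⊕ 1F))   ≡⟨ cong₂ (λ x y → 1F ⊕ (x ⊕ y)) (inv-involutive t) (sym (inv-unique inverse)) ⟩
      1F ⊕ (t ⊕ t · inv (t ⊕ 1F))             ≡⟨ cong (λ x → 1F ⊕ (t ⊕ x)) t·k ⟩
      1F ⊕ (t ⊕ (1F ⊕ inv (t ⊕ 1F)))          ≡⟨ solve 2 (λ t k → con true :+ (t :+ (con true :+ k)) := t :+ k) refl t (inv (t ⊕ 1F)) ⟩
      t ⊕ inv (t ⊕ 1F)                        ∎
      where
      open ≡-Reasoning
      open Solver
      t≢0 : t ≢ 0F
      t≢0 refl = ℘≢0 (·-zeroˡ _)
      t+1≢0 : t ⊕ 1F ≢ 0F
      t+1≢0 e = ℘≢0 (trans (cong (t ·_) e) (·-zeroʳ t))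
      k = inv (t ⊕ 1F)
      t·k : t · k ≡ 1F ⊕ k
      t·k = begin
        t · k                       ≡⟨ solve 2 (λ t k → t :* k := (t :+ con true) :* k :+ k) refl t k ⟩
        (t ⊕ 1F) · k ⊕ k            ≡⟨ cong (_⊕ k) (·-inverseʳ (t ⊕ 1F) t+1≢0) ⟩
        1F ⊕ k                      ∎
      inverse : (inv t ⊕ 1F) · (t · k) ≡ 1F
      inverse = begin
        (inv t ⊕ 1F) · (t · k)      ≡⟨ solve 3 (λ i t k → (i :+ con true) :* (t :* k) := (t :* i) :* k :+ t :* k) refl (inv t) t k ⟩
        (t · inv t) · k ⊕ t · k     ≡⟨ cong (λ x → x · k ⊕ t · k) (·-inverseʳ t t≢0) ⟩
        1F · k ⊕ t · k              ≡⟨ cong₂ _⊕_ (·-identityˡ k) t·k ⟩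
        k ⊕ (1F ⊕ k)                ≡⟨ solve 1 (λ k → k :+ (con true :+ k) := con true) refl k ⟩
        1F                          ∎

    K : ℤ
    K = ∑ (λ t → χ (t ⊕ inv t))

    -- Replacing x by x + y in the double sum separates χ x from the autocorrelation of χ ∘ `inv`.
    K²≡ : K * K ≡ ∑ (λ a → χ a * G a)
    K²≡ = begin
      K * K                                                            ≡⟨ ∑-product f f ⟩
      ∑ (λ x → ∑ (λ y → f x * f y))                                    ≡⟨ ∑-swap (λ x y → f x * f y) ⟩
      ∑ (λ y → ∑ (λ x → f x * f y))                                    ≡⟨ ∑-cong (λ y → ∑-shift y (λ x → f x * f y)) ⟨
      ∑ (λ y → ∑ (λ x → f (x ⊕ y) * f y))                              ≡⟨ ∑-swap (λ y x → f (x ⊕ y) * f y) ⟩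
      ∑ (λ x → ∑ (λ y → f (x ⊕ y) * f y))                              ≡⟨ ∑-cong (λ x → ∑-cong (λ y → pointwise x y)) ⟩
      ∑ (λ x → ∑ (λ y → χ x * χ (inv y ⊕ inv (x ⊕ y))))                ≡⟨ ∑-cong (λ x → ∑-*ˡ (χ x) _) ⟩
      ∑ (λ a → χ a * G a)                                              ∎
      where
      open ≡-Reasoning
      f : F n → ℤ
      f t = χ (t ⊕ inv t)
      pointwise : ∀ x y → f (x ⊕ y) * f y ≡ χ x * χ (inv y ⊕ inv (x ⊕ y))
      pointwise x y = trans (sym (χ-⊕ _ _)) (trans (cong χ
        (solve 4 (λ x y p q → ((x :+ y) :+ p) :+ (y :+ q) := x :+ (q :+ p)) refl x y (inv (x ⊕ y)) (inv y))) (χ-⊕ _ _))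
        where open Solver

    K⁴≤ : (K * K) * (K * K) ℤ.≤ Q * M
    K⁴≤ = subst (λ x → x * x ℤ.≤ Q * M) (sym K²≡) (signed-G χ χ-square)

    ∑χβ : ∑ (χ ∘ β) ≡ - K
    ∑χβ = begin
      ∑ (χ ∘ β)                          ≡⟨ ∑-shift 1F (χ ∘ β) ⟨
      ∑ (λ t → χ (β (t ⊕ 1F)))           ≡⟨ ∑-cong (λ t → trans (cong χ (pointwise t)) (χ-1⊕ (t ⊕ inv t))) ⟩
      ∑ (λ t → - χ (t ⊕ inv t))          ≡⟨ ∑-neg _ ⟩
      - K                                ∎
      where
      open ≡-Reasoning
      pointwise : ∀ t → β (t ⊕ 1F) ≡ 1F ⊕ (t ⊕ inv t)
      pointwise t = trans (cong (λ x → (t ⊕ 1F) ⊕ inv x) (trans (⊕-assoc t 1F 1F) (trans (cong (t ⊕_) (⊕-self 1F)) (⊕-identityʳ t))))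
        (trans (cong (_⊕ inv t) (⊕-comm t 1F)) (⊕-assoc 1F t (inv t)))

    -- The substitution t ↦ 1/t turns α into β except at 0 and 1. There the value is 0 instead of 1,
    -- and each of the two raises the sum by 2.
    ∑χα : ∑ (χ ∘ α) ≡ - K + + 4
    ∑χα = begin
      ∑ (χ ∘ α)                                              ≡⟨ ∑-reindex inv-injective (χ ∘ α) ⟨
      ∑ (λ t → χ (α (inv t)))                                ≡⟨ ∑-cong pointwise ⟩
      ∑ (λ t → χ (β t) + (+ 2 * δ 0F t + + 2 * δ 1F t))      ≡⟨ ∑-∙ (χ ∘ β) _ ⟩
      ∑ (χ ∘ β) + ∑ (λ t → + 2 * δ 0F t + + 2 * δ 1F t)
        ≡⟨ cong₂ _+_ ∑χβ (trans (∑-∙ (λ t → + 2 * δ 0F t) _) (cong₂ _+_ (trans (∑-*ˡ (+ 2) (δ 0F)) (cong (+ 2 *_) (∑-δ 0F))) (trans (∑-*ˡ (+ 2) (δ 1F)) (cong (+ 2 *_) (∑-δ 1F))))) ⟩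
      - K + + 4                                              ∎
      where
      open ≡-Reasoning
      at-01 : ∀ t → ℘ t ≡ 0F → δ 0F t + δ 1F t ≡ 1ℤ → χ (α (inv t)) ≡ χ (β t) + (+ 2 * δ 0F t + + 2 * δ 1F t)
      at-01 t e one = begin
        χ (α (inv t))                              ≡⟨ trans (cong χ (α-01 t e)) χ-0 ⟩
        1ℤ                                         ≡⟨ cong₂ (λ x y → x + + 2 * y) (trans (cong χ (β-01 t e)) χ-1) one ⟨
        χ (β t) + + 2 * (δ 0F t + δ 1F t)          ≡⟨ cong (_+_ (χ (β t))) (ℤ.*-distribˡ-+ (+ 2) (δ 0F t) (δ 1F t)) ⟩
        χ (β t) + (+ 2 * δ 0F t + + 2 * δ 1F t)    ∎
      pointwise : ∀ t → χ (α (inv t)) ≡ χ (β t) + (+ 2 * δ 0F t + + 2 * δ 1F t)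
      pointwise t with ℘ t ≟F 0F
      ... | no ne = begin
        χ (α (inv t))                              ≡⟨ cong χ (α-inv t ne) ⟩
        χ (β t)                                    ≡⟨ ℤ.+-identityʳ _ ⟨
        χ (β t) + (+ 2 * 0ℤ + + 2 * 0ℤ)            ≡⟨ cong₂ (λ x y → χ (β t) + (+ 2 * x + + 2 * y))
            (⟦⟧-no (t ≟F 0F) (λ { refl → ne (·-zeroˡ _) }))
            (⟦⟧-no (t ≟F 1F) (λ { refl → ne (trans (cong (1F ·_) (⊕-self 1F)) (·-zeroʳ 1F)) })) ⟨
        χ (β t) + (+ 2 * δ 0F t + + 2 * δ 1F t)    ∎
      ... | yes e with ℘≡0 t e
      ... | inj₁ refl = at-01 0F e (cong₂ _+_ (δ-refl {n} 0F) (⟦⟧-no (0F {n} ≟F 1F) (λ e′ → 1≢0 (sym e′))))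
      ... | inj₂ refl = at-01 1F e (cong₂ _+_ (⟦⟧-no (1F {n} ≟F 0F) 1≢0) (δ-refl {n} 1F))

    -- Otherwise Σ (1 + χ α)(1 + χ β) = 0. Since α + β = 1 + t + 1/t, the terms of the expansion sum
    -- to q, -K + 4, -K and -K, which forces 3K = q + 4.
    good-t : ∃[ t ] ℘ t ≢ 0F × tr (α t) ≡ false × tr (β t) ≡ false
    good-t with ∃? (λ t → ¬? (℘ t ≟F 0F) ×-dec (tr (α t) Bool.≟ false) ×-dec (tr (β t) Bool.≟ false))
    ... | yes found = found
    ... | no none   = ⊥-elim (kloosterman-contradiction K K⁴≤ (begin
      + 3 * K                                    ≡⟨ rearrange Q K ⟩
      (Q + + 4) - (Q * 1ℤ + (- K + + 4) + (- K + - K))  ≡⟨ cong (λ x → (Q + + 4) - x) total≡0 ⟩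
      (Q + + 4) - 0ℤ                             ≡⟨ ℤ.+-identityʳ (Q + + 4) ⟩
      Q + + 4                                    ∎))
      where
      open ≡-Reasoning
      rearrange : ∀ (Q K : ℤ) → + 3 * K ≡ (Q + + 4) - (Q * 1ℤ + (- K + + 4) + (- K + - K))
      rearrange = ℤSolver.solve-∀
      expand : ∀ x y → (1ℤ + x) * (1ℤ + y) ≡ 1ℤ + x + (y + x * y)
      expand = ℤSolver.solve-∀
      vanish : ∀ t → (1ℤ + χ (α t)) * (1ℤ + χ (β t)) ≡ 0ℤ
      vanish t = cases (℘ t ≟F 0F) (tr (α t) Bool.≟ false) (tr (β t) Bool.≟ false)
        where
        right : tr (β t) ≡ true → (1ℤ + χ (α t)) * (1ℤ + χ (β t)) ≡ 0ℤ
        right e = trans (cong ((1ℤ + χ (α t)) *_) (1+χ≡0 e)) (ℤ.*-zeroʳ (1ℤ + χ (α t)))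
        cases : Dec (℘ t ≡ 0F) → Dec (tr (α t) ≡ false) → Dec (tr (β t) ≡ false) → _
        cases (yes e) _ _ = right (trans (cong tr (β-01 t e)) tr-1)
        cases (no _)  (no ne) _ = cong (_* (1ℤ + χ (β t))) (1+χ≡0 (Bool.¬-not ne))
        cases (no _)  (yes _) (no ne) = right (Bool.¬-not ne)
        cases (no ne) (yes e) (yes e′) = ⊥-elim (none (t , ne , e , e′))
      χαχβ : ∀ t → χ (α t) * χ (β t) ≡ - χ (t ⊕ inv t)
      χαχβ t = trans (sym (χ-⊕ _ _)) (trans (cong χ
        (solve 3 (λ t i k → (con true :+ (i :+ k)) :+ (t :+ k) := con true :+ (t :+ i)) refl t (inv t) (inv (t ⊕ 1F)))) (χ-1⊕ _))
        where open Solver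
      total≡0 : Q * 1ℤ + (- K + + 4) + (- K + - K) ≡ 0ℤ
      total≡0 = begin
        Q * 1ℤ + (- K + + 4) + (- K + - K)
          ≡⟨ cong₂ _+_ (cong₂ _+_ (∑-const n 1ℤ) ∑χα) (cong₂ _+_ ∑χβ (∑-neg (λ t → χ (t ⊕ inv t)))) ⟨
        ∑ {n} (λ _ → 1ℤ) + ∑ (χ ∘ α) + (∑ (χ ∘ β) + ∑ (λ t → - χ (t ⊕ inv t)))
          ≡⟨ trans (∑-∙ (λ t → 1ℤ + χ (α t)) _) (cong₂ _+_ (∑-∙ (λ _ → 1ℤ) (χ ∘ α)) (∑-∙ (χ ∘ β) _)) ⟨
        ∑ (λ t → 1ℤ + χ (α t) + (χ (β t) + - χ (t ⊕ inv t)))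
          ≡⟨ ∑-cong (λ t → trans (cong (λ x → 1ℤ + χ (α t) + (χ (β t) + x)) (sym (χαχβ t))) (trans (sym (expand (χ (α t)) (χ (β t)))) (vanish t))) ⟩
        ∑ {n} (λ _ → 0ℤ)
          ≡⟨ ∑-ε {n} ⟩
        0ℤ ∎

    ZS-3 : ZS 3
    ZS-3 with good-t
    -- The two half traces are preimages under `℘` of α and β = α t; adding the kernel vector 1
    -- gives the full preimage of α · ⟨1, t⟩.
    ... | t , ℘t≢0 , trα , trβ = half (β t) ∷ half (α t) ∷ 1F ∷ [] , ·≢0 Lw≢0 (·≢0 Lu≢0 (·≢0 1≢0 1≢0)) , (begin
      s (half (β t) ∷ half (α t) ∷ 1F ∷ [])
        ≡⟨ s-cons-indep (half (β t)) (half (α t) ∷ 1F ∷ []) Lw≢0 ⟩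
      s (half (α t) ∷ 1F ∷ []) ⊕ C (half (α t) ∷ 1F ∷ []) · inv (L (half (α t) ∷ 1F ∷ []) (half (β t)))
        ≡⟨ cong₂ _⊕_ (trans (s-cons-indep (half (α t)) (1F ∷ []) Lu≢0) (cong (λ x → s (1F ∷ []) ⊕ C (1F ∷ []) · inv x) Lu))
                     (cong₂ (λ x y → (x · C (1F ∷ [])) · inv y) Lu Lw) ⟩
      (s (1F ∷ []) ⊕ C (1F ∷ []) · inv a) ⊕ (a · C (1F ∷ [])) · inv ((a · a) · ℘ t)
        ≡⟨ cong₂ (λ x y → (x ⊕ y · inv a) ⊕ (a · y) · inv ((a · a) · ℘ t)) s1 (·-identityˡ 1F) ⟩
      (1F ⊕ 1F · inv a) ⊕ (a · 1F) · inv ((a · a) · ℘ t)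
        ≡⟨ cong (λ x → (1F ⊕ 1F · inv a) ⊕ (a · 1F) · x) (trans (inv-· (a · a) (℘ t)) (cong₂ _·_ (inv-· a a) inv℘)) ⟩
      (1F ⊕ 1F · inv a) ⊕ (a · 1F) · ((inv a · inv a) · (1F ⊕ a))
        ≡⟨ solve 2 (λ a i → (con true :+ con true :* i) :+ (a :* con true) :* ((i :* i) :* (con true :+ a)) := (con true :+ i) :+ (a :* i) :* (i :+ a :* i)) refl a (inv a) ⟩
      (1F ⊕ inv a) ⊕ (a · inv a) · (inv a ⊕ a · inv a)
        ≡⟨ cong (λ x → (1F ⊕ inv a) ⊕ x · (inv a ⊕ x)) (·-inverseʳ a a≢0) ⟩
      (1F ⊕ inv a) ⊕ 1F · (inv a ⊕ 1F)
        ≡⟨ solve 1 (λ i → (con true :+ i) :+ con true :* (i :+ con true) := con false) refl (inv a) ⟩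
      0F ∎)
      where
      open ≡-Reasoning
      open Solver
      a : F n
      a = α t
      inv℘ : inv (℘ t) ≡ 1F ⊕ a
      inv℘ = trans (sym (inv-℘ t ℘t≢0)) (sym (⊕-cancel 1F _))
      -- α = 1 + 1/℘(t), so its vanishing would mean ℘(t) = 1, which odd n excludes.
      a≢0 : a ≢ 0F
      a≢0 e = ℘≢1 t (begin
        ℘ t                   ≡⟨ inv-involutive (℘ t) ⟨
        inv (inv (℘ t))       ≡⟨ cong inv (trans inv℘ (trans (cong (1F ⊕_) e) (⊕-identityʳ 1F))) ⟩
        inv 1F                ≡⟨ inv-1 ⟩
        1F                    ∎)
      s1 : s (1F ∷ []) ≡ 1F
      s1 = trans (s-single 1F) inv-1
      Lu : L (1F ∷ []) (half (α t)) ≡ a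
      Lu = ℘-half (α t) trα
      β≡ : β t ≡ a · t
      β≡ = begin
        t ⊕ k                                        ≡⟨ solve 2 (λ t k → t :+ k := t :+ (con true :+ (con true :+ k))) refl t k ⟩
        t ⊕ (1F ⊕ (1F ⊕ k))                          ≡⟨ cong₂ (λ x y → t ⊕ (x ⊕ (y ⊕ k))) (·-inverseʳ t t≢0) (·-inverseʳ (t ⊕ 1F) t+1≢0) ⟨
        t ⊕ (t · inv t ⊕ ((t ⊕ 1F) · k ⊕ k))         ≡⟨ solve 3 (λ t i k → t :+ (t :* i :+ ((t :+ con true) :* k :+ k)) := (con true :+ (i :+ k)) :* t) refl t (inv t) k ⟩
        a · t                                        ∎
        where
        k = inv (t ⊕ 1F)
        t≢0 : t ≢ 0F
        t≢0 refl = ℘t≢0 (·-zeroˡ _)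
        t+1≢0 : t ⊕ 1F ≢ 0F
        t+1≢0 e = ℘t≢0 (trans (cong (t ·_) e) (·-zeroʳ t))
      Lw : L (half (α t) ∷ 1F ∷ []) (half (β t)) ≡ (a · a) · ℘ t
      Lw = begin
        L (half (α t) ∷ 1F ∷ []) (half (β t))              ≡⟨ L-cons (half (α t)) (1F ∷ []) (half (β t)) ⟩
        ℘ (half (β t)) · (℘ (half (β t)) ⊕ ℘ (half (α t))) ≡⟨ cong₂ (λ x y → x · (x ⊕ y)) (trans (℘-half (β t) trβ) β≡) Lu ⟩
        (a · t) · (a · t ⊕ a)                              ≡⟨ solve 2 (λ a t → (a :* t) :* (a :* t :+ a) := (a :* a) :* (t :* (t :+ con true))) refl a t ⟩
        (a · a) · ℘ t                                      ∎
      Lu≢0 : L (1F ∷ []) (half (α t)) ≢ 0F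
      Lu≢0 e = a≢0 (trans (sym Lu) e)
      Lw≢0 : L (half (α t) ∷ 1F ∷ []) (half (β t)) ≢ 0F
      Lw≢0 e = ·≢0 (·≢0 a≢0 a≢0) ℘t≢0 (trans (sym Lw) e)

    -- Dimension four

    tr-℘ : ∀ x → tr (℘ x) ≡ false
    tr-℘ x = trans (cong tr (℘-expand x)) (tr-artin-schreier x)

    ℘-⊕ : ∀ x y → ℘ (x ⊕ y) ≡ ℘ x ⊕ ℘ y
    ℘-⊕ = solve 2 (λ x y → (x :+ y) :* ((x :+ y) :+ con true) := x :* (x :+ con true) :+ y :* (y :+ con true)) refl
      where open Solver

    -- The fibres of `℘` have two elements over trace 0 and none over trace 1, that is, 1 + χ a
    -- elements over a.
    ∑-℘ : ∀ (f : F n → ℤ) → ∑ (f ∘ ℘) ≡ ∑ (λ a → (1ℤ + χ a) * f a)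
    ∑-℘ f = begin
      ∑ (f ∘ ℘)                                 ≡⟨ ∑-cong (λ y → sym (pick y)) ⟩
      ∑ (λ y → ∑ (λ a → δ (℘ y) a * f a))       ≡⟨ ∑-swap (λ y a → δ (℘ y) a * f a) ⟩
      ∑ (λ a → ∑ (λ y → δ (℘ y) a * f a))       ≡⟨ ∑-cong (λ a → trans (∑-*ʳ (f a) (λ y → δ (℘ y) a)) (cong (_* f a) (fibre a))) ⟩
      ∑ (λ a → (1ℤ + χ a) * f a)                ∎
      where
      open ≡-Reasoning
      pick : ∀ y → ∑ (λ a → δ (℘ y) a * f a) ≡ f (℘ y)
      pick y = trans (∑-only (℘ y) _ (λ a a≢ → cong (_* f a) (⟦⟧-no (a ≟F ℘ y) a≢)))
                     (trans (cong (_* f (℘ y)) (δ-refl (℘ y))) (ℤ.*-identityˡ _))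
      fibre : ∀ a → ∑ (λ y → δ (℘ y) a) ≡ 1ℤ + χ a
      fibre a with tr a in tr-a
      ... | true = trans (∑-cong (λ y → ⟦⟧-no (a ≟F ℘ y) (λ e → true≢false (trans (sym tr-a) (trans (cong tr e) (tr-℘ y)))))) (∑-ε {n})
        where
        true≢false : true ≢ false
        true≢false ()
      ... | false = trans (∑-cong pointwise) (trans (∑-∙ (δ h) (δ (h ⊕ 1F))) (cong₂ _+_ (∑-δ h) (∑-δ (h ⊕ 1F))))
        where
        h : F n
        h = half a
        h≢h+1 : h ≢ h ⊕ 1F
        h≢h+1 e = 1≢0 (trans (sym (⊕-cancel h 1F)) (trans (cong (h ⊕_) (sym e)) (⊕-self h)))
        ℘h+1 : ℘ (h ⊕ 1F) ≡ a
        ℘h+1 = trans (℘-⊕ h 1F) (trans (cong₂ _⊕_ (℘-half a tr-a) (trans (cong (1F ·_) (⊕-self 1F)) (·-zeroʳ 1F))) (⊕-identityʳ a))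
        pointwise : ∀ y → δ (℘ y) a ≡ δ h y + δ (h ⊕ 1F) y
        pointwise y with y ≟F h
        ... | yes refl = trans (⟦⟧-yes (a ≟F ℘ h) (sym (℘-half a tr-a))) (cong (λ t → 1ℤ + t) (sym (⟦⟧-no (h ≟F (h ⊕ 1F)) h≢h+1)))
        ... | no y≢h with y ≟F (h ⊕ 1F)
        ... | yes refl = ⟦⟧-yes (a ≟F ℘ (h ⊕ 1F)) (sym ℘h+1)
        ... | no y≢h+1 = ⟦⟧-no (a ≟F ℘ y) λ a≡ → root≢ a≡ (℘≡0 (y ⊕ h) (trans (℘-⊕ y h) (trans (cong₂ _⊕_ (sym a≡) (℘-half a tr-a)) (⊕-self a))))
          where
          root≢ : a ≡ ℘ y → y ⊕ h ≡ 0F ⊎ y ⊕ h ≡ 1F → ⊥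
          root≢ _ (inj₁ e) = y≢h (⊕≡0⇒≡ y h e)
          root≢ _ (inj₂ e) = y≢h+1 (trans (sym (⊕-cancel h y)) (cong (h ⊕_) (trans (⊕-comm h y) e)))

    ∑² : (F n → F n → ℤ) → ℤ
    ∑² f = ∑ (λ y → ∑ (λ z → f y z))

    ∑²-cong : ∀ {f g} → (∀ y z → f y z ≡ g y z) → ∑² f ≡ ∑² g
    ∑²-cong e = ∑-cong λ y → ∑-cong λ z → e y z

    ∑²-mono : ∀ {f g} → (∀ y z → f y z ℤ.≤ g y z) → ∑² f ℤ.≤ ∑² g
    ∑²-mono e = ∑-mono λ y → ∑-mono λ z → e y z

    ∑²-+ : ∀ f g → ∑² (λ y z → f y z + g y z) ≡ ∑² f + ∑² g
    ∑²-+ f g = trans (∑-cong λ y → ∑-∙ (f y) (g y)) (∑-∙ _ _)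

    ∑²-const : ∀ c → ∑² (λ _ _ → c) ≡ Q * (Q * c)
    ∑²-const c = trans (∑-cong {n} λ _ → ∑-const n c) (∑-const n _)

    Φ : F n → F n → F n
    Φ a b = inv a ⊕ inv b ⊕ inv (a ⊕ b)

    T₀ T₁ S S′ : ℤ
    T₀ = ∑ (λ a → χ (inv a) * G a)
    T₁ = ∑ (λ a → χ (a ⊕ inv a) * G a)
    S′ = ∑² (λ y z → χ (Φ (℘ y) (℘ z)))

    private
      U₀ : ∑² (λ a b → χ (Φ a b)) ≡ T₀
      U₀ = ∑-cong λ a → trans (∑-cong λ b → trans (cong χ (⊕-assoc (inv a) (inv b) (inv (a ⊕ b)))) (χ-⊕ (inv a) _)) (∑-*ˡ (χ (inv a)) _)

      U₁ : ∑² (λ a b → χ a * χ (Φ a b)) ≡ T₁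
      U₁ = ∑-cong λ a → trans (∑-cong λ b → trans (sym (χ-⊕ a (Φ a b))) (trans (cong χ (regroup a b)) (χ-⊕ (a ⊕ inv a) _))) (∑-*ˡ (χ (a ⊕ inv a)) _)
        where
        open Solver
        regroup : ∀ a b → a ⊕ Φ a b ≡ (a ⊕ inv a) ⊕ (inv b ⊕ inv (a ⊕ b))
        regroup a b = solve 4 (λ a p q r → a :+ (p :+ q :+ r) := (a :+ p) :+ (q :+ r)) refl a (inv a) (inv b) (inv (a ⊕ b))

      U₂ : ∑² (λ a b → χ b * χ (Φ a b)) ≡ T₁
      U₂ = trans (∑-swap (λ a b → χ b * χ (Φ a b))) (trans (∑²-cong λ b a → cong (λ t → χ b * χ t) (symmetric a b)) U₁)
        where
        symmetric : ∀ a b → Φ a b ≡ Φ b a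
        symmetric a b = cong₂ _⊕_ (⊕-comm (inv a) (inv b)) (cong inv (⊕-comm a b))

      U₃ : ∑² (λ a b → χ (a ⊕ b) * χ (Φ a b)) ≡ T₁
      U₃ = trans (∑-cong λ a → trans (sym (∑-shift a (λ b → χ (a ⊕ b) * χ (Φ a b)))) (∑-cong λ b →
             cong₂ (λ s t → χ s * χ t) (a+b+a a b) (trans (cong (λ t → inv a ⊕ inv (b ⊕ a) ⊕ inv t) (a+b+a a b)) (regroup a b)))) U₂
        where
        a+b+a : ∀ a b → a ⊕ (b ⊕ a) ≡ b
        a+b+a a b = trans (cong (a ⊕_) (⊕-comm b a)) (⊕-cancel a b)
        regroup : ∀ a b → inv a ⊕ inv (b ⊕ a) ⊕ inv b ≡ Φ a b
        regroup a b = trans (cong (λ t → inv a ⊕ inv t ⊕ inv b) (⊕-comm b a))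
          (trans (⊕-assoc (inv a) _ _) (trans (cong (inv a ⊕_) (⊕-comm _ (inv b))) (sym (⊕-assoc (inv a) _ _))))

    -- Expanding one factor 1 + χ per variable leaves four sums. The three twisted by χ a, χ b and χ
    -- (a + b) agree, since `Φ` is symmetric in a, b and a + b.
    S′≡ : S′ ≡ T₀ + + 3 * T₁
    S′≡ = begin
      ∑² (λ y z → χ (Φ (℘ y) (℘ z)))
        ≡⟨ ∑-cong (λ y → ∑-℘ (λ b → χ (Φ (℘ y) b))) ⟩
      ∑ (λ y → ∑ (λ b → (1ℤ + χ b) * χ (Φ (℘ y) b)))
        ≡⟨ ∑-℘ (λ a → ∑ (λ b → (1ℤ + χ b) * χ (Φ a b))) ⟩
      ∑ (λ a → (1ℤ + χ a) * ∑ (λ b → (1ℤ + χ b) * χ (Φ a b)))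
        ≡⟨ ∑-cong (λ a → ∑-*ˡ (1ℤ + χ a) _) ⟨
      ∑² (λ a b → (1ℤ + χ a) * ((1ℤ + χ b) * χ (Φ a b)))
        ≡⟨ ∑²-cong (λ a b → trans (expand (χ a) (χ b) (χ (Φ a b))) (cong (λ t → χ (Φ a b) + χ a * χ (Φ a b) + (χ b * χ (Φ a b) + t * χ (Φ a b))) (sym (χ-⊕ a b)))) ⟩
      ∑² (λ a b → χ (Φ a b) + χ a * χ (Φ a b) + (χ b * χ (Φ a b) + χ (a ⊕ b) * χ (Φ a b)))
        ≡⟨ trans (∑²-+ (λ a b → χ (Φ a b) + χ a * χ (Φ a b)) _) (cong₂ _+_ (∑²-+ (λ a b → χ (Φ a b)) _) (∑²-+ (λ a b → χ b * χ (Φ a b)) _)) ⟩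
      ∑² (λ a b → χ (Φ a b)) + ∑² (λ a b → χ a * χ (Φ a b)) + (∑² (λ a b → χ b * χ (Φ a b)) + ∑² (λ a b → χ (a ⊕ b) * χ (Φ a b)))
        ≡⟨ cong₂ _+_ (cong₂ _+_ U₀ U₁) (cong₂ _+_ U₂ U₃) ⟩
      T₀ + T₁ + (T₁ + T₁)
        ≡⟨ collect T₀ T₁ ⟩
      T₀ + + 3 * T₁ ∎
      where
      open ≡-Reasoning
      expand : ∀ x y t → (1ℤ + x) * ((1ℤ + y) * t) ≡ t + x * t + (y * t + (x * y) * t)
      expand = ℤSolver.solve-∀
      collect : ∀ (x y : ℤ) → x + y + (y + y) ≡ x + + 3 * y
      collect = ℤSolver.solve-∀

    σ : F n → F n → F n
    σ y z = s (z ∷ y ∷ 1F ∷ [])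

    S = ∑² (λ y z → χ (σ y z))

    σ-nondegenerate : ∀ y z → C (z ∷ y ∷ 1F ∷ []) ≢ 0F → σ y z ≡ 1F ⊕ Φ (℘ y) (℘ z)
    σ-nondegenerate y z C≢0 = begin
      s ((z ∷ y ∷ []) ++ (1F ∷ []))                      ≡⟨ s-++ (z ∷ y ∷ []) (1F ∷ []) C≢0 ⟩
      s (1F ∷ []) ⊕ (1F · 1F) · s (℘ z ∷ ℘ y ∷ [])       ≡⟨ cong₂ _⊕_ (trans (s-single 1F) inv-1) (cong₂ _·_ (·-identityˡ 1F) (s-pair (℘ z) (℘ y))) ⟩
      1F ⊕ 1F · Φ (℘ y) (℘ z)                            ≡⟨ cong (1F ⊕_) (·-identityˡ _) ⟩
      1F ⊕ Φ (℘ y) (℘ z)                                 ∎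
      where open ≡-Reasoning

    -- On independent triples σ = 1 + Φ, and the two characters cancel; on dependent ones σ = 0
    -- contributes 1, at least as much as can be lost. The one-sided bound avoids counting dependent
    -- triples.
    S+S′≥0 : 0ℤ ℤ.≤ S + S′
    S+S′≥0 = subst₂ ℤ._≤_ (trans (∑²-const 0ℤ) (trans (cong (Q *_) (ℤ.*-zeroʳ Q)) (ℤ.*-zeroʳ Q))) (∑²-+ _ _) (∑²-mono pointwise)
      where
      pointwise : ∀ y z → 0ℤ ℤ.≤ χ (σ y z) + χ (Φ (℘ y) (℘ z))
      pointwise y z with C (z ∷ y ∷ 1F ∷ []) ≟F 0F
      ... | yes C≡0 = subst (λ t → 0ℤ ℤ.≤ t + χ (Φ (℘ y) (℘ z))) (sym (trans (cong χ (C≡0⇒A≡0 (z ∷ y ∷ 1F ∷ []) C≡0 0F)) χ-0))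
                        (ℤ.+-monoʳ-≤ 1ℤ (χ≥-1 (Φ (℘ y) (℘ z))))
      ... | no C≢0  = ℤ.≤-reflexive (sym (trans (cong (_+ χ (Φ (℘ y) (℘ z))) (trans (cong χ (σ-nondegenerate y z C≢0)) (χ-1⊕ _))) (ℤ.+-inverseˡ (χ (Φ (℘ y) (℘ z))))))

    σ-swap : ∀ y z → σ y z ≡ σ z y
    σ-swap y z = A-swap z y (1F ∷ []) 0F

    σ-+ˡ : ∀ y z → σ (y ⊕ 1F) z ≡ σ y z
    σ-+ˡ y z = trans (σ-swap (y ⊕ 1F) z) (trans (A-add y (z ∷ 1F ∷ []) 0F (false ∷ true ∷ []) (sym (trans (⊕-identityˡ _) (⊕-identityʳ 1F)))) (σ-swap z y))

    σ-+ʳ : ∀ y z {w} c → w ≡ combo c (y ∷ 1F ∷ []) → σ y (z ⊕ w) ≡ σ y z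
    σ-+ʳ y z c = A-add z (y ∷ 1F ∷ []) 0F c

    σ-0 : ∀ z → σ 0F z ≡ 0F
    σ-0 z = C≡0⇒A≡0 (z ∷ 0F ∷ 1F ∷ []) (trans (cong (λ t → L (0F ∷ 1F ∷ []) z · (t · (1F · 1F))) (·-zeroˡ (0F ⊕ 1F))) (trans (cong (L (0F ∷ 1F ∷ []) z ·_) (·-zeroˡ _)) (·-zeroʳ _))) 0F

    -- ⟨1, 1/y, z/y⟩ is ⟨y, 1, z⟩ scaled by 1/y.
    σ-inv : ∀ y z → y ≢ 0F → σ (inv y) (inv y · z) · inv y ≡ σ y z
    σ-inv y z y≢0 = begin
      s (inv y · z ∷ inv y ∷ 1F ∷ []) · inv y
        ≡⟨ cong₂ (λ p q → s (inv y · z ∷ p ∷ q ∷ []) · inv y) (·-identityʳ (inv y)) (·-inverseˡ y y≢0) ⟨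
      s (map (inv y ·_) (z ∷ 1F ∷ y ∷ [])) · inv y
        ≡⟨ cong (_· inv y) (s-scale (inv y) (z ∷ 1F ∷ y ∷ [])) ⟩
      inv (inv y) · s (z ∷ 1F ∷ y ∷ []) · inv y
        ≡⟨ cong₂ (λ p q → p · q · inv y) (inv-involutive y) reorder ⟩
      y · σ y z · inv y
        ≡⟨ solve 3 (λ y t i → y :* t :* i := t :* (y :* i)) refl y (σ y z) (inv y) ⟩
      σ y z · (y · inv y)
        ≡⟨ trans (cong (σ y z ·_) (·-inverseʳ y y≢0)) (·-identityʳ _) ⟩
      σ y z ∎
      where
      open ≡-Reasoning
      open Solver
      reorder : s (z ∷ 1F ∷ y ∷ []) ≡ σ y z
      reorder = trans (A-cons z (1F ∷ y ∷ []) 0F) (trans (cong₂ _⊕_ (A-swap 1F y [] 0F) (A-swap 1F y [] (0F ⊕ z))) (sym (A-cons z (y ∷ 1F ∷ []) 0F)))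

    -- σ y z · u for the nonzero u in ⟨1, y, z⟩: GL₃(𝔽₂) permutes these u transitively, so all seven character sums equal S.
    private
      Eʸ : ∑² (λ y z → χ (σ y z · y)) ≡ S
      Eʸ = trans (sym (∑-reindex inv-injective (λ y → ∑ (λ z → χ (σ y z · y))))) (∑-cong row)
        where
        row : ∀ y → ∑ (λ z → χ (σ (inv y) z · inv y)) ≡ ∑ (λ z → χ (σ y z))
        row y with y ≟F 0F
        ... | yes refl = ∑-cong λ z → cong χ (trans (trans (cong (σ (inv 0F) z ·_) inv-0) (·-zeroʳ _)) (sym (σ-0 z)))
        ... | no y≢0   = trans (sym (∑-reindex (·-cancelˡ (inv-≢0 y≢0)) (λ z → χ (σ (inv y) z · inv y)))) (∑-cong λ z → cong χ (σ-inv y z y≢0))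

      Eᶻ : ∑² (λ y z → χ (σ y z · z)) ≡ S
      Eᶻ = trans (∑-swap (λ y z → χ (σ y z · z))) (trans (∑²-cong λ z y → cong (λ t → χ (t · z)) (σ-swap y z)) Eʸ)

      Eʸ⁺¹ : ∑² (λ y z → χ (σ y z · (y ⊕ 1F))) ≡ S
      Eʸ⁺¹ = trans (∑²-cong λ y z → cong (λ t → χ (t · (y ⊕ 1F))) (sym (σ-+ˡ y z))) (trans (∑-shift 1F (λ y → ∑ (λ z → χ (σ y z · y)))) Eʸ)

      Eᶻ⁺ : ∀ (w : F n → F n) (c : Vec Bool 2) → (∀ y → w y ≡ combo c (y ∷ 1F ∷ [])) → ∑² (λ y z → χ (σ y z · (z ⊕ w y))) ≡ S
      Eᶻ⁺ w c w≡ = trans (∑-cong λ y → trans (∑-cong λ z → cong (λ t → χ (t · (z ⊕ w y))) (sym (σ-+ʳ y z c (w≡ y)))) (∑-shift (w y) (λ z → χ (σ y z · z)))) Eᶻ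

    P : F n → F n → ℤ
    P y z = (1ℤ + χ (σ y z)) * ((1ℤ + χ (σ y z · y)) * (1ℤ + χ (σ y z · z)))

    -- The product expands into 1 and the characters of σ u for the seven combinations u of 1, y, z
    -- with nonzero coefficients; each of these sums to `S`.
    ∑²P : ∑² P ≡ Q * Q + + 7 * S
    ∑²P = begin
      ∑² P
        ≡⟨ ∑²-cong (λ y z → trans (expand (a y z) (b y z) (c y z)) (cong (λ t → ((1ℤ + a y z) + (b y z + c y z)) + t)
             (cong₂ _+_ (cong₂ _+_ (times-σ y z y) (times-σ y z z))
                        (cong₂ _+_ (times y z) (trans (cong (a y z *_) (times y z)) (times-σ′ y z)))))) ⟩
      ∑² (λ y z → ((1ℤ + a y z) + (b y z + c y z)) + ((χ (σ y z · (y ⊕ 1F)) + χ (σ y z · (z ⊕ 1F))) + (χ (σ y z · (z ⊕ y)) + χ (σ y z · (z ⊕ (y ⊕ 1F))))))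
        ≡⟨ trans (∑²-+ (λ y z → (1ℤ + a y z) + (b y z + c y z)) _)
             (cong₂ _+_ (trans (∑²-+ (λ y z → 1ℤ + a y z) _) (cong₂ _+_ (∑²-+ (λ _ _ → 1ℤ) a) (∑²-+ b c)))
                        (trans (∑²-+ (λ y z → χ (σ y z · (y ⊕ 1F)) + χ (σ y z · (z ⊕ 1F))) _) (cong₂ _+_ (∑²-+ (λ y z → χ (σ y z · (y ⊕ 1F))) _) (∑²-+ (λ y z → χ (σ y z · (z ⊕ y))) _)))) ⟩
      ((∑² (λ _ _ → 1ℤ) + ∑² a) + (∑² b + ∑² c)) + ((∑² (λ y z → χ (σ y z · (y ⊕ 1F))) + ∑² (λ y z → χ (σ y z · (z ⊕ 1F)))) + (∑² (λ y z → χ (σ y z · (z ⊕ y))) + ∑² (λ y z → χ (σ y z · (z ⊕ (y ⊕ 1F))))))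
        ≡⟨ cong₂ _+_ (cong₂ _+_ (cong₂ _+_ (∑²-const 1ℤ) refl) (cong₂ _+_ Eʸ Eᶻ))
             (cong₂ _+_ (cong₂ _+_ Eʸ⁺¹ (Eᶻ⁺ (λ _ → 1F) (false ∷ true ∷ []) (λ _ → sym (trans (⊕-identityˡ _) (⊕-identityʳ 1F)))))
                        (cong₂ _+_ (Eᶻ⁺ id (true ∷ false ∷ []) (λ y → sym (trans (cong (y ⊕_) (⊕-identityˡ 0F)) (⊕-identityʳ y))))
                                   (Eᶻ⁺ (_⊕ 1F) (true ∷ true ∷ []) (λ y → cong (y ⊕_) (sym (⊕-identityʳ 1F)))))) ⟩
      ((Q * (Q * 1ℤ) + S) + (S + S)) + ((S + S) + (S + S))
        ≡⟨ collect Q S ⟩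
      Q * Q + + 7 * S ∎
      where
      open ≡-Reasoning
      a b c : F n → F n → ℤ
      a y z = χ (σ y z)
      b y z = χ (σ y z · y)
      c y z = χ (σ y z · z)
      expand : ∀ a b c → (1ℤ + a) * ((1ℤ + b) * (1ℤ + c)) ≡ ((1ℤ + a) + (b + c)) + ((a * b + a * c) + (b * c + a * (b * c)))
      expand = ℤSolver.solve-∀
      collect : ∀ (Q S : ℤ) → ((Q * (Q * 1ℤ) + S) + (S + S)) + ((S + S) + (S + S)) ≡ Q * Q + + 7 * S
      collect = ℤSolver.solve-∀
      times-σ : ∀ y z t → χ (σ y z) * χ (σ y z · t) ≡ χ (σ y z · (t ⊕ 1F))
      times-σ y z t = trans (sym (χ-⊕ _ _)) (cong χ (solve 2 (λ s t → s :+ s :* t := s :* (t :+ con true)) refl (σ y z) t))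
        where open Solver
      times : ∀ y z → χ (σ y z · y) * χ (σ y z · z) ≡ χ (σ y z · (z ⊕ y))
      times y z = trans (sym (χ-⊕ _ _)) (cong χ (solve 3 (λ s y z → s :* y :+ s :* z := s :* (z :+ y)) refl (σ y z) y z))
        where open Solver
      times-σ′ : ∀ y z → χ (σ y z) * χ (σ y z · (z ⊕ y)) ≡ χ (σ y z · (z ⊕ (y ⊕ 1F)))
      times-σ′ y z = trans (times-σ y z (z ⊕ y)) (cong (λ t → χ (σ y z · t)) (⊕-assoc z y 1F))

    -- L ⟨1, y⟩ takes the same value at all zeros of σ y outside ⟨1, y⟩.
    zeros-of-σ : ∀ y → ℘ y ≢ 0F → ∃[ z₀ ] ∀ z → σ y z ≡ 0F → ∃[ c ] z ≡ combo c (z₀ ∷ y ∷ 1F ∷ [])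
    zeros-of-σ y ℘y≢0 with ∃? (λ z → ¬? (L (y ∷ 1F ∷ []) z ≟F 0F) ×-dec (σ y z ≟F 0F))
    -- If all zeros lie in ⟨1, y⟩, the default vector 0 leaves that span unchanged.
    ... | no none = 0F , λ z σ≡0 → L≡0⇒combo (0F ∷ y ∷ 1F ∷ []) z (trans (cong (_· L (y ∷ 1F ∷ []) (z ⊕ 0F)) (trivial z σ≡0)) (·-zeroˡ _))
      where
      trivial : ∀ z → σ y z ≡ 0F → L (y ∷ 1F ∷ []) z ≡ 0F
      trivial z σ≡0 with L (y ∷ 1F ∷ []) z ≟F 0F
      ... | yes e = e
      ... | no ne = ⊥-elim (none (z , ne , σ≡0))
    ... | yes (z₀ , L≢0 , σ₀) = z₀ , λ z σ≡0 → L≡0⇒combo (z₀ ∷ y ∷ 1F ∷ []) z (vanishes z σ≡0)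
      where
      V = y ∷ 1F ∷ []
      CV≢0 : C V ≢ 0F
      CV≢0 = ·≢0 ℘y≢0 (·≢0 1≢0 1≢0)
      value : ∀ z → σ y z ≡ 0F → L V z ≢ 0F → C V · inv (L V z) ≡ s V
      value z σ≡0 ne = sym (⊕≡0⇒≡ _ _ (trans (sym (s-cons-indep z V ne)) σ≡0))
      vanishes : ∀ z → σ y z ≡ 0F → L (z₀ ∷ V) z ≡ 0F
      vanishes z σ≡0 with L V z ≟F 0F
      ... | yes e = trans (cong (_· L V (z ⊕ z₀)) e) (·-zeroˡ _)
      ... | no ne = trans (L-cons z₀ V z) (trans (cong (L V z ·_) (trans (cong (_⊕ L V z₀) same) (⊕-self _))) (·-zeroʳ _))
        where
        same : L V z ≡ L V z₀
        same = inv-injective (·-cancelˡ CV≢0 (trans (value z σ≡0 ne) (sym (value z₀ σ₀ L≢0))))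

    -- The zeros lie in the span of three vectors, of at most eight elements. For y = 0 or y = 1 the
    -- triple is dependent, and the trivial bound Q takes over.
    zero-count : ∀ y → ∑ (λ z → ⟦ σ y z ≟F 0F ⟧) ℤ.≤ + 8 + Q * (δ 0F y + δ 1F y)
    zero-count y with ℘ y ≟F 0F
    ... | yes e = ℤ.≤-trans (∑-mono λ z → ⟦⟧≤1 (σ y z ≟F 0F)) (ℤ.≤-trans (ℤ.≤-reflexive (trans (∑-const n 1ℤ) (sym (trans (cong (Q *_) (one (℘≡0 y e))) refl))))
                    (ℤ.≤-trans (ℤ.≤-reflexive (sym (ℤ.+-identityˡ _))) (ℤ.+-monoˡ-≤ (Q * (δ 0F y + δ 1F y)) {0ℤ} {+ 8} (+≤+ z≤n))))
      where
      ⟦⟧≤1 : ∀ {X : Set} (d : Dec X) → ⟦ d ⟧ ℤ.≤ 1ℤ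
      ⟦⟧≤1 (yes _) = ℤ.≤-refl
      ⟦⟧≤1 (no _)  = +≤+ z≤n
      one : y ≡ 0F ⊎ y ≡ 1F → δ 0F y + δ 1F y ≡ 1ℤ
      one (inj₁ refl) = cong₂ _+_ (δ-refl {n} 0F) (⟦⟧-no (0F {n} ≟F 1F) (λ e′ → 1≢0 (sym e′)))
      one (inj₂ refl) = cong₂ _+_ (⟦⟧-no (1F {n} ≟F 0F) 1≢0) (δ-refl {n} 1F)
    ... | no ne with zeros-of-σ y ne
    ... | z₀ , zeros = begin
      ∑ (λ z → ⟦ σ y z ≟F 0F ⟧)                   ≤⟨ ∑-mono pointwise ⟩
      ∑ (λ z → ∑ {3} (λ c → δ (combo c V) z))     ≡⟨ ∑-swap (λ z c → δ (combo c V) z) ⟩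
      ∑ {3} (λ c → ∑ (λ z → δ (combo c V) z))     ≡⟨ ∑-cong (λ c → ∑-δ (combo c V)) ⟩
      ∑ {3} (λ c → 1ℤ)                            ≡⟨ ∑-const 3 1ℤ ⟩
      + 8                                         ≡⟨ ℤ.+-identityʳ (+ 8) ⟨
      + 8 + 0ℤ                                    ≤⟨ ℤ.+-monoʳ-≤ (+ 8) nonneg ⟩
      + 8 + Q * (δ 0F y + δ 1F y)                 ∎
      where
      open ℤ.≤-Reasoning
      V = z₀ ∷ y ∷ 1F ∷ []
      nonneg : 0ℤ ℤ.≤ Q * (δ 0F y + δ 1F y)
      nonneg = subst (ℤ._≤ Q * (δ 0F y + δ 1F y)) (ℤ.*-zeroʳ Q) (ℤ.*-monoˡ-≤-nonNeg Q (ℤ.+-mono-≤ (⟦⟧≥0 (y ≟F 0F)) (⟦⟧≥0 (y ≟F 1F))))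
      pointwise : ∀ z → ⟦ σ y z ≟F 0F ⟧ ℤ.≤ ∑ {3} (λ c → δ (combo c V) z)
      pointwise z with σ y z ≟F 0F
      ... | no _  = subst (ℤ._≤ ∑ {3} (λ c → δ (combo c V) z)) (∑-ε {3}) (∑-mono λ c → ⟦⟧≥0 (z ≟F combo c V))
      ... | yes e with zeros z e
      ... | c₀ , z≡ = subst (ℤ._≤ ∑ {3} (λ c → δ (combo c V) z)) (∑-δ c₀) (∑-mono λ c → term c)
        where
        term : ∀ c → δ c₀ c ℤ.≤ δ (combo c V) z
        term c with c ≟F c₀
        ... | yes refl = ℤ.≤-reflexive (sym (⟦⟧-yes (z ≟F combo c V) z≡))
        ... | no _     = ⟦⟧≥0 (z ≟F combo c V)

    -- Otherwise `P` is 8 where σ = 0 and 0 elsewhere, so it sums to at most 8(8q + 2q) = 80q,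
    -- against its value q² + 7S.
    good-pair : ∃[ y ] ∃[ z ] σ y z ≢ 0F × tr (σ y z) ≡ false × tr (σ y z · y) ≡ false × tr (σ y z · z) ≡ false
    good-pair with ∃? (λ y → ∃? (λ z → ¬? (σ y z ≟F 0F) ×-dec (tr (σ y z) Bool.≟ false) ×-dec (tr (σ y z · y) Bool.≟ false) ×-dec (tr (σ y z · z) Bool.≟ false)))
    ... | yes found = found
    ... | no none   = ⊥-elim (count-contradiction S S′ T₀ T₁ S+S′≥0 S′≡
                        (T-bound T₀ (signed-G (χ ∘ inv) (χ-square ∘ inv))) (T-bound T₁ (signed-G (λ a → χ (a ⊕ inv a)) (λ a → χ-square (a ⊕ inv a)))) (begin
      Q * Q + + 7 * S                                           ≡⟨ ∑²P ⟨
      ∑² P                                                      ≡⟨ ∑²-cong pointwise ⟩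
      ∑² (λ y z → + 8 * ⟦ σ y z ≟F 0F ⟧)                        ≡⟨ ∑-cong (λ y → ∑-*ˡ (+ 8) (λ z → ⟦ σ y z ≟F 0F ⟧)) ⟩
      ∑ (λ y → + 8 * ∑ (λ z → ⟦ σ y z ≟F 0F ⟧))                 ≤⟨ ∑-mono (λ y → ℤ.*-monoˡ-≤-nonNeg (+ 8) (zero-count y)) ⟩
      ∑ (λ y → + 8 * (+ 8 + Q * (δ 0F y + δ 1F y)))             ≡⟨ ∑-cong (λ y → expand Q (δ 0F y) (δ 1F y)) ⟩
      ∑ (λ y → + 64 + ((+ 8 * Q) * δ 0F y + (+ 8 * Q) * δ 1F y)) ≡⟨ trans (∑-∙ (λ _ → + 64) _) (cong₂ _+_ (∑-const n (+ 64)) (trans (∑-∙ (λ y → (+ 8 * Q) * δ 0F y) _) (cong₂ _+_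
                                                                     (trans (∑-*ˡ (+ 8 * Q) (δ 0F)) (cong ((+ 8 * Q) *_) (∑-δ 0F))) (trans (∑-*ˡ (+ 8 * Q) (δ 1F)) (cong ((+ 8 * Q) *_) (∑-δ 1F)))))) ⟩
      Q * + 64 + ((+ 8 * Q) * 1ℤ + (+ 8 * Q) * 1ℤ)              ≡⟨ collect Q ⟩
      + 80 * Q                                                  ∎))
      where
      open ℤ.≤-Reasoning
      expand : ∀ (Q d e : ℤ) → + 8 * (+ 8 + Q * (d + e)) ≡ + 64 + ((+ 8 * Q) * d + (+ 8 * Q) * e)
      expand = ℤSolver.solve-∀
      collect : ∀ (Q : ℤ) → Q * + 64 + ((+ 8 * Q) * 1ℤ + (+ 8 * Q) * 1ℤ) ≡ + 80 * Q
      collect = ℤSolver.solve-∀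
      pointwise : ∀ y z → P y z ≡ + 8 * ⟦ σ y z ≟F 0F ⟧
      pointwise y z with σ y z ≟F 0F
      ... | yes e = trans (cong₂ (λ p q → (1ℤ + p) * q) (trivial e) (cong₂ (λ p q → (1ℤ + p) * (1ℤ + q))
                      (trivial (trans (cong (_· y) e) (·-zeroˡ y))) (trivial (trans (cong (_· z) e) (·-zeroˡ z))))) refl
        where
        trivial : ∀ {x} → x ≡ 0F → χ x ≡ 1ℤ
        trivial e = trans (cong χ e) χ-0
      ... | no ne = cases (tr (σ y z) Bool.≟ false) (tr (σ y z · y) Bool.≟ false) (tr (σ y z · z) Bool.≟ false)
        where
        cases : Dec (tr (σ y z) ≡ false) → Dec (tr (σ y z · y) ≡ false) → Dec (tr (σ y z · z) ≡ false) → P y z ≡ 0ℤ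
        cases (no t) _ _ = cong (_* ((1ℤ + χ (σ y z · y)) * (1ℤ + χ (σ y z · z)))) (1+χ≡0 (Bool.¬-not t))
        cases (yes _) (no t) _ = trans (cong ((1ℤ + χ (σ y z)) *_) (cong (_* (1ℤ + χ (σ y z · z))) (1+χ≡0 (Bool.¬-not t)))) (ℤ.*-zeroʳ (1ℤ + χ (σ y z)))
        cases (yes _) (yes _) (no t) = trans (cong (λ x → (1ℤ + χ (σ y z)) * ((1ℤ + χ (σ y z · y)) * x)) (1+χ≡0 (Bool.¬-not t)))
          (trans (cong ((1ℤ + χ (σ y z)) *_) (ℤ.*-zeroʳ (1ℤ + χ (σ y z · y)))) (ℤ.*-zeroʳ (1ℤ + χ (σ y z))))
        cases (yes t₁) (yes t₂) (yes t₃) = ⊥-elim (none (y , z , ne , t₁ , t₂ , t₃))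

    -- U = σ·⟨1, y, z⟩ satisfies s U = 1 and lies in the image of ℘ = L ⟨1⟩; its preimage under ℘ has zero sum.
    ZS-4 : ZS 4
    ZS-4 with good-pair
    ... | y , z , σ≢0 , tr-σ , tr-σy , tr-σz = ws ++ (1F ∷ []) , C≢0 , (begin
      s (ws ++ (1F ∷ []))                                    ≡⟨ s-++ ws (1F ∷ []) C≢0 ⟩
      s (1F ∷ []) ⊕ (1F · 1F) · s (map (L (1F ∷ [])) ws)     ≡⟨ cong₂ _⊕_ (trans (s-single 1F) inv-1) (cong₂ _·_ (·-identityˡ 1F) (cong s lifts)) ⟩
      1F ⊕ 1F · s (map (σ y z ·_) V)                         ≡⟨ cong (1F ⊕_) (trans (·-identityˡ _) (s-scale (σ y z) V)) ⟩
      1F ⊕ inv (σ y z) · σ y z                               ≡⟨ cong (1F ⊕_) (·-inverseˡ (σ y z) σ≢0) ⟩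
      1F ⊕ 1F                                                ≡⟨ ⊕-self 1F ⟩
      0F                                                     ∎)
      where
      open ≡-Reasoning
      V ws : Vec (F n) 3
      V  = z ∷ y ∷ 1F ∷ []
      ws = half (σ y z · z) ∷ half (σ y z · y) ∷ half (σ y z · 1F) ∷ []
      lifts : map (L (1F ∷ [])) ws ≡ map (σ y z ·_) V
      lifts = cong₂ _∷_ (℘-half _ tr-σz) (cong₂ _∷_ (℘-half _ tr-σy) (cong (_∷ []) (℘-half _ (trans (cong tr (·-identityʳ _)) tr-σ))))
      CV≢0 : C V ≢ 0F
      CV≢0 e = σ≢0 (C≡0⇒A≡0 V e 0F)
      C≢0 : C (ws ++ (1F ∷ [])) ≢ 0F
      C≢0 e = ·≢0 (subst (λ t → C t ≢ 0F) (sym lifts) (C-scale V σ≢0 CV≢0)) (·≢0 1≢0 1≢0) (trans (sym (C-++ ws (1F ∷ []))) e)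

-- All dimensions

open import Data.Fin using (zero; suc)
open import Data.Nat using (_+_; _*_; _/_)

finiteField : ∀ {n} (p : F (suc n)) → IsFieldModulus p → BinaryField (suc n)
finiteField p field-p = record
  { _·_               = _·_
  ; inv               = finv p
  ; isCommutativeRing = ⊕-·-isCommutativeRing
  ; inv-0             = finv-0
  ; ·-inverseʳ        = finv-inverseʳ field-p
  ; 1≢0               = λ ()
  }
  where open Multiplication p

-- Yields n ≥ 15, and n ≥ 25 as soon as n ≠ 15.
odd-multiple : ∀ m → m * 5 % 2 ≡ 1 → 7 ≤ m * 5 → 3 ≤ m × m ≢ 4
odd-multiple zero                ()  _
odd-multiple (suc zero)          _   (s≤s (s≤s (s≤s (s≤s (s≤s ())))))
odd-multiple (suc (suc zero))    ()  _
odd-multiple (suc (suc (suc m))) odd _ = s≤s (s≤s (s≤s z≤n)) , λ { refl → even odd }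
  where
  even : 20 % 2 ≢ 1
  even ()

module Characterization {n : ℕ} (𝔽 : BinaryField n) (odd : n % 2 ≡ 1) (7≤n : 7 ≤ n) {m : ℕ} (n≡5m : n ≡ m * 5) where

  open BinaryField 𝔽 using (inv)
  open Subspaces 𝔽

  private
    n≡1+2j : n ≡ suc (n / 2 + n / 2)
    n≡1+2j = begin
      n                     ≡⟨ m≡m%n+[m/n]*n n 2 ⟩
      n % 2 + n / 2 * 2     ≡⟨ cong₂ _+_ odd (ℕ.*-comm (n / 2) 2) ⟩
      suc (n / 2 + (n / 2 + 0)) ≡⟨ cong (λ t → suc (n / 2 + t)) (ℕ.+-identityʳ (n / 2)) ⟩
      suc (n / 2 + n / 2)   ∎
      where open ≡-Reasoning

    m-odd : 3 ≤ m × m ≢ 4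
    m-odd = odd-multiple m (subst (λ t → t % 2 ≡ 1) n≡5m odd) (subst (7 ≤_) n≡5m 7≤n)

    3≤m : 3 ≤ m
    3≤m = proj₁ m-odd

    5h≤n : ∀ {h} → h ≤ m → h * 5 ≤ n
    5h≤n {h} h≤m = subst (h * 5 ≤_) (sym n≡5m) (ℕ.*-monoˡ-≤ 5 h≤m)

    15≤n : 15 ≤ n
    15≤n = 5h≤n 3≤m

  open OddSubspaces (n / 2) n≡1+2j
  open CharacterSumEstimates.LowDimensional 𝔽 (n / 2) n≡1+2j (ℕ.^-monoʳ-≤ 2 15≤n)

  private
    generator : ∃[ g ] FieldProperties._^_ 𝔽 g 31 ≡ 1F × g ≢ 1F
    generator = Roots.31-torsion-element 𝔽 m (ℕ.≤-trans (s≤s z≤n) 3≤m) n≡5m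

  open Subfield 𝔽 {proj₁ generator}
  open Degree5 (proj₁ (proj₂ generator)) (proj₂ (proj₂ generator))
  open WithScalar g≢0 (proj₂ (proj₂ generator))

  residue-0 : ∀ j → j ≤ m → ZS (j * 5)
  residue-0 j j≤m = ZS-5h∸ j ZS-0 z≤n (5h≤n j≤m) (ℕ.+-identityʳ (j * 5))

  -- 11 = 5 · 3 - 4 violates l ≤ h. For n = 15 it is dual to 4; for n ≥ 25 it is 3 + (3 + 5), where
  -- the products 15 and 24 stay below n.
  ZS-11 : ZS 11
  ZS-11 with ℕ.m≤n⇒m<n∨m≡n 3≤m
  ... | inj₂ 3≡m = duality (trans (cong (_* 5) 3≡m) (sym n≡5m)) ZS-4
  ... | inj₁ 3<m = sum ZS-3 (sum ZS-3 (residue-0 1 (ℕ.≤-trans (s≤s z≤n) 3≤m)) (ℕ.<-≤-trans (ℕ.m≤m+n 16 9) 25≤n)) 25≤n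
    where
    25≤n : 25 ≤ n
    25≤n = 5h≤n (ℕ.≤∧≢⇒< 3<m (λ 4≡m → proj₂ m-odd (sym 4≡m)))

  residue-2 : ∀ j → 3 ≤ 2 + j * 5 → suc j ≤ m → ZS (2 + j * 5)
  residue-2 zero          (s≤s (s≤s ())) _
  -- 7 = 5 · 2 - 3 violates l ≤ h, but 7 = 3 + 4 with 3 · 4 < 15.
  residue-2 (suc zero)    _ _   = sum ZS-3 ZS-4 (ℕ.<-≤-trans (ℕ.m≤m+n 13 2) 15≤n)
  residue-2 (suc (suc j)) _ h≤m = ZS-5h∸ (3 + j) ZS-3 (s≤s (s≤s (s≤s z≤n))) (5h≤n h≤m) (ℕ.+-comm (2 + (2 + j) * 5) 3)

  residue-1 : ∀ j → 3 ≤ 1 + j * 5 → suc j ≤ m → ZS (1 + j * 5)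
  residue-1 zero                (s≤s ()) _
  -- 6 = 5 · 2 - 4 violates l ≤ h, but 6 = 3 + 3 with 3 · 3 < 15.
  residue-1 (suc zero)          _ _   = sum ZS-3 ZS-3 (ℕ.<-≤-trans (ℕ.m≤m+n 10 5) 15≤n)
  residue-1 (suc (suc zero))    _ _   = ZS-11
  residue-1 (suc (suc (suc j))) _ h≤m = ZS-5h∸ (4 + j) ZS-4 (s≤s (s≤s (s≤s (s≤s z≤n)))) (5h≤n h≤m) (ℕ.+-comm (1 + (3 + j) * 5) 4)

  -- As 5 divides n, the map k ↦ n - k exchanges the residues r and 5 - r, and it turns k ≤ n - 3
  -- into the lower bound 3 required on the other side.
  dual-residue : ∀ {r r′} j → r + r′ ≡ 5 → 2 < r → (∀ i → 3 ≤ r′ + i * 5 → suc i ≤ m → ZS (r′ + i * 5)) →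
                 3 + (r + j * 5) ≤ n → ZS (r + j * 5)
  dual-residue {r} {r′} j r+r′≡5 2<r residue k+3≤n = duality k+k′≡n (residue i 3≤k′ (subst (suc i ≤_) m≡ (s≤s (ℕ.m≤n+m i j))))
    where
    open ℕ.≤-Reasoning
    j<m : suc j ≤ m
    j<m = ℕ.*-cancelʳ-≤ (suc j) m 5 (begin
      5 + j * 5           ≤⟨ ℕ.+-monoˡ-≤ (j * 5) (ℕ.≤-trans (ℕ.n≤1+n 5) (ℕ.+-monoʳ-≤ 3 2<r)) ⟩
      3 + r + j * 5       ≡⟨ ℕ.+-assoc 3 r (j * 5) ⟩
      3 + (r + j * 5)     ≤⟨ k+3≤n ⟩
      n                   ≡⟨ n≡5m ⟩
      m * 5               ∎)
    i = m ∸ suc j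
    m≡ : suc j + i ≡ m
    m≡ = ℕ.m+[n∸m]≡n j<m
    regroup : ∀ r r′ j i → (r + j * 5) + (r′ + i * 5) ≡ (r + r′) + (j + i) * 5
    regroup = ℕSolver.solve-∀
    k+k′≡n : (r + j * 5) + (r′ + i * 5) ≡ n
    k+k′≡n = begin-equality
      (r + j * 5) + (r′ + i * 5)   ≡⟨ regroup r r′ j i ⟩
      (r + r′) + (j + i) * 5       ≡⟨ cong (_+ (j + i) * 5) r+r′≡5 ⟩
      (suc j + i) * 5              ≡⟨ cong (_* 5) m≡ ⟩
      m * 5                        ≡⟨ n≡5m ⟨
      n                            ∎
    3≤k′ : 3 ≤ r′ + i * 5
    3≤k′ = ℕ.+-cancelˡ-≤ (r + j * 5) 3 (r′ + i * 5) (begin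
      r + j * 5 + 3                ≡⟨ ℕ.+-comm (r + j * 5) 3 ⟩
      3 + (r + j * 5)              ≤⟨ k+3≤n ⟩
      n                            ≡⟨ k+k′≡n ⟨
      (r + j * 5) + (r′ + i * 5)   ∎)

  zero-sum-subspaces : ∀ k → 3 ≤ k → 3 + k ≤ n → ZS k
  zero-sum-subspaces k 3≤k 3+k≤n with k divMod 5
  ... | result j zero refl = residue-0 j (ℕ.*-cancelʳ-≤ j m 5 (subst (j * 5 ≤_) n≡5m (ℕ.≤-trans (ℕ.m≤n+m (j * 5) 3) 3+k≤n)))
  -- Here 5j + 4 ≤ 5m is one short of 5(j + 1) ≤ 5m, so the cancellation goes through the strict 5(j
  -- + 1) < 5(m + 1).
  ... | result j (suc zero) refl = residue-1 j 3≤k (ℕ.≤-pred (ℕ.*-cancelʳ-< 5 (suc j) (suc m)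
          (s≤s (ℕ.+-monoʳ-≤ 4 (subst (suc (j * 5) ≤_) n≡5m (ℕ.≤-trans (ℕ.m≤n+m (suc (j * 5)) 3) 3+k≤n))))))
  ... | result j (suc (suc zero)) refl = residue-2 j 3≤k (ℕ.*-cancelʳ-≤ (suc j) m 5 (subst (suc j * 5 ≤_) n≡5m 3+k≤n))
  ... | result j (suc (suc (suc zero))) refl = dual-residue j refl ℕ.≤-refl residue-2 3+k≤n
  ... | result j (suc (suc (suc (suc zero)))) refl = dual-residue j refl (ℕ.n≤1+n 3) residue-1 3+k≤n

  ZS⇒3≤ : ∀ k → 1 ≤ k → ZS k → 3 ≤ k
  ZS⇒3≤ (suc zero)          _ zs = ⊥-elim (¬ZS-1 zs)
  ZS⇒3≤ (suc (suc zero))    _ zs = ⊥-elim (¬ZS-2 zs)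
  ZS⇒3≤ (suc (suc (suc k))) _ _  = s≤s (s≤s (s≤s z≤n))

  characterization : ∀ k → (1 ≤ k × k ≤ n ∸ 1 × ¬ SumFree k inv) ⇔ (3 ≤ k × k ≤ n ∸ 3)
  characterization k = mk⇔ necessary sufficient
    where
    necessary : 1 ≤ k × k ≤ n ∸ 1 × ¬ SumFree k inv → 3 ≤ k × k ≤ n ∸ 3
    necessary (1≤k , k≤n∸1 , ¬sf) =
      ℕ.≮⇒≥ (λ k<3 → ¬sf (¬ZS⇒SumFree (λ zs → ℕ.<⇒≱ k<3 (ZS⇒3≤ k 1≤k zs)))) ,
      ℕ.≮⇒≥ (λ n∸3<k → ¬sf (¬ZS⇒SumFree (λ zs → ℕ.<⇒≱ n∸3<k
        (subst (_≤ n ∸ 3) (ℕ.m∸[m∸n]≡n k≤n) (ℕ.∸-monoʳ-≤ n (ZS⇒3≤ (n ∸ k) 1≤n∸k (duality (ℕ.m∸n+n≡m k≤n) zs)))))))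
      where
      k<n : k < n
      k<n = ℕ.≤-<-trans k≤n∸1 (ℕ.∸-monoʳ-< {n} {1} {0} (s≤s z≤n) (ℕ.≤-trans (s≤s z≤n) 7≤n))
      k≤n : k ≤ n
      k≤n = ℕ.<⇒≤ k<n
      1≤n∸k : 1 ≤ n ∸ k
      1≤n∸k = ℕ.m<n⇒0<n∸m k<n
    sufficient : 3 ≤ k × k ≤ n ∸ 3 → 1 ≤ k × k ≤ n ∸ 1 × ¬ SumFree k inv
    sufficient (3≤k , k≤n∸3) =
      ℕ.≤-trans (s≤s z≤n) 3≤k , ℕ.≤-trans k≤n∸3 (ℕ.∸-monoʳ-≤ n (s≤s z≤n)) ,
      ZS⇒¬SumFree (zero-sum-subspaces k 3≤k (subst (_≤ n) (ℕ.+-comm k 3) (ℕ.m≤o∸n⇒m+n≤o k (ℕ.≤-trans (ℕ.m≤m+n 3 12) 15≤n) k≤n∸3)))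

theorem3p13 : (n : ℕ) → n % 2 ≡ 1 → 7 ≤ n → 5 ∣ n →
    (p : F n) → IsFieldModulus p →
    (k : ℕ) → InK p k ⇔ (3 ≤ k × k ≤ n ∸ 3)
theorem3p13 (suc n) odd 7≤n (divides m n≡5m) p field-p k = Characterization.characterization (finiteField p field-p) odd 7≤n {m} n≡5m k
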